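{- Let $\mathcal R$ be a left-linear TRS. Let $\Phi:w\multimap t$ and $\Psi:w\multimap s$ be multisteps of $\mathcal R$ with the same source term $w$. Then either 1. the peak is non-overlapping, and then there is a term $v$ with $\Psi/\Phi:t\multimap v$ and $\Phi/\Psi:s\multimap v$, where the rule symbols occurring in $\Psi/\Phi$ are contained in those of $\Psi$, and those occurring in $\Phi/\Psi$ are contained in those of $\Phi$; or 2. it can be horizontally decomposed: there are overlapping steps $\phi\in\Phi$ and $\psi\in\Psi$ and terms $t',s'$ such that $\phi:w\to t'$, $\ \Phi/\phi:t'\multimap t$, $\ \psi:w\to s'$ and $\Psi/\psi:s'\multimap s$.
   Context: **Terms.** Terms are built from function symbols, 2nd-order variables $X,Y,\dots$ (each with an arity) and 1st-order variables $x,y,\dots$; a 1st-order term contains no 2nd-order variables. For each rule $\varrho$ of $\mathcal R$ there is a rule symbol, written $\varrho(\vec x):\ell\to r$ with $\vec x$ the variables of $\ell$ in order of occurrence. **Multipatterns and multisteps.** Consider let-expressions $\mathsf{let}\ X_1,\dots,X_n=\lambda\vec x_1.s_1,\dots,\lambda\vec x_n.s_n\ \mathsf{in}\ M$ ($n\ge 0$) with pairwise distinct 2nd-order variables $X_i$, closed $\lambda\vec x_i.s_i$ with $|\vec x_i|$ the arity of $X_i$, and $M$ (the body) a term with 2nd-order variables among the $X_i$, that are linear (each $X_i$ occurs exactly once in $M$ and each variable of $\vec x_i$ exactly once in $s_i$) and canonical ($X_i$'s listed in order of occurrence in the pre-order walk of $M$, and likewise $\vec x_i$ in $s_i$), up to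 renaming of bound variables; the $\lambda$-prefixes are usually omitted. Such an expression is a multipattern if each $s_i$ is a non-variable 1st-order term, and a multistep of $\mathcal R$ if each $s_i$ has shape $\varrho(\vec x_i)$ for a rule symbol $\varrho$ of $\mathcal R$; a step is a multistep with $n=1$. The denotation $[\![\cdot]\!]$ is the result of 2nd-order substituting $\lambda\vec x_i.s_i$ for $X_i$ in $M$. For a multistep $\Phi=\mathsf{let}\ \vec X=\vec{\varrho(\vec x)}\ \mathsf{in}\ M$ with rules $\varrho_i(\vec x_i):\ell_i\to r_i$, $\mathsf{src}(\Phi)=\mathsf{let}\ \vec X=\vec\ell\ \mathsf{in}\ M$ (a multipattern by left-linearity) and $\mathsf{tgt}(\Phi)=\mathsf{let}\ \vec X=\vec r\ \mathsf{in}\ M$; $\Phi:t\multimap s$ means $t=[\![\mathsf{src}(\Phi)]\!]$ and $s=[\![\mathsf{tgt}(\Phi)]\!]$; for steps we write $\to$ instead of $\multimap$. **Refinement lattice and overlap.** For multipatterns $\varsigma=\mathsf{let}\ \vec X=\vec s\ \mathsf{in}\ M$ and $\zeta=\mathsf{let}\ \vec Y=\vec u\ \mathsf{in}\ N$, $\varsigma\sqsubseteq\zeta$ if there is a 2nd-order substitution $\sigma$ on $\vec Y$ with $N^\sigma=M$ and $[\![\mathsf{let}\ \vec X=\vec s\ \mathsf{in}\ (Y_i(\vec y_i))^\sigma]\!]=u_i$ for all $i$, with $\vec y_i$ the variables of $u_i$. On multipatterns denoting a fixed 1st-order term, $\sqsubseteq$ is a finite distributive lattice with meet $\sqcap$,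 join $\sqcup$, least element $\bot$ and greatest element $\top$. Multisteps $\Phi,\Psi$ with the same source term are overlapping if $\mathsf{src}(\Phi)\sqcap\mathsf{src}(\Psi)\neq\bot$. **Joins and residuals.** Let $\Phi=\mathsf{let}\ \vec X=\vec{\varrho(\vec x)}\ \mathsf{in}\ M$ and $\Psi=\mathsf{let}\ \vec Y=\vec{\theta(\vec y)}\ \mathsf{in}\ N$ be non-overlapping multisteps with the same source term, for rules $\varrho_i(\vec x_i):\ell_i\to r_i$ and $\theta_j(\vec y_j):g_j\to d_j$. Then $\mathsf{src}(\Phi)\sqcup\mathsf{src}(\Psi)$ is $\mathsf{let}\ \vec X\vec Y=\vec\ell\,\vec g\ \mathsf{in}\ L$ (up to canonical reordering of bindings) for some $L$ with $L[\![\vec Y:=\vec g]\!]=M$ and $L[\![\vec X:=\vec\ell]\!]=N$. The join is $\Phi\sqcup\Psi=\mathsf{let}\ \vec X\vec Y=\vec{\varrho(\vec x)}\,\vec{\theta(\vec y)}\ \mathsf{in}\ L$, and the residual is $\Phi/\Psi=\mathsf{let}\ \vec X=\vec{\varrho(\vec x)}\ \mathsf{in}\ L[\![\vec Y:=\vec d]\!]$, implicitly made canonical and linear by reordering, deleting and replicating let-bindings (symmetrically for $\Psi/\Phi$). For a step $\phi$, $\phi\in\Phi$ means $\Phi=\phi\sqcup\Phi'$ for some multistep $\Phi'$ (non-overlapping with $\phi$), and then $\Phi/\phi$ denotes $\Phi'/\phi$. -}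

module Defs where

open import Data.Fin using (Fin)
open import Data.Fin.Properties using (_≟_)
open import Data.List using (List; []; _∷_; _++_; length; deduplicate; allFin)
open import Data.List.Membership.Propositional using (_∈_)
open import Data.List.Membership.Propositional.Properties using (∈-++⁺ˡ; ∈-++⁺ʳ)
open import Data.List.Relation.Unary.All as All using (All; []; _∷_)
open import Data.List.Relation.Unary.All.Properties using (++⁺)
open import Data.List.Relation.Unary.Any using (here; there)
open import Data.List.Relation.Unary.Unique.Propositional using (Unique)
open import Data.Nat using (ℕ)
open import Data.Product using (∃; ∃-syntax; _×_)
open import Data.Sum using ([_,_]′)
open import Data.Vec as Vec using (Vec; []; _∷_)
open import Function using (id)
open import Relation.Binary.PropositionalEquality using (_≡_; _≢_; refl)
open import Relation.Nullary using (¬_)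
open import Relation.Unary using (∅; _∪_)

-- Families of symbols indexed by arity; used for function symbols, rule
-- symbols and 2nd-order variables alike.
Symbols : Set₁
Symbols = ℕ → Set

data Term (F Γ : Symbols) (V : Set) : Set where
  var : V → Term F Γ V
  fun : ∀ {k} → F k → Vec (Term F Γ V) k → Term F Γ V
  app : ∀ {k} → Γ k → Vec (Term F Γ V) k → Term F Γ V

FOTerm : Symbols → Set → Set
FOTerm F V = Term F ∅ V

-- Closed abstractions λx₁…xₖ.s, with s a 1st-order term.
Abs : Symbols → Symbols
Abs F k = FOTerm F (Fin k)

module _ {F Γ Δ : Symbols} {V : Set} (f : ∀ {k} → Γ k → Δ k) where

  mutual
    rename₂ : Term F Γ V → Term F Δ V
    rename₂ (var x)    = var x
    rename₂ (fun g ts) = fun g (rename₂* ts)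
    rename₂ (app X ts) = app (f X) (rename₂* ts)

    rename₂* : ∀ {n} → Vec (Term F Γ V) n → Vec (Term F Δ V) n
    rename₂* []       = []
    rename₂* (t ∷ ts) = rename₂ t ∷ rename₂* ts

module _ {F Γ : Symbols} {V : Set} where

  NonVariable : Term F Γ V → Set
  NonVariable t = ∀ x → t ≢ var x

  mutual
    vars : Term F Γ V → List V
    vars (var x)    = x ∷ []
    vars (fun _ ts) = vars* ts
    vars (app _ ts) = vars* ts

    vars* : ∀ {n} → Vec (Term F Γ V) n → List V
    vars* []       = []
    vars* (t ∷ ts) = vars t ++ vars* ts

  -- Arities and names of all 2nd-order variable occurrences, with repetitions,
  -- in pre-order.
  mutual
    arities : Term F Γ V → List ℕ
    arities (var _)        = []
    arities (fun _ ts)     = arities* ts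
    arities (app {k} _ ts) = k ∷ arities* ts

    arities* : ∀ {n} → Vec (Term F Γ V) n → List ℕ
    arities* []       = []
    arities* (t ∷ ts) = arities t ++ arities* ts

  mutual
    occurrences : (t : Term F Γ V) → All Γ (arities t)
    occurrences (var _)    = []
    occurrences (fun _ ts) = occurrences* ts
    occurrences (app X ts) = X ∷ occurrences* ts

    occurrences* : ∀ {n} (ts : Vec (Term F Γ V) n) → All Γ (arities* ts)
    occurrences* []       = []
    occurrences* (t ∷ ts) = ++⁺ (occurrences t) (occurrences* ts)

  -- Gives every occurrence of a 2nd-order variable a name of its own.
  mutual
    split : (t : Term F Γ V) → Term F (_∈ arities t) V
    split (var x)    = var x
    split (fun g ts) = fun g (split* ts)
    split (app _ ts) = app (here refl) (rename₂* there (split* ts))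

    split* : ∀ {n} (ts : Vec (Term F Γ V) n) → Vec (Term F (_∈ arities* ts) V) n
    split* []       = []
    split* (t ∷ ts) = rename₂ ∈-++⁺ˡ (split t)
                    ∷ rename₂* (∈-++⁺ʳ (arities t)) (split* ts)

embed : ∀ {F Γ V} → FOTerm F V → Term F Γ V
embed = rename₂ λ ()

module _ {F Γ : Symbols} {V W : Set} (τ : V → Term F Γ W) where

  mutual
    subst₁ : Term F Γ V → Term F Γ W
    subst₁ (var x)    = τ x
    subst₁ (fun g ts) = fun g (subst₁* ts)
    subst₁ (app X ts) = app X (subst₁* ts)

    subst₁* : ∀ {n} → Vec (Term F Γ V) n → Vec (Term F Γ W) n
    subst₁* []       = []
    subst₁* (t ∷ ts) = subst₁ t ∷ subst₁* ts

-- A 2nd-order substitution maps each X of arity k to a closed λx₁…xₖ.s.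
Subst₂ : Symbols → Symbols → Symbols → Set
Subst₂ F Γ Δ = ∀ {k} → Γ k → Term F Δ (Fin k)

module _ {F Γ Δ : Symbols} {V : Set} (σ : Subst₂ F Γ Δ) where

  mutual
    subst₂ : Term F Γ V → Term F Δ V
    subst₂ (var x)    = var x
    subst₂ (fun g ts) = fun g (subst₂* ts)
    subst₂ (app X ts) = subst₁ (Vec.lookup (subst₂* ts)) (σ X)

    subst₂* : ∀ {n} → Vec (Term F Γ V) n → Vec (Term F Δ V) n
    subst₂* []       = []
    subst₂* (t ∷ ts) = subst₂ t ∷ subst₂* ts

-- The term X(x₁,…,xₖ).
generic : ∀ {F Γ} → Subst₂ F Γ Γ
generic X = app X (Vec.map var (Vec.allFin _))

-- let-expressions binding 2nd-order variables to elements of B: either closed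
-- abstractions, or rule symbols ϱ standing for λx⃗.ϱ(x⃗).  The bound variables
-- are the positions in the list of arities, so α-equivalence is equality.
record Let (F B : Symbols) (V : Set) : Set where
  constructor let[_]_
  field
    {context} : List ℕ
    binds     : All B context
    body      : Term F (_∈ context) V

  bound : ∀ {k} → k ∈ context → B k
  bound = All.lookup binds

open Let public

-- Each bound 2nd-order variable occurs exactly once in the body, in order.
LinearCanonical : ∀ {F B V} → Let F B V → Set
LinearCanonical e = All.toList (occurrences (body e)) ≡
                    All.toList (All.tabulate {xs = context e} id)

-- From a let-expression that need not be linear or canonical, and whose
-- variables come from an arbitrary family, the linear and canonical one
-- obtained by reordering, deleting and replicating bindings.
canonise : ∀ {F Γ B V} → (∀ {k} → Γ k → B k) → Term F Γ V → Let F B V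
canonise b t = let[ All.map b (occurrences t) ] split t

⟦_⟧ : ∀ {F V} → Let F (Abs F) V → FOTerm F V
⟦ e ⟧ = subst₂ (bound e) (body e)

record Multipattern {F V} (ς : Let F (Abs F) V) : Set where
  field
    linearCanonical       : LinearCanonical ς
    nonVariable           : ∀ {k} (X : k ∈ context ς) → NonVariable (bound ς X)
    boundLinearCanonical  : ∀ {k} (X : k ∈ context ς) → vars (bound ς X) ≡ allFin k

infix 4 _⊑_

record _⊑_ {F V} (ς ζ : Let F (Abs F) V) : Set where
  field
    σ          : Subst₂ F (_∈ context ζ) (_∈ context ς)
    body-σ     : subst₂ σ (body ζ) ≡ body ς
    pattern-σ  : ∀ {k} (Y : k ∈ context ζ) →
                 ⟦ let[ binds ς ] subst₂ σ (generic Y) ⟧ ≡ bound ζ Y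

-- The poset of multipatterns denoting w.
module _ {F V} (w : FOTerm F V) where

  record MultipatternOf (ς : Let F (Abs F) V) : Set where
    field
      multipattern : Multipattern ς
      denotes      : ⟦ ς ⟧ ≡ w

  record IsMeet (ς ζ μ : Let F (Abs F) V) : Set where
    field
      member    : MultipatternOf μ
      lowerˡ    : μ ⊑ ς
      lowerʳ    : μ ⊑ ζ
      greatest  : ∀ ν → MultipatternOf ν → ν ⊑ ς → ν ⊑ ζ → ν ⊑ μ

  record IsJoin (ς ζ μ : Let F (Abs F) V) : Set where
    field
      member  : MultipatternOf μ
      upperˡ  : ς ⊑ μ
      upperʳ  : ζ ⊑ μ
      least   : ∀ ν → MultipatternOf ν → ς ⊑ ν → ζ ⊑ ν → μ ⊑ ν

  record IsBottom (μ : Let F (Abs F) V) : Set where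
    field
      member  : MultipatternOf μ
      least   : ∀ ν → MultipatternOf ν → μ ⊑ ν

-- Variables of a rule are named by their order of first occurrence in the
-- left-hand side; in particular right-hand sides have no other variables.
record TRS (F : Symbols) : Set₁ where
  field
    Rule             : Symbols
    lhs rhs          : ∀ {k} → Rule k → Abs F k
    lhs-nonVariable  : ∀ {k} (ϱ : Rule k) → NonVariable (lhs ϱ)
    lhs-vars         : ∀ {k} (ϱ : Rule k) → deduplicate _≟_ (vars (lhs ϱ)) ≡ allFin k

LeftLinear : ∀ {F} → TRS F → Set
LeftLinear R = ∀ {k} (ϱ : Rule k) → Unique (vars (lhs ϱ))
  where open TRS R

module Multisteps {F : Symbols} (R : TRS F) (V : Set) where

  open TRS R

  RuleLet : Set
  RuleLet = Let F Rule V

  src tgt : RuleLet → Let F (Abs F) V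
  src Φ = let[ All.map lhs (binds Φ) ] body Φ
  tgt Φ = let[ All.map rhs (binds Φ) ] body Φ

  ruleSymbols : RuleLet → List (∃ Rule)
  ruleSymbols Φ = All.toList (binds Φ)

  -- The arguments ϱ(x⃗) of the bindings are linear and canonical by
  -- construction.
  Multistep : RuleLet → Set
  Multistep = LinearCanonical

  infix 4 _∶_⊸_ _∶_⟶_

  record _∶_⊸_ (Φ : RuleLet) (t s : FOTerm F V) : Set where
    field
      multistep  : Multistep Φ
      source     : t ≡ ⟦ src Φ ⟧
      target     : s ≡ ⟦ tgt Φ ⟧

  _∶_⟶_ : RuleLet → FOTerm F V → FOTerm F V → Set
  φ ∶ t ⟶ s = length (context φ) ≡ 1 × φ ∶ t ⊸ s

  Overlapping : FOTerm F V → RuleLet → RuleLet → Set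
  Overlapping w Φ Ψ = ∃[ μ ] IsMeet w (src Φ) (src Ψ) μ × ¬ IsBottom w μ

  NonOverlapping : FOTerm F V → RuleLet → RuleLet → Set
  NonOverlapping w Φ Ψ = ¬ Overlapping w Φ Ψ

  -- The body L of Φ ⊔ Ψ, in which variables of Φ and of Ψ are kept apart.
  -- For multisteps of a left-linear TRS, L is linear by the two equations.
  record JoinBody (w : FOTerm F V) (Φ Ψ : RuleLet) : Set where
    field
      L : Term F ((_∈ context Φ) ∪ (_∈ context Ψ)) V

    instˡ : (∀ {k} → k ∈ context Φ → Abs F k) → Term F (_∈ context Ψ) V
    instˡ s = subst₂ [ (λ X → embed (s X)) , generic ]′ L

    instʳ : (∀ {k} → k ∈ context Ψ → Abs F k) → Term F (_∈ context Φ) V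
    instʳ s = subst₂ [ generic , (λ Y → embed (s Y)) ]′ L

    field
      instʳ-lhs  : instʳ (bound (src Ψ)) ≡ body Φ
      instˡ-lhs  : instˡ (bound (src Φ)) ≡ body Ψ
      isJoin     : IsJoin w (src Φ) (src Ψ)
                     (canonise [ bound (src Φ) , bound (src Ψ) ]′ L)

    join : RuleLet
    join = canonise [ bound Φ , bound Ψ ]′ L

    -- Φ / Ψ
    residualˡ : RuleLet
    residualˡ = canonise (bound Φ) (instʳ (bound (tgt Ψ)))

    -- Ψ / Φ
    residualʳ : RuleLet
    residualʳ = canonise (bound Ψ) (instˡ (bound (tgt Φ)))

  -- φ ∈ Φ, witnessed by a multistep Φ′ with Φ = φ ⊔ Φ′.
  record _∈[_]_ (φ : RuleLet) (w : FOTerm F V) (Φ : RuleLet) : Set where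
    field
      rest            : RuleLet
      rest-multistep  : Multistep rest
      rest-source     : w ≡ ⟦ src rest ⟧
      nonOverlapping  : NonOverlapping w φ rest
      joinBody        : JoinBody w φ rest
      decomposition   : Φ ≡ JoinBody.join joinBody

    -- Φ / φ, that is Φ′ / φ
    residual : RuleLet
    residual = JoinBody.residualʳ joinBody

{-# OPTIONS --safe #-}
module Submission where

-- A multipattern of w amounts to a marking of the function symbols of w with
-- plain < start < cont: outside all patterns, at the root of a pattern, or in the
-- pattern of the parent symbol.  Under this correspondence refinement is the
-- pointwise order, so meets are pointwise minima, and two multisteps overlap iff
-- some symbol is marked non-plain by both.  If there is no such symbol, the bodies
-- of the multisteps amalgamate to a term L that restricts to each of them, whose
-- marking is the pointwise maximum; both residuals then lead to the instance of L by
-- all right-hand sides.  If there is one, colouring the pattern occurrence through it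
-- in each multistep yields the overlapping steps; the amalgam of a step and its
-- complement is the multistep itself, because an amalgam is determined by its two
-- restrictions.

open import Defs
open import Data.Empty using (⊥-elim)
open import Data.Fin as Fin using (Fin; _↑ˡ_; _↑ʳ_)
open import Data.Fin.Properties using (_≟_)
open import Data.List as List using (List; []; _∷_; _++_; allFin; concatMap; deduplicate; length)
open import Data.List.Membership.Propositional using (_∈_)
open import Data.List.Membership.Propositional.Properties
  using (∈-++⁺ˡ; ∈-++⁺ʳ; ∈-++⁻; ∈-allFin; ∈-map⁺; ∈-map⁻)
import Data.List.Properties as Listₚ
open import Data.List.Relation.Binary.Subset.Propositional using (_⊆_)
open import Data.List.Relation.Unary.All as All using (All; []; _∷_)
open import Data.List.Relation.Unary.All.Properties as Allₚ using (++⁺)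
open import Data.List.Relation.Unary.AllPairs using ([]; _∷_)
open import Data.List.Relation.Unary.Any using (here; there)
open import Data.List.Relation.Unary.Unique.Propositional using (Unique)
open import Data.List.Relation.Unary.Unique.Propositional.Properties using (allFin⁺)
open import Data.Nat using (ℕ; zero; suc) renaming (_+_ to _+ℕ_)
open import Data.Nat.Properties using (suc-injective)
open import Data.Product using (Σ-syntax; ∃; ∃-syntax; _×_; _,_; proj₁; proj₂; map₂)
open import Data.Sum using (_⊎_; inj₁; inj₂; [_,_]′)
open import Data.Vec as Vec using (Vec; []; _∷_)
import Data.Vec.Properties as Vecₚ
open import Data.Vec.Relation.Binary.Pointwise.Inductive as Pointwise using (Pointwise; []; _∷_)
open import Data.Vec.Relation.Unary.All using ([]; _∷_) renaming (All to VecAll)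
import Data.Vec.Relation.Unary.All.Properties as VecAllₚ
open import Function using (id; _∘_)
open import Relation.Binary.PropositionalEquality hiding (J; [_]) renaming (subst₂ to transport₂)
open import Relation.Nullary using (¬_; Dec; yes; no)
open import Relation.Unary using (∅; _∪_)

-- A pattern of one term has to be compared with symbols of the other, while the arguments of the
-- two terms hang below different positions, so a simultaneous structural recursion on both terms
-- gets stuck. One term therefore drives the recursion. The other is decomposed along a pattern into
-- a term whose leaves carry the piece found there together with evidence about it. As the pattern
-- is linear, `choose` turns the leaves into a function on its argument positions, and the recursion
-- continues on the argument vector of the driving term. Pieces thus arrive as functions on `Fin n`,
-- and reassembling is a substitution on the labelled leaves. The constructions work over arbitrary
-- families of 2nd-order variables, without asking for linear bodies: positions in a context would
-- have to be adjusted at each split. Let-expressions are re-entered through `canonise`, and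
-- equality of linear canonical ones is reduced to equality of terms by `toTerm`.

private variable
  k m n : ℕ
  F Γ Δ B : Symbols
  A U V W : Set

-- Calculus of 1st-order and 2nd-order substitution

module _ {F Γ : Symbols} {V W : Set} {τ τ′ : V → Term F Γ W} where
  mutual
    subst₁-cong-vars : (t : Term F Γ V) → (∀ {x} → x ∈ vars t → τ x ≡ τ′ x) → subst₁ τ t ≡ subst₁ τ′ t
    subst₁-cong-vars (var x)    e = e (here refl)
    subst₁-cong-vars (fun g ts) e = cong (fun g) (subst₁*-cong-vars ts e)
    subst₁-cong-vars (app X ts) e = cong (app X) (subst₁*-cong-vars ts e)

    subst₁*-cong-vars : (ts : Vec (Term F Γ V) n) → (∀ {x} → x ∈ vars* ts → τ x ≡ τ′ x) → subst₁* τ ts ≡ subst₁* τ′ ts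
    subst₁*-cong-vars []       e = refl
    subst₁*-cong-vars (t ∷ ts) e =
      cong₂ _∷_ (subst₁-cong-vars t (e ∘ ∈-++⁺ˡ)) (subst₁*-cong-vars ts (e ∘ ∈-++⁺ʳ (vars t)))

  subst₁-cong : (∀ x → τ x ≡ τ′ x) → (t : Term F Γ V) → subst₁ τ t ≡ subst₁ τ′ t
  subst₁-cong e t = subst₁-cong-vars t (λ {x} _ → e x)

  subst₁*-cong : (∀ x → τ x ≡ τ′ x) → (ts : Vec (Term F Γ V) n) → subst₁* τ ts ≡ subst₁* τ′ ts
  subst₁*-cong e ts = subst₁*-cong-vars ts (λ {x} _ → e x)

  mutual
    -- A substitution can be recovered on the variables that occur. A linear pattern contains all of
    -- its variables, so its arguments can be recovered from an instance.
    subst₁-injective-vars : (t : Term F Γ V) → subst₁ τ t ≡ subst₁ τ′ t → ∀ {x} → x ∈ vars t → τ x ≡ τ′ x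
    subst₁-injective-vars (var x)    e (here refl) = e
    subst₁-injective-vars (fun g ts) e i = subst₁*-injective-vars ts (fun-injective e) i
      where fun-injective : ∀ {k} {g : F k} {us us′ : Vec (Term F Γ W) k} → fun g us ≡ fun g us′ → us ≡ us′
            fun-injective refl = refl
    subst₁-injective-vars (app X ts) e i = subst₁*-injective-vars ts (app-injective e) i
      where app-injective : ∀ {k} {X : Γ k} {us us′ : Vec (Term F Γ W) k} → app X us ≡ app X us′ → us ≡ us′
            app-injective refl = refl

    subst₁*-injective-vars : (ts : Vec (Term F Γ V) n) → subst₁* τ ts ≡ subst₁* τ′ ts →
                             ∀ {x} → x ∈ vars* ts → τ x ≡ τ′ x
    subst₁*-injective-vars (t ∷ ts) e i with ∈-++⁻ (vars t) i
    ... | inj₁ j = subst₁-injective-vars t (Vecₚ.∷-injectiveˡ e) j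
    ... | inj₂ j = subst₁*-injective-vars ts (Vecₚ.∷-injectiveʳ e) j

module _ {F Γ : Symbols} {U V W : Set} {τ : V → Term F Γ W} {ρ : U → Term F Γ V} where
  mutual
    subst₁-subst₁ : (t : Term F Γ U) → subst₁ τ (subst₁ ρ t) ≡ subst₁ (subst₁ τ ∘ ρ) t
    subst₁-subst₁ (var x)    = refl
    subst₁-subst₁ (fun g ts) = cong (fun g) (subst₁*-subst₁* ts)
    subst₁-subst₁ (app X ts) = cong (app X) (subst₁*-subst₁* ts)

    subst₁*-subst₁* : (ts : Vec (Term F Γ U) n) → subst₁* τ (subst₁* ρ ts) ≡ subst₁* (subst₁ τ ∘ ρ) ts
    subst₁*-subst₁* []       = refl
    subst₁*-subst₁* (t ∷ ts) = cong₂ _∷_ (subst₁-subst₁ t) (subst₁*-subst₁* ts)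

mutual
  subst₁-var : (t : Term F Γ V) → subst₁ var t ≡ t
  subst₁-var (var x)    = refl
  subst₁-var (fun g ts) = cong (fun g) (subst₁*-var ts)
  subst₁-var (app X ts) = cong (app X) (subst₁*-var ts)

  subst₁*-var : (ts : Vec (Term F Γ V) n) → subst₁* var ts ≡ ts
  subst₁*-var []       = refl
  subst₁*-var (t ∷ ts) = cong₂ _∷_ (subst₁-var t) (subst₁*-var ts)

rename₁ : (V → W) → Term F Γ V → Term F Γ W
rename₁ f = subst₁ (var ∘ f)

rename₁* : (V → W) → Vec (Term F Γ V) n → Vec (Term F Γ W) n
rename₁* f = subst₁* (var ∘ f)

lookup-subst₁* : {τ : V → Term F Γ W} (ts : Vec (Term F Γ V) n) (i : Fin n) →
                 Vec.lookup (subst₁* τ ts) i ≡ subst₁ τ (Vec.lookup ts i)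
lookup-subst₁* (t ∷ ts) Fin.zero    = refl
lookup-subst₁* (t ∷ ts) (Fin.suc i) = lookup-subst₁* ts i

subst₁*-lookup : (ts : Vec (Term F Γ V) n) → subst₁* (Vec.lookup ts) (Vec.map var (Vec.allFin n)) ≡ ts
subst₁*-lookup {F} {Γ} {V} ts = trans (lemma (Vec.allFin _)) (Vecₚ.map-lookup-allFin ts)
  where
  lemma : ∀ {m} (is : Vec (Fin _) m) → subst₁* (Vec.lookup ts) (Vec.map var is) ≡ Vec.map (Vec.lookup ts) is
  lemma []       = refl
  lemma (i ∷ is) = cong (Vec.lookup ts i ∷_) (lemma is)

module _ {F Γ Δ : Symbols} {f f′ : ∀ {k} → Γ k → Δ k} (e : ∀ {k} (X : Γ k) → f X ≡ f′ X) where
  mutual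
    rename₂-cong : (t : Term F Γ V) → rename₂ f t ≡ rename₂ f′ t
    rename₂-cong (var x)    = refl
    rename₂-cong (fun g ts) = cong (fun g) (rename₂*-cong ts)
    rename₂-cong (app X ts) = cong₂ app (e X) (rename₂*-cong ts)

    rename₂*-cong : (ts : Vec (Term F Γ V) n) → rename₂* f ts ≡ rename₂* f′ ts
    rename₂*-cong []       = refl
    rename₂*-cong (t ∷ ts) = cong₂ _∷_ (rename₂-cong t) (rename₂*-cong ts)

module _ {F Γ Δ Θ : Symbols} {f : ∀ {k} → Δ k → Θ k} {g : ∀ {k} → Γ k → Δ k} where
  mutual
    rename₂-rename₂ : (t : Term F Γ V) → rename₂ f (rename₂ g t) ≡ rename₂ (f ∘ g) t
    rename₂-rename₂ (var x)    = refl
    rename₂-rename₂ (fun h ts) = cong (fun h) (rename₂*-rename₂* ts)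
    rename₂-rename₂ (app X ts) = cong (app _) (rename₂*-rename₂* ts)

    rename₂*-rename₂* : (ts : Vec (Term F Γ V) n) → rename₂* f (rename₂* g ts) ≡ rename₂* (f ∘ g) ts
    rename₂*-rename₂* []       = refl
    rename₂*-rename₂* (t ∷ ts) = cong₂ _∷_ (rename₂-rename₂ t) (rename₂*-rename₂* ts)

mutual
  rename₂-id : (t : Term F Γ V) → rename₂ id t ≡ t
  rename₂-id (var x)    = refl
  rename₂-id (fun g ts) = cong (fun g) (rename₂*-id ts)
  rename₂-id (app X ts) = cong (app X) (rename₂*-id ts)

  rename₂*-id : (ts : Vec (Term F Γ V) n) → rename₂* id ts ≡ ts
  rename₂*-id []       = refl
  rename₂*-id (t ∷ ts) = cong₂ _∷_ (rename₂-id t) (rename₂*-id ts)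

module _ {F Γ Δ : Symbols} {f : ∀ {k} → Γ k → Δ k} {τ : V → Term F Γ W} where
  mutual
    rename₂-subst₁ : (t : Term F Γ V) → rename₂ f (subst₁ τ t) ≡ subst₁ (rename₂ f ∘ τ) (rename₂ f t)
    rename₂-subst₁ (var x)    = refl
    rename₂-subst₁ (fun g ts) = cong (fun g) (rename₂*-subst₁* ts)
    rename₂-subst₁ (app X ts) = cong (app _) (rename₂*-subst₁* ts)

    rename₂*-subst₁* : (ts : Vec (Term F Γ V) n) →
                       rename₂* f (subst₁* τ ts) ≡ subst₁* (rename₂ f ∘ τ) (rename₂* f ts)
    rename₂*-subst₁* []       = refl
    rename₂*-subst₁* (t ∷ ts) = cong₂ _∷_ (rename₂-subst₁ t) (rename₂*-subst₁* ts)

lookup-rename₂* : {f : ∀ {k} → Γ k → Δ k} (ts : Vec (Term F Γ V) n) (i : Fin n) →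
                  Vec.lookup (rename₂* f ts) i ≡ rename₂ f (Vec.lookup ts i)
lookup-rename₂* (t ∷ ts) Fin.zero    = refl
lookup-rename₂* (t ∷ ts) (Fin.suc i) = lookup-rename₂* ts i

lookup-subst₂* : {σ : Subst₂ F Γ Δ} (ts : Vec (Term F Γ V) n) (i : Fin n) →
                 Vec.lookup (subst₂* σ ts) i ≡ subst₂ σ (Vec.lookup ts i)
lookup-subst₂* (t ∷ ts) Fin.zero    = refl
lookup-subst₂* (t ∷ ts) (Fin.suc i) = lookup-subst₂* ts i

module _ {F Γ Δ : Symbols} {σ σ′ : Subst₂ F Γ Δ} (e : ∀ {k} (X : Γ k) → σ X ≡ σ′ X) where
  mutual
    subst₂-cong : (t : Term F Γ V) → subst₂ σ t ≡ subst₂ σ′ t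
    subst₂-cong (var x)    = refl
    subst₂-cong (fun g ts) = cong (fun g) (subst₂*-cong ts)
    subst₂-cong (app X ts) = cong₂ (λ us → subst₁ (Vec.lookup us)) (subst₂*-cong ts) (e X)

    subst₂*-cong : (ts : Vec (Term F Γ V) n) → subst₂* σ ts ≡ subst₂* σ′ ts
    subst₂*-cong []       = refl
    subst₂*-cong (t ∷ ts) = cong₂ _∷_ (subst₂-cong t) (subst₂*-cong ts)

module _ {F Γ Δ Θ : Symbols} {σ : Subst₂ F Δ Θ} {f : ∀ {k} → Γ k → Δ k} where
  mutual
    subst₂-rename₂ : (t : Term F Γ V) → subst₂ σ (rename₂ f t) ≡ subst₂ (σ ∘ f) t
    subst₂-rename₂ (var x)    = refl
    subst₂-rename₂ (fun g ts) = cong (fun g) (subst₂*-rename₂* ts)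
    subst₂-rename₂ (app X ts) = cong (λ us → subst₁ (Vec.lookup us) (σ (f X))) (subst₂*-rename₂* ts)

    subst₂*-rename₂* : (ts : Vec (Term F Γ V) n) → subst₂* σ (rename₂* f ts) ≡ subst₂* (σ ∘ f) ts
    subst₂*-rename₂* []       = refl
    subst₂*-rename₂* (t ∷ ts) = cong₂ _∷_ (subst₂-rename₂ t) (subst₂*-rename₂* ts)

module _ {F Γ Δ : Symbols} {σ : Subst₂ F Γ Δ} {τ : V → Term F Γ W} where
  mutual
    subst₂-subst₁ : (t : Term F Γ V) → subst₂ σ (subst₁ τ t) ≡ subst₁ (subst₂ σ ∘ τ) (subst₂ σ t)
    subst₂-subst₁ (var x)    = refl
    subst₂-subst₁ (fun g ts) = cong (fun g) (subst₂*-subst₁* ts)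
    subst₂-subst₁ (app X ts) = begin
      subst₁ (Vec.lookup (subst₂* σ (subst₁* τ ts))) (σ X)
        ≡⟨ cong (λ us → subst₁ (Vec.lookup us) (σ X)) (subst₂*-subst₁* ts) ⟩
      subst₁ (Vec.lookup (subst₁* (subst₂ σ ∘ τ) (subst₂* σ ts))) (σ X)
        ≡⟨ subst₁-cong (lookup-subst₁* (subst₂* σ ts)) (σ X) ⟩
      subst₁ (subst₁ (subst₂ σ ∘ τ) ∘ Vec.lookup (subst₂* σ ts)) (σ X)
        ≡⟨ subst₁-subst₁ (σ X) ⟨
      subst₁ (subst₂ σ ∘ τ) (subst₁ (Vec.lookup (subst₂* σ ts)) (σ X)) ∎
      where open ≡-Reasoning

    subst₂*-subst₁* : (ts : Vec (Term F Γ V) n) →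
                      subst₂* σ (subst₁* τ ts) ≡ subst₁* (subst₂ σ ∘ τ) (subst₂* σ ts)
    subst₂*-subst₁* []       = refl
    subst₂*-subst₁* (t ∷ ts) = cong₂ _∷_ (subst₂-subst₁ t) (subst₂*-subst₁* ts)

module _ {F Γ Δ Θ : Symbols} {σ : Subst₂ F Δ Θ} {ρ : Subst₂ F Γ Δ} where
  mutual
    subst₂-subst₂ : (t : Term F Γ V) → subst₂ σ (subst₂ ρ t) ≡ subst₂ (λ X → subst₂ σ (ρ X)) t
    subst₂-subst₂ (var x)    = refl
    subst₂-subst₂ (fun g ts) = cong (fun g) (subst₂*-subst₂* ts)
    subst₂-subst₂ (app X ts) = begin
      subst₂ σ (subst₁ (Vec.lookup (subst₂* ρ ts)) (ρ X))
        ≡⟨ subst₂-subst₁ (ρ X) ⟩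
      subst₁ (subst₂ σ ∘ Vec.lookup (subst₂* ρ ts)) (subst₂ σ (ρ X))
        ≡⟨ subst₁-cong (λ i → sym (lookup-subst₂* (subst₂* ρ ts) i)) (subst₂ σ (ρ X)) ⟩
      subst₁ (Vec.lookup (subst₂* σ (subst₂* ρ ts))) (subst₂ σ (ρ X))
        ≡⟨ cong (λ us → subst₁ (Vec.lookup us) (subst₂ σ (ρ X))) (subst₂*-subst₂* ts) ⟩
      subst₁ (Vec.lookup (subst₂* (λ X → subst₂ σ (ρ X)) ts)) (subst₂ σ (ρ X)) ∎
      where open ≡-Reasoning

    subst₂*-subst₂* : (ts : Vec (Term F Γ V) n) → subst₂* σ (subst₂* ρ ts) ≡ subst₂* (λ X → subst₂ σ (ρ X)) ts
    subst₂*-subst₂* []       = refl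
    subst₂*-subst₂* (t ∷ ts) = cong₂ _∷_ (subst₂-subst₂ t) (subst₂*-subst₂* ts)

module _ {F Γ Δ Θ : Symbols} {f : ∀ {k} → Δ k → Θ k} {σ : Subst₂ F Γ Δ} where
  mutual
    rename₂-subst₂ : (t : Term F Γ V) → rename₂ f (subst₂ σ t) ≡ subst₂ (λ X → rename₂ f (σ X)) t
    rename₂-subst₂ (var x)    = refl
    rename₂-subst₂ (fun g ts) = cong (fun g) (rename₂*-subst₂* ts)
    rename₂-subst₂ (app X ts) = begin
      rename₂ f (subst₁ (Vec.lookup (subst₂* σ ts)) (σ X))
        ≡⟨ rename₂-subst₁ (σ X) ⟩
      subst₁ (rename₂ f ∘ Vec.lookup (subst₂* σ ts)) (rename₂ f (σ X))
        ≡⟨ subst₁-cong (λ i → sym (lookup-rename₂* (subst₂* σ ts) i)) (rename₂ f (σ X)) ⟩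
      subst₁ (Vec.lookup (rename₂* f (subst₂* σ ts))) (rename₂ f (σ X))
        ≡⟨ cong (λ us → subst₁ (Vec.lookup us) (rename₂ f (σ X))) (rename₂*-subst₂* ts) ⟩
      subst₁ (Vec.lookup (subst₂* (λ X → rename₂ f (σ X)) ts)) (rename₂ f (σ X)) ∎
      where open ≡-Reasoning

    rename₂*-subst₂* : (ts : Vec (Term F Γ V) n) →
                       rename₂* f (subst₂* σ ts) ≡ subst₂* (λ X → rename₂ f (σ X)) ts
    rename₂*-subst₂* []       = refl
    rename₂*-subst₂* (t ∷ ts) = cong₂ _∷_ (rename₂-subst₂ t) (rename₂*-subst₂* ts)

module _ {F Γ Δ : Symbols} {σ : Subst₂ F Γ Δ} where
  mutual
    subst₂-embed : (t : FOTerm F V) → subst₂ σ (embed t) ≡ embed t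
    subst₂-embed (var x)    = refl
    subst₂-embed (fun g ts) = cong (fun g) (subst₂*-embed ts)

    subst₂*-embed : (ts : Vec (FOTerm F V) n) → subst₂* {Γ = Γ} {Δ} σ (rename₂* (λ ()) ts) ≡ rename₂* (λ ()) ts
    subst₂*-embed []       = refl
    subst₂*-embed (t ∷ ts) = cong₂ _∷_ (subst₂-embed t) (subst₂*-embed ts)

module _ {F Γ Δ : Symbols} {f : ∀ {k} → Γ k → Δ k} where
  mutual
    rename₂-embed : (t : FOTerm F V) → rename₂ {Γ = Γ} {Δ} f (embed t) ≡ embed t
    rename₂-embed (var x)    = refl
    rename₂-embed (fun g ts) = cong (fun g) (rename₂*-embed ts)

    rename₂*-embed : (ts : Vec (FOTerm F V) n) → rename₂* {Γ = Γ} {Δ} f (rename₂* (λ ()) ts) ≡ rename₂* (λ ()) ts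
    rename₂*-embed []       = refl
    rename₂*-embed (t ∷ ts) = cong₂ _∷_ (rename₂-embed t) (rename₂*-embed ts)

mutual
  embed-id : (t : FOTerm F V) → embed t ≡ t
  embed-id (var x)    = refl
  embed-id (fun g ts) = cong (fun g) (embed*-id ts)

  embed*-id : (ts : Vec (FOTerm F V) n) → rename₂* (λ ()) ts ≡ ts
  embed*-id []       = refl
  embed*-id (t ∷ ts) = cong₂ _∷_ (embed-id t) (embed*-id ts)

lookup-map-var : (i : Fin n) → Vec.lookup (Vec.map {B = Term F Γ (Fin n)} var (Vec.allFin n)) i ≡ var i
lookup-map-var i = trans (Vecₚ.lookup-map i var (Vec.allFin _)) (cong var (Vecₚ.lookup-allFin i))

module _ {F Γ Δ : Symbols} {σ : Subst₂ F Γ Δ} where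
  subst₂*-map-var : (xs : Vec V n) → subst₂* σ (Vec.map var xs) ≡ Vec.map var xs
  subst₂*-map-var []       = refl
  subst₂*-map-var (x ∷ xs) = cong (var x ∷_) (subst₂*-map-var xs)

  -- `generic X` is the eta-expansion of `X`, so `generic` is the unit of 2nd-order substitution.
  subst₂-generic : (X : Γ k) → subst₂ σ (generic X) ≡ σ X
  subst₂-generic X = begin
    subst₁ (Vec.lookup (subst₂* σ (Vec.map var (Vec.allFin _)))) (σ X)
      ≡⟨ cong (λ us → subst₁ (Vec.lookup us) (σ X)) (subst₂*-map-var (Vec.allFin _)) ⟩
    subst₁ (Vec.lookup (Vec.map var (Vec.allFin _))) (σ X)
      ≡⟨ subst₁-cong lookup-map-var (σ X) ⟩
    subst₁ var (σ X)
      ≡⟨ subst₁-var (σ X) ⟩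
    σ X ∎
    where open ≡-Reasoning

module _ {F Γ Δ : Symbols} {f : ∀ {k} → Γ k → Δ k} where
  rename₂*-map-var : (xs : Vec V n) → rename₂* {F} {Γ} {Δ} f (Vec.map var xs) ≡ Vec.map var xs
  rename₂*-map-var []       = refl
  rename₂*-map-var (x ∷ xs) = cong (var x ∷_) (rename₂*-map-var xs)

  rename₂-generic : (X : Γ k) → rename₂ {F} {Γ} {Δ} f (generic X) ≡ generic (f X)
  rename₂-generic X = cong (app (f X)) (rename₂*-map-var (Vec.allFin _))

-- Variables, and let-expressions as terms

unique⇒deduplicate : {xs : List (Fin n)} → Unique xs → deduplicate _≟_ xs ≡ xs
unique⇒deduplicate []                      = refl
unique⇒deduplicate {xs = x ∷ xs} (x∉ ∷ xs!) =
  cong (x ∷_) (trans (cong (List.filter _) (unique⇒deduplicate xs!)) (Listₚ.filter-all _ x∉))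

unique-map-injective : {f : A → U} {xs : List A} → Unique (List.map f xs) →
                       ∀ {x y} → x ∈ xs → y ∈ xs → f x ≡ f y → x ≡ y
unique-map-injective (_ ∷ _)  (here refl) (here refl) _ = refl
unique-map-injective {f = f} (x∉ ∷ _) (here refl) (there j) e = ⊥-elim (All.lookup x∉ (∈-map⁺ f j) e)
unique-map-injective {f = f} (x∉ ∷ _) (there i) (here refl) e = ⊥-elim (All.lookup x∉ (∈-map⁺ f i) (sym e))
unique-map-injective (_ ∷ u)  (there i) (there j) e = unique-map-injective u i j e

module _ (h : A → List U) where
  concatMap-lookup-allFin : (xs : Vec A n) → concatMap (h ∘ Vec.lookup xs) (allFin n) ≡ concatMap h (Vec.toList xs)
  concatMap-lookup-allFin []       = refl
  concatMap-lookup-allFin {n = suc n} (x ∷ xs) = cong (h x ++_) (begin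
    concatMap (h ∘ Vec.lookup (x ∷ xs)) (List.tabulate Fin.suc)
      ≡⟨ cong (concatMap (h ∘ Vec.lookup (x ∷ xs))) (Listₚ.map-tabulate id Fin.suc) ⟨
    concatMap (h ∘ Vec.lookup (x ∷ xs)) (List.map Fin.suc (allFin n))
      ≡⟨ Listₚ.concatMap-map (h ∘ Vec.lookup (x ∷ xs)) Fin.suc (allFin n) ⟩
    concatMap (h ∘ Vec.lookup xs) (allFin n)
      ≡⟨ concatMap-lookup-allFin xs ⟩
    concatMap h (Vec.toList xs) ∎)
    where open ≡-Reasoning

vars*-concatMap : (ts : Vec (Term F Γ V) n) → vars* ts ≡ concatMap vars (Vec.toList ts)
vars*-concatMap []       = refl
vars*-concatMap (t ∷ ts) = cong (vars t ++_) (vars*-concatMap ts)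

arities*-concatMap : (ts : Vec (Term F Γ V) n) → arities* ts ≡ concatMap arities (Vec.toList ts)
arities*-concatMap []       = refl
arities*-concatMap (t ∷ ts) = cong (arities t ++_) (arities*-concatMap ts)

module _ {F Γ : Symbols} {V W : Set} {τ : V → Term F Γ W} where
  mutual
    vars-subst₁ : (t : Term F Γ V) → vars (subst₁ τ t) ≡ concatMap (vars ∘ τ) (vars t)
    vars-subst₁ (var x)    = sym (Listₚ.++-identityʳ (vars (τ x)))
    vars-subst₁ (fun g ts) = vars*-subst₁* ts
    vars-subst₁ (app X ts) = vars*-subst₁* ts

    vars*-subst₁* : (ts : Vec (Term F Γ V) n) → vars* (subst₁* τ ts) ≡ concatMap (vars ∘ τ) (vars* ts)
    vars*-subst₁* []       = refl
    vars*-subst₁* (t ∷ ts) = trans (cong₂ _++_ (vars-subst₁ t) (vars*-subst₁* ts))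
                                   (sym (Listₚ.concatMap-++ _ (vars t) (vars* ts)))

  mutual
    arities-subst₁-embed : (t : FOTerm F V) → arities (subst₁ τ (embed t)) ≡ concatMap (arities ∘ τ) (vars t)
    arities-subst₁-embed (var x)    = sym (Listₚ.++-identityʳ (arities (τ x)))
    arities-subst₁-embed (fun g ts) = arities*-subst₁*-embed ts

    arities*-subst₁*-embed : (ts : Vec (FOTerm F V) n) →
      arities* (subst₁* τ (rename₂* (λ ()) ts)) ≡ concatMap (arities ∘ τ) (vars* ts)
    arities*-subst₁*-embed []       = refl
    arities*-subst₁*-embed (t ∷ ts) = trans (cong₂ _++_ (arities-subst₁-embed t) (arities*-subst₁*-embed ts))
                                            (sym (Listₚ.concatMap-++ _ (vars t) (vars* ts)))

vars-rename₁ : (f : V → W) (t : Term F Γ V) → vars (rename₁ f t) ≡ List.map f (vars t)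
vars-rename₁ f t = begin
  vars (rename₁ f t)             ≡⟨ vars-subst₁ t ⟩
  concatMap (List.[_] ∘ f) (vars t)     ≡⟨ Listₚ.concatMap-map List.[_] f (vars t) ⟨
  concatMap List.[_] (List.map f (vars t)) ≡⟨ Listₚ.concatMap-pure (List.map f (vars t)) ⟩
  List.map f (vars t) ∎
  where open ≡-Reasoning

vars*-rename₁* : (f : V → W) (ts : Vec (Term F Γ V) n) → vars* (rename₁* f ts) ≡ List.map f (vars* ts)
vars*-rename₁* f []       = refl
vars*-rename₁* f (t ∷ ts) = trans (cong₂ _++_ (vars-rename₁ f t) (vars*-rename₁* f ts)) (sym (Listₚ.map-++ f (vars t) (vars* ts)))

Linear : Term F Γ (Fin k) → Set
Linear {k = k} t = vars t ≡ allFin k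

-- Linearity copies every argument exactly once and in order, and `q` has no 2nd-order variables of
-- its own. Expanding a variable into its pattern thus removes just that occurrence; this is how the
-- occurrences left in a single step are counted.
arities-subst₁-linear : (q : Abs F k) → Linear q → (ts : Vec (Term F Γ V) k) →
                        arities (subst₁ (Vec.lookup ts) (embed q)) ≡ arities* ts
arities-subst₁-linear q l ts = begin
  arities (subst₁ (Vec.lookup ts) (embed q))     ≡⟨ arities-subst₁-embed q ⟩
  concatMap (arities ∘ Vec.lookup ts) (vars q)   ≡⟨ cong (concatMap _) l ⟩
  concatMap (arities ∘ Vec.lookup ts) (allFin _) ≡⟨ concatMap-lookup-allFin arities ts ⟩
  concatMap arities (Vec.toList ts)              ≡⟨ arities*-concatMap ts ⟨
  arities* ts ∎
  where open ≡-Reasoning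

module _ {F Γ Δ : Symbols} {σ : Subst₂ F Γ Δ} (σ-linear : ∀ {k} (X : Γ k) → Linear (σ X)) where
  mutual
    -- Expanding by linear terms neither moves nor copies 1st-order variables. Linearity of an
    -- expanded pattern therefore passes back to the term that it was expanded from.
    vars-subst₂ : (t : Term F Γ V) → vars (subst₂ σ t) ≡ vars t
    vars-subst₂ (var x)    = refl
    vars-subst₂ (fun g ts) = vars*-subst₂* ts
    vars-subst₂ (app X ts) = begin
      vars (subst₁ (Vec.lookup (subst₂* σ ts)) (σ X))
        ≡⟨ vars-subst₁ (σ X) ⟩
      concatMap (vars ∘ Vec.lookup (subst₂* σ ts)) (vars (σ X))
        ≡⟨ cong (concatMap _) (σ-linear X) ⟩
      concatMap (vars ∘ Vec.lookup (subst₂* σ ts)) (allFin _)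
        ≡⟨ concatMap-lookup-allFin vars (subst₂* σ ts) ⟩
      concatMap vars (Vec.toList (subst₂* σ ts))
        ≡⟨ vars*-concatMap (subst₂* σ ts) ⟨
      vars* (subst₂* σ ts)
        ≡⟨ vars*-subst₂* ts ⟩
      vars* ts ∎
      where open ≡-Reasoning

    vars*-subst₂* : (ts : Vec (Term F Γ V) n) → vars* (subst₂* σ ts) ≡ vars* ts
    vars*-subst₂* []       = refl
    vars*-subst₂* (t ∷ ts) = cong₂ _++_ (vars-subst₂ t) (vars*-subst₂* ts)

-- A term whose leaves are labelled with data over the variables of a linear
-- term amounts to a choice of one datum for each of these variables.
choose : (f : A → Fin k) (P : Term F Γ A) → Linear (rename₁ {Γ = Γ} f P) →
         Σ[ c ∈ (Fin k → A) ] (∀ i → f (c i) ≡ i) ×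
           (∀ {W} (h : A → Term F Γ W) → subst₁ h P ≡ subst₁ (h ∘ c) (rename₁ f P))
choose {A = A} {k} f P linear = c , f∘c , λ h → begin
  subst₁ h P                                  ≡⟨ subst₁-cong-vars P (λ x∈ → cong h (sym (c∘f x∈))) ⟩
  subst₁ (h ∘ c ∘ f) P                        ≡⟨ subst₁-subst₁ P ⟨
  subst₁ (h ∘ c) (rename₁ f P) ∎
  where
  open ≡-Reasoning
  enumeration : List.map f (vars P) ≡ allFin k
  enumeration = trans (sym (vars-rename₁ f P)) linear
  preimage : ∀ i → ∃[ a ] a ∈ vars P × i ≡ f a
  preimage i = ∈-map⁻ f (subst (i ∈_) (sym enumeration) (∈-allFin i))
  c : Fin k → A
  c = proj₁ ∘ preimage
  f∘c : ∀ i → f (c i) ≡ i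
  f∘c i = sym (proj₂ (proj₂ (preimage i)))
  -- By construction `c` is a right inverse of `f`. As the images of the leaves form a
  -- duplicate-free list, `f` is injective on leaves, which makes `c` a left inverse there as well.
  c∘f : ∀ {x} → x ∈ vars P → c (f x) ≡ x
  c∘f {x} x∈ = unique-map-injective (subst Unique (sym enumeration) (allFin⁺ k))
                 (proj₁ (proj₂ (preimage (f x)))) x∈ (f∘c (f x))

toList-++⁺ : {P : ℕ → Set} {xs ys : List ℕ} (ps : All P xs) (qs : All P ys) →
             All.toList (++⁺ ps qs) ≡ All.toList ps ++ All.toList qs
toList-++⁺ []       qs = refl
toList-++⁺ (p ∷ ps) qs = cong (_ ∷_) (toList-++⁺ ps qs)

lookup-++ˡ : {P : ℕ → Set} {xs ys : List ℕ} (ps : All P xs) (qs : All P ys) (i : k ∈ xs) →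
             All.lookup (++⁺ ps qs) (∈-++⁺ˡ i) ≡ All.lookup ps i
lookup-++ˡ (p ∷ ps) qs (here refl) = refl
lookup-++ˡ (p ∷ ps) qs (there i)   = lookup-++ˡ ps qs i

lookup-++ʳ : {P : ℕ → Set} {xs ys : List ℕ} (ps : All P xs) (qs : All P ys) (i : k ∈ ys) →
             All.lookup (++⁺ ps qs) (∈-++⁺ʳ xs i) ≡ All.lookup qs i
lookup-++ʳ []       qs i = refl
lookup-++ʳ (p ∷ ps) qs i = lookup-++ʳ ps qs i

toList-tabulate-++ : {P : ℕ → Set} (xs : List ℕ) {ys : List ℕ} (f : ∀ {k} → k ∈ xs ++ ys → P k) →
  All.toList (All.tabulate {xs = xs ++ ys} f) ≡
  All.toList (All.tabulate {xs = xs} (λ i → f (∈-++⁺ˡ {ys = ys} i))) ++ All.toList (All.tabulate {xs = ys} (λ i → f (∈-++⁺ʳ xs i)))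
toList-tabulate-++ []       f = refl
toList-tabulate-++ (x ∷ xs) f = cong ((x , f (here refl)) ∷_) (toList-tabulate-++ xs (f ∘ there))

toList-tabulate : {P Q : ℕ → Set} (xs : List ℕ) (f : ∀ {k} → k ∈ xs → P k) (g : ∀ {k} → P k → Q k) →
  All.toList (All.tabulate (λ i → g (f i))) ≡ List.map (map₂ g) (All.toList (All.tabulate f))
toList-tabulate []       f g = refl
toList-tabulate (x ∷ xs) f g = cong (_ ∷_) (toList-tabulate xs (f ∘ there) g)

toList-injective : {P : ℕ → Set} {xs : List ℕ} {ps qs : All P xs} → All.toList ps ≡ All.toList qs → ps ≡ qs
toList-injective {ps = []}     {[]}     e = refl
toList-injective {ps = p ∷ ps} {q ∷ qs} e with Listₚ.∷-injectiveˡ e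
... | refl = cong (p ∷_) (toList-injective (Listₚ.∷-injectiveʳ e))

map-proj₁-toList : {P : ℕ → Set} {xs : List ℕ} (ps : All P xs) → List.map proj₁ (All.toList ps) ≡ xs
map-proj₁-toList []       = refl
map-proj₁-toList (p ∷ ps) = cong (_ ∷_) (map-proj₁-toList ps)

toList-tabulate-lookup : {P : ℕ → Set} {xs : List ℕ} (ps : All P xs) →
                         All.toList (All.tabulate (All.lookup ps)) ≡ All.toList ps
toList-tabulate-lookup []       = refl
toList-tabulate-lookup (p ∷ ps) = cong (_ ∷_) (toList-tabulate-lookup ps)

module _ {F Γ Δ : Symbols} {f : ∀ {k} → Γ k → Δ k} where
  mutual
    toList-occurrences-rename₂ : (t : Term F Γ V) →
      All.toList (occurrences (rename₂ f t)) ≡ List.map (map₂ f) (All.toList (occurrences t))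
    toList-occurrences-rename₂ (var x)    = refl
    toList-occurrences-rename₂ (fun g ts) = toList-occurrences*-rename₂* ts
    toList-occurrences-rename₂ (app X ts) = cong (_ ∷_) (toList-occurrences*-rename₂* ts)

    toList-occurrences*-rename₂* : (ts : Vec (Term F Γ V) n) →
      All.toList (occurrences* (rename₂* f ts)) ≡ List.map (map₂ f) (All.toList (occurrences* ts))
    toList-occurrences*-rename₂* []       = refl
    toList-occurrences*-rename₂* (t ∷ ts) = begin
      All.toList (++⁺ (occurrences (rename₂ f t)) (occurrences* (rename₂* f ts)))
        ≡⟨ toList-++⁺ (occurrences (rename₂ f t)) _ ⟩
      All.toList (occurrences (rename₂ f t)) ++ All.toList (occurrences* (rename₂* f ts))
        ≡⟨ cong₂ _++_ (toList-occurrences-rename₂ t) (toList-occurrences*-rename₂* ts) ⟩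
      List.map (map₂ f) (All.toList (occurrences t)) ++ List.map (map₂ f) (All.toList (occurrences* ts))
        ≡⟨ Listₚ.map-++ (map₂ f) (All.toList (occurrences t)) _ ⟨
      List.map (map₂ f) (All.toList (occurrences t) ++ All.toList (occurrences* ts))
        ≡⟨ cong (List.map (map₂ f)) (toList-++⁺ (occurrences t) _) ⟨
      List.map (map₂ f) (All.toList (++⁺ (occurrences t) (occurrences* ts))) ∎
      where open ≡-Reasoning

mutual
  rename₂-lookup-split : (t : Term F Γ V) → rename₂ (All.lookup (occurrences t)) (split t) ≡ t
  rename₂-lookup-split (var x)    = refl
  rename₂-lookup-split (fun g ts) = cong (fun g) (rename₂*-lookup-split* ts)
  rename₂-lookup-split (app X ts) =
    cong (app X) (trans (rename₂*-rename₂* (split* ts)) (rename₂*-lookup-split* ts))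

  rename₂*-lookup-split* : (ts : Vec (Term F Γ V) n) → rename₂* (All.lookup (occurrences* ts)) (split* ts) ≡ ts
  rename₂*-lookup-split* []       = refl
  rename₂*-lookup-split* (t ∷ ts) = cong₂ _∷_
    (trans (rename₂-rename₂ (split t))
      (trans (rename₂-cong (lookup-++ˡ (occurrences t) (occurrences* ts)) (split t)) (rename₂-lookup-split t)))
    (trans (rename₂*-rename₂* (split* ts))
      (trans (rename₂*-cong (lookup-++ʳ (occurrences t) (occurrences* ts)) (split* ts)) (rename₂*-lookup-split* ts)))

mutual
  toList-occurrences-split : (t : Term F Γ V) →
    All.toList (occurrences (split t)) ≡ All.toList (All.tabulate {xs = arities t} id)
  toList-occurrences-split (var x)    = refl
  toList-occurrences-split (fun g ts) = toList-occurrences*-split* ts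
  toList-occurrences-split (app {k} X ts) = cong ((k , here refl) ∷_) (begin
    All.toList (occurrences* (rename₂* there (split* ts)))
      ≡⟨ toList-occurrences*-rename₂* (split* ts) ⟩
    List.map (map₂ there) (All.toList (occurrences* (split* ts)))
      ≡⟨ cong (List.map (map₂ there)) (toList-occurrences*-split* ts) ⟩
    List.map (map₂ there) (All.toList (All.tabulate id))
      ≡⟨ toList-tabulate (arities* ts) id there ⟨
    All.toList (All.tabulate there) ∎)
    where open ≡-Reasoning

  toList-occurrences*-split* : (ts : Vec (Term F Γ V) n) →
    All.toList (occurrences* (split* ts)) ≡ All.toList (All.tabulate {xs = arities* ts} id)
  toList-occurrences*-split* []       = refl
  toList-occurrences*-split* (t ∷ ts) = begin
    All.toList (++⁺ (occurrences (rename₂ inˡ (split t))) (occurrences* (rename₂* inʳ (split* ts))))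
      ≡⟨ toList-++⁺ (occurrences (rename₂ inˡ (split t))) _ ⟩
    All.toList (occurrences (rename₂ inˡ (split t))) ++ All.toList (occurrences* (rename₂* inʳ (split* ts)))
      ≡⟨ cong₂ _++_ (toList-occurrences-rename₂ (split t)) (toList-occurrences*-rename₂* (split* ts)) ⟩
    List.map (map₂ inˡ) (All.toList (occurrences (split t))) ++
    List.map (map₂ inʳ) (All.toList (occurrences* (split* ts)))
      ≡⟨ cong₂ (λ xs ys → List.map (map₂ inˡ) xs ++ List.map (map₂ inʳ) ys)
           (toList-occurrences-split t) (toList-occurrences*-split* ts) ⟩
    List.map (map₂ inˡ) (All.toList (All.tabulate id)) ++ List.map (map₂ inʳ) (All.toList (All.tabulate id))
      ≡⟨ cong₂ _++_ (toList-tabulate (arities t) id inˡ) (toList-tabulate (arities* ts) id inʳ) ⟨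
    All.toList (All.tabulate inˡ) ++ All.toList (All.tabulate inʳ)
      ≡⟨ toList-tabulate-++ (arities t) id ⟨
    All.toList (All.tabulate {xs = arities t ++ arities* ts} id) ∎
    where
    open ≡-Reasoning
    inˡ : ∀ {k} → k ∈ arities t → k ∈ arities t ++ arities* ts
    inˡ = ∈-++⁺ˡ
    inʳ : ∀ {k} → k ∈ arities* ts → k ∈ arities t ++ arities* ts
    inʳ = ∈-++⁺ʳ (arities t)

-- Up to equality, linear canonical let-expressions over B are terms over B:
-- proof terms in the case of rule symbols.
toTerm : ∀ {B} → Let F B V → Term F B V
toTerm e = rename₂ (bound e) (body e)

canonise-linearCanonical : (b : ∀ {k} → Γ k → B k) (t : Term F Γ V) → LinearCanonical (canonise b t)
canonise-linearCanonical b t = toList-occurrences-split t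

toTerm-canonise : (b : ∀ {k} → Γ k → B k) (t : Term F Γ V) → toTerm (canonise {B = B} b t) ≡ rename₂ b t
toTerm-canonise b t = begin
  rename₂ (All.lookup (All.map b (occurrences t))) (split t)
    ≡⟨ rename₂-cong (Allₚ.lookup-map (occurrences t)) (split t) ⟩
  rename₂ (b ∘ All.lookup (occurrences t)) (split t)
    ≡⟨ rename₂-rename₂ (split t) ⟨
  rename₂ b (rename₂ (All.lookup (occurrences t)) (split t))
    ≡⟨ cong (rename₂ b) (rename₂-lookup-split t) ⟩
  rename₂ b t ∎
  where open ≡-Reasoning

-- Arity and symbol are paired, so that one match on `refl` identifies both when the arities are not
-- known to agree.
fun-symbol : ∀ {j} {g : F k} {h : F j} {us : Vec (Term F Γ V) k} {vs : Vec (Term F Γ V) j} →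
             _≡_ {A = Term F Γ V} (fun g us) (fun h vs) → _≡_ {A = ∃[ k ] F k} (k , g) (j , h)
fun-symbol refl = refl

fun-injective : {g : F k} {us us′ : Vec (Term F Γ V) k} → _≡_ {A = Term F Γ V} (fun g us) (fun g us′) → us ≡ us′
fun-injective refl = refl

app-symbol : ∀ {j} {X : Γ k} {Y : Γ j} {us : Vec (Term F Γ V) k} {vs : Vec (Term F Γ V) j} →
             _≡_ {A = Term F Γ V} (app X us) (app Y vs) → _≡_ {A = ∃[ k ] Γ k} (k , X) (j , Y)
app-symbol refl = refl

app-injective : {X : Γ k} {us us′ : Vec (Term F Γ V) k} → _≡_ {A = Term F Γ V} (app X us) (app X us′) → us ≡ us′
app-injective refl = refl

module _ {F Γ Δ : Symbols} {f : ∀ {k} → Γ k → Δ k} where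
  rename₂-var⁻¹ : (t : Term F Γ V) {x : V} → var x ≡ rename₂ f t → t ≡ var x
  rename₂-var⁻¹ (var x) refl = refl

  rename₂-fun⁻¹ : (t : Term F Γ V) {g : F k} {us : Vec (Term F Δ V) k} → fun g us ≡ rename₂ f t →
                  ∃[ ts ] t ≡ fun g ts × us ≡ rename₂* f ts
  rename₂-fun⁻¹ (fun g ts) refl = ts , refl , refl

  rename₂-app⁻¹ : (t : Term F Γ V) {Y : Δ k} {us : Vec (Term F Δ V) k} → app Y us ≡ rename₂ f t →
                  ∃[ X ] ∃[ ts ] t ≡ app X ts × us ≡ rename₂* f ts
  rename₂-app⁻¹ (app X ts) refl = X , ts , refl , refl

  -- Needed to cut two equal concatenations of occurrence lists, one segment per argument, at the
  -- same place.
  length-occurrences : (t t′ : Term F Γ V) → rename₂ f t ≡ rename₂ f t′ →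
                       length (All.toList (occurrences t)) ≡ length (All.toList (occurrences t′))
  length-occurrences t t′ e = begin
    length (All.toList (occurrences t))
      ≡⟨ Listₚ.length-map (map₂ f) (All.toList (occurrences t)) ⟨
    length (List.map (map₂ f) (All.toList (occurrences t)))
      ≡⟨ cong length (toList-occurrences-rename₂ t) ⟨
    length (All.toList (occurrences (rename₂ f t)))
      ≡⟨ cong (length ∘ All.toList ∘ occurrences) e ⟩
    length (All.toList (occurrences (rename₂ f t′)))
      ≡⟨ cong length (toList-occurrences-rename₂ t′) ⟩
    length (List.map (map₂ f) (All.toList (occurrences t′)))
      ≡⟨ Listₚ.length-map (map₂ f) (All.toList (occurrences t′)) ⟩
    length (All.toList (occurrences t′)) ∎
    where open ≡-Reasoning

  ++-injective : (xs xs′ : List A) {ys ys′ : List A} → length xs ≡ length xs′ → xs ++ ys ≡ xs′ ++ ys′ →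
                 xs ≡ xs′ × ys ≡ ys′
  ++-injective []       []         l e = refl , e
  ++-injective (x ∷ xs) (x′ ∷ xs′) l e =
    let e₁ , e₂ = ++-injective xs xs′ (suc-injective l) (Listₚ.∷-injectiveʳ e)
    in cong₂ _∷_ (Listₚ.∷-injectiveˡ e) e₁ , e₂

  mutual
    -- The renaming may identify names; the list of occurrences supplies the information that it
    -- loses.
    rename₂-injective : (t t′ : Term F Γ V) → rename₂ f t ≡ rename₂ f t′ →
      All.toList (occurrences t) ≡ All.toList (occurrences t′) → t ≡ t′
    rename₂-injective (var x)    t′ e o = sym (rename₂-var⁻¹ t′ e)
    rename₂-injective (fun g ts) t′ e o with rename₂-fun⁻¹ t′ e
    ... | ts′ , refl , e′ = cong (fun g) (rename₂*-injective ts ts′ e′ o)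
    rename₂-injective (app X ts) t′ e o with rename₂-app⁻¹ t′ e
    ... | X′ , ts′ , refl , e′ with Listₚ.∷-injectiveˡ o
    ... | refl = cong (app X) (rename₂*-injective ts ts′ e′ (Listₚ.∷-injectiveʳ o))

    rename₂*-injective : (ts ts′ : Vec (Term F Γ V) n) → rename₂* f ts ≡ rename₂* f ts′ →
      All.toList (occurrences* ts) ≡ All.toList (occurrences* ts′) → ts ≡ ts′
    rename₂*-injective []       []         e o = refl
    rename₂*-injective (t ∷ ts) (t′ ∷ ts′) e o =
      let eᵗ = Vecₚ.∷-injectiveˡ e
          o₁ , o₂ = ++-injective (All.toList (occurrences t)) (All.toList (occurrences t′))
                      (length-occurrences t t′ eᵗ)
                      (trans (sym (toList-++⁺ (occurrences t) _)) (trans o (toList-++⁺ (occurrences t′) _)))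
      in cong₂ _∷_ (rename₂-injective t t′ eᵗ o₁) (rename₂*-injective ts ts′ (Vecₚ.∷-injectiveʳ e) o₂)

toList-occurrences-toTerm : {B : Symbols} (e : Let F B V) → LinearCanonical e →
                            All.toList (occurrences (toTerm e)) ≡ All.toList (binds e)
toList-occurrences-toTerm e lc = begin
  All.toList (occurrences (rename₂ (bound e) (body e)))
    ≡⟨ toList-occurrences-rename₂ (body e) ⟩
  List.map (map₂ (bound e)) (All.toList (occurrences (body e)))
    ≡⟨ cong (List.map (map₂ (bound e))) lc ⟩
  List.map (map₂ (bound e)) (All.toList (All.tabulate id))
    ≡⟨ toList-tabulate (context e) id (bound e) ⟨
  All.toList (All.tabulate (bound e))
    ≡⟨ toList-tabulate-lookup (binds e) ⟩
  All.toList (binds e) ∎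
  where open ≡-Reasoning

-- In a linear canonical let-expression the pre-order list of symbols of `toTerm` is the list of
-- bindings, so bindings and context can be read off. The bodies then agree because the occurrences
-- of both enumerate this one context.
toTerm-injective : {B : Symbols} (e e′ : Let F B V) → LinearCanonical e → LinearCanonical e′ →
                   toTerm e ≡ toTerm e′ → e ≡ e′
toTerm-injective {F} {V} {B} e e′ lc lc′ eq = go (binds e) (binds e′) (body e) (body e′) lc lc′ eq binds≡ context≡
  where
  binds≡ : All.toList (binds e) ≡ All.toList (binds e′)
  binds≡ = trans (sym (toList-occurrences-toTerm e lc))
                 (trans (cong (All.toList ∘ occurrences) eq) (toList-occurrences-toTerm e′ lc′))
  context≡ : context e ≡ context e′
  context≡ = trans (sym (map-proj₁-toList (binds e)))
                   (trans (cong (List.map proj₁) binds≡) (map-proj₁-toList (binds e′)))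
  -- Contexts are generalised to variables here, since their equation can be matched with `refl`
  -- only then.
  go : ∀ {c c′} (b : All B c) (b′ : All B c′) (t : Term F (_∈ c) V) (t′ : Term F (_∈ c′) V) →
       LinearCanonical (let[ b ] t) → LinearCanonical (let[ b′ ] t′) →
       rename₂ (All.lookup b) t ≡ rename₂ (All.lookup b′) t′ →
       All.toList b ≡ All.toList b′ → c ≡ c′ → (let[ b ] t) ≡ (let[ b′ ] t′)
  go b b′ t t′ l l′ e b≡ refl with toList-injective b≡
  ... | refl = cong (let[ b ]_) (rename₂-injective t t′ e (trans l (sym l′)))

-- Markings

data Mark : Set where
  plain start cont : Mark

infix 4 _≤ᵐ_

-- `start` lies below `cont` because refinement may cut a pattern into smaller ones: an inner symbol
-- of the coarse pattern becomes the root of a fine one.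
data _≤ᵐ_ : Mark → Mark → Set where
  plain≤    : ∀ {m} → plain ≤ᵐ m
  start≤    : start ≤ᵐ start
  start≤cont : start ≤ᵐ cont
  cont≤     : cont ≤ᵐ cont

data Disjoint : Mark → Mark → Set where
  plainˡ : ∀ {m} → Disjoint plain m
  plainʳ : ∀ {m} → Disjoint m plain

-- The total relation: `Zip Arbitrary` says that two markings decorate the same term, in a form that
-- supports recursion.
data Arbitrary : Mark → Mark → Set where
  arbitrary : ∀ {m m′} → Arbitrary m m′

≤ᵐ-refl : ∀ m → m ≤ᵐ m
≤ᵐ-refl plain = plain≤
≤ᵐ-refl start = start≤
≤ᵐ-refl cont  = cont≤

≤ᵐ-trans : ∀ {m m′ m″} → m ≤ᵐ m′ → m′ ≤ᵐ m″ → m ≤ᵐ m″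
≤ᵐ-trans plain≤     _     = plain≤
≤ᵐ-trans start≤     q     = q
≤ᵐ-trans start≤cont cont≤ = start≤cont
≤ᵐ-trans cont≤      q     = q

≤ᵐ-cont : ∀ m → m ≤ᵐ cont
≤ᵐ-cont plain = plain≤
≤ᵐ-cont start = start≤cont
≤ᵐ-cont cont  = cont≤

Marked : Symbols → Symbols
Marked F k = F k × Mark

MTerm : Symbols → Set → Set
MTerm F V = FOTerm (Marked F) V

module _ {F : Symbols} {V : Set} where
  mutual
    erase : MTerm F V → FOTerm F V
    erase (var x)          = var x
    erase (fun (g , m) ds) = fun g (erase* ds)

    erase* : Vec (MTerm F V) n → Vec (FOTerm F V) n
    erase* []       = []
    erase* (d ∷ ds) = erase d ∷ erase* ds

  module _ (m : Mark) where
    mutual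
      label : FOTerm F V → MTerm F V
      label (var x)    = var x
      label (fun g ts) = fun (g , m) (label* ts)

      label* : Vec (FOTerm F V) n → Vec (MTerm F V) n
      label* []       = []
      label* (t ∷ ts) = label t ∷ label* ts

  markPattern : FOTerm F V → MTerm F V
  markPattern (var x)    = var x
  markPattern (fun g ts) = fun (g , start) (label* cont ts)

module _ {F Γ : Symbols} (s : ∀ {k} → Γ k → Abs F k) where
  mutual
    mark : Term F Γ V → MTerm F V
    mark (var x)    = var x
    mark (fun g ts) = fun (g , plain) (mark* ts)
    mark (app X ts) = subst₁ (Vec.lookup (mark* ts)) (markPattern (s X))

    mark* : Vec (Term F Γ V) n → Vec (MTerm F V) n
    mark* []       = []
    mark* (t ∷ ts) = mark t ∷ mark* ts

data Zip {F : Symbols} {V : Set} (R : Mark → Mark → Set) : MTerm F V → MTerm F V → Set where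
  var : (x : V) → Zip R (var x) (var x)
  fun : (g : F k) {m m′ : Mark} {ds ds′ : Vec (MTerm F V) k} →
        R m m′ → Pointwise (Zip R) ds ds′ → Zip R (fun (g , m) ds) (fun (g , m′) ds′)

infix 4 _≤ᶻ_ _∥_ _≈ᶻ_

_≤ᶻ_ _∥_ _≈ᶻ_ : MTerm F V → MTerm F V → Set
_≤ᶻ_ = Zip _≤ᵐ_
_∥_  = Zip Disjoint
_≈ᶻ_ = Zip Arbitrary

module _ {F : Symbols} {R : Mark → Mark → Set} {τ : V → MTerm F W} {τ′ : V → MTerm F W}
         (zτ : ∀ x → Zip R (τ x) (τ′ x)) where
  mutual
    zip-subst₁ : {d d′ : MTerm F V} → Zip R d d′ → Zip R (subst₁ τ d) (subst₁ τ′ d′)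
    zip-subst₁ (var x)      = zτ x
    zip-subst₁ (fun g r zs) = fun g r (zip-subst₁* zs)

    zip-subst₁* : {ds ds′ : Vec (MTerm F V) n} → Pointwise (Zip R) ds ds′ →
                  Pointwise (Zip R) (subst₁* τ ds) (subst₁* τ′ ds′)
    zip-subst₁* []       = []
    zip-subst₁* (z ∷ zs) = zip-subst₁ z ∷ zip-subst₁* zs

module _ {F : Symbols} {V : Set} {R S T : Mark → Mark → Set}
         (compose : ∀ {m m′ m″} → R m m′ → S m′ m″ → T m m″) where
  mutual
    zip-trans : {d d′ d″ : MTerm F V} → Zip R d d′ → Zip S d′ d″ → Zip T d d″
    zip-trans (var x)      (var .x)       = var x
    zip-trans (fun g r zs) (fun .g s zs′) = fun g (compose r s) (zip-trans* zs zs′)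

    zip-trans* : {ds ds′ ds″ : Vec (MTerm F V) n} → Pointwise (Zip R) ds ds′ → Pointwise (Zip S) ds′ ds″ →
                 Pointwise (Zip T) ds ds″
    zip-trans* []       []         = []
    zip-trans* (z ∷ zs) (z′ ∷ zs′) = zip-trans z z′ ∷ zip-trans* zs zs′

module _ {F : Symbols} {V : Set} {R S : Mark → Mark → Set} (f : ∀ {m m′} → R m m′ → S m′ m) where
  mutual
    zip-flip : {d d′ : MTerm F V} → Zip R d d′ → Zip S d′ d
    zip-flip (var x)      = var x
    zip-flip (fun g r zs) = fun g (f r) (zip-flip* zs)

    zip-flip* : {ds ds′ : Vec (MTerm F V) n} → Pointwise (Zip R) ds ds′ → Pointwise (Zip S) ds′ ds
    zip-flip* []       = []
    zip-flip* (z ∷ zs) = zip-flip z ∷ zip-flip* zs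

module _ {F : Symbols} {V : Set} {R : Mark → Mark → Set} where
  mutual
    zip-label : {m m′ : Mark} → R m m′ → (q : FOTerm F V) → Zip R (label m q) (label m′ q)
    zip-label r (var x)    = var x
    zip-label r (fun g qs) = fun g r (zip-label* r qs)

    zip-label* : {m m′ : Mark} → R m m′ → (qs : Vec (FOTerm F V) n) → Pointwise (Zip R) (label* m qs) (label* m′ qs)
    zip-label* r []       = []
    zip-label* r (q ∷ qs) = zip-label r q ∷ zip-label* r qs

  -- Replaces the exceptional mark at the root of a pattern by `cont`, so that a recursion into the
  -- pattern treats all its symbols alike.
  zip-pattern-label : {m : Mark} → R start m → R cont m → (q : FOTerm F V) → Zip R (markPattern q) (label m q)
  zip-pattern-label r r′ (var x)    = var x
  zip-pattern-label r r′ (fun g qs) = fun g r (zip-label* r′ qs)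

  mutual
    zip-refl : (∀ m → R m m) → (d : MTerm F V) → Zip R d d
    zip-refl r (var x)          = var x
    zip-refl r (fun (g , m) ds) = fun g (r m) (zip-refl* r ds)

    zip-refl* : (∀ m → R m m) → (ds : Vec (MTerm F V) n) → Pointwise (Zip R) ds ds
    zip-refl* r []       = []
    zip-refl* r (d ∷ ds) = zip-refl r d ∷ zip-refl* r ds

  mutual
    erase-zip : {d d′ : MTerm F V} → Zip R d d′ → erase d ≡ erase d′
    erase-zip (var x)      = refl
    erase-zip (fun g r zs) = cong (fun g) (erase*-zip* zs)

    erase*-zip* : {ds ds′ : Vec (MTerm F V) n} → Pointwise (Zip R) ds ds′ → erase* ds ≡ erase* ds′
    erase*-zip* []       = refl
    erase*-zip* (z ∷ zs) = cong₂ _∷_ (erase-zip z) (erase*-zip* zs)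

mutual
  erase-≈ᶻ : (d d′ : MTerm F V) → erase d ≡ erase d′ → d ≈ᶻ d′
  erase-≈ᶻ (var x)          (var .x)            refl = var x
  erase-≈ᶻ (var x)          (fun _ _)           ()
  erase-≈ᶻ (fun (g , m) ds) (fun (g′ , m′) ds′) e    = erase-fun-≈ᶻ g g′ ds ds′ e

  erase-fun-≈ᶻ : ∀ {k k′ m m′} (g : F k) (g′ : F k′) (ds : Vec (MTerm F V) k) (ds′ : Vec (MTerm F V) k′) →
                 _≡_ {A = FOTerm F V} (fun g (erase* ds)) (fun g′ (erase* ds′)) →
                 fun (g , m) ds ≈ᶻ fun (g′ , m′) ds′
  erase-fun-≈ᶻ g g′ ds ds′ e with fun-symbol e
  ... | refl = fun g arbitrary (erase*-≈ᶻ ds ds′ (fun-injective e))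

  erase*-≈ᶻ : (ds ds′ : Vec (MTerm F V) n) → erase* ds ≡ erase* ds′ → Pointwise _≈ᶻ_ ds ds′
  erase*-≈ᶻ []       []         e = []
  erase*-≈ᶻ (d ∷ ds) (d′ ∷ ds′) e =
    erase-≈ᶻ d d′ (Vecₚ.∷-injectiveˡ e) ∷ erase*-≈ᶻ ds ds′ (Vecₚ.∷-injectiveʳ e)

mutual
  erase-label : (m : Mark) (q : FOTerm F V) → erase (label m q) ≡ q
  erase-label m (var x)    = refl
  erase-label m (fun g qs) = cong (fun g) (erase*-label* m qs)

  erase*-label* : (m : Mark) (qs : Vec (FOTerm F V) n) → erase* (label* m qs) ≡ qs
  erase*-label* m []       = refl
  erase*-label* m (q ∷ qs) = cong₂ _∷_ (erase-label m q) (erase*-label* m qs)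

erase-markPattern : (q : FOTerm F V) → erase (markPattern q) ≡ q
erase-markPattern (var x)    = refl
erase-markPattern (fun g qs) = cong (fun g) (erase*-label* cont qs)

module _ {F : Symbols} {τ : V → MTerm F W} where
  mutual
    erase-subst₁ : (d : MTerm F V) → erase (subst₁ τ d) ≡ subst₁ (erase ∘ τ) (erase d)
    erase-subst₁ (var x)          = refl
    erase-subst₁ (fun (g , m) ds) = cong (fun g) (erase*-subst₁* ds)

    erase*-subst₁* : (ds : Vec (MTerm F V) n) → erase* (subst₁* τ ds) ≡ subst₁* (erase ∘ τ) (erase* ds)
    erase*-subst₁* []       = refl
    erase*-subst₁* (d ∷ ds) = cong₂ _∷_ (erase-subst₁ d) (erase*-subst₁* ds)

module _ {F Γ : Symbols} {s : ∀ {k} → Γ k → Abs F k} where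
  lookup-mark* : (ts : Vec (Term F Γ V) n) (i : Fin n) → Vec.lookup (mark* s ts) i ≡ mark s (Vec.lookup ts i)
  lookup-mark* (t ∷ ts) Fin.zero    = refl
  lookup-mark* (t ∷ ts) (Fin.suc i) = lookup-mark* ts i

  mutual
    erase-mark : (t : Term F Γ V) → erase (mark s t) ≡ subst₂ s t
    erase-mark (var x)    = refl
    erase-mark (fun g ts) = cong (fun g) (erase*-mark* ts)
    erase-mark (app X ts) = begin
      erase (subst₁ (Vec.lookup (mark* s ts)) (markPattern (s X)))
        ≡⟨ erase-subst₁ (markPattern (s X)) ⟩
      subst₁ (erase ∘ Vec.lookup (mark* s ts)) (erase (markPattern (s X)))
        ≡⟨ cong (subst₁ _) (erase-markPattern (s X)) ⟩
      subst₁ (erase ∘ Vec.lookup (mark* s ts)) (s X)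
        ≡⟨ subst₁-cong (λ i → lookup-erase* (mark* s ts) i) (s X) ⟨
      subst₁ (Vec.lookup (erase* (mark* s ts))) (s X)
        ≡⟨ cong (λ us → subst₁ (Vec.lookup us) (s X)) (erase*-mark* ts) ⟩
      subst₁ (Vec.lookup (subst₂* s ts)) (s X) ∎
      where
      open ≡-Reasoning
      lookup-erase* : ∀ {n} (ds : Vec (MTerm F V) n) (i : Fin n) → Vec.lookup (erase* ds) i ≡ erase (Vec.lookup ds i)
      lookup-erase* (d ∷ ds) Fin.zero    = refl
      lookup-erase* (d ∷ ds) (Fin.suc i) = lookup-erase* ds i

    erase*-mark* : (ts : Vec (Term F Γ V) n) → erase* (mark* s ts) ≡ subst₂* s ts
    erase*-mark* []       = refl
    erase*-mark* (t ∷ ts) = cong₂ _∷_ (erase-mark t) (erase*-mark* ts)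

  mutual
    mark-subst₁ : {τ : V → Term F Γ W} (t : Term F Γ V) → mark s (subst₁ τ t) ≡ subst₁ (mark s ∘ τ) (mark s t)
    mark-subst₁ (var x)    = refl
    mark-subst₁ (fun g ts) = cong (fun (g , plain)) (mark*-subst₁* ts)
    mark-subst₁ {τ = τ} (app X ts) = begin
      subst₁ (Vec.lookup (mark* s (subst₁* τ ts))) (markPattern (s X))
        ≡⟨ cong (λ ds → subst₁ (Vec.lookup ds) (markPattern (s X))) (mark*-subst₁* ts) ⟩
      subst₁ (Vec.lookup (subst₁* (mark s ∘ τ) (mark* s ts))) (markPattern (s X))
        ≡⟨ subst₁-cong (lookup-subst₁* (mark* s ts)) (markPattern (s X)) ⟩
      subst₁ (subst₁ (mark s ∘ τ) ∘ Vec.lookup (mark* s ts)) (markPattern (s X))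
        ≡⟨ subst₁-subst₁ (markPattern (s X)) ⟨
      subst₁ (mark s ∘ τ) (subst₁ (Vec.lookup (mark* s ts)) (markPattern (s X))) ∎
      where open ≡-Reasoning

    mark*-subst₁* : {τ : V → Term F Γ W} (ts : Vec (Term F Γ V) n) →
                    mark* s (subst₁* τ ts) ≡ subst₁* (mark s ∘ τ) (mark* s ts)
    mark*-subst₁* []       = refl
    mark*-subst₁* (t ∷ ts) = cong₂ _∷_ (mark-subst₁ t) (mark*-subst₁* ts)

  mutual
    mark-embed : (q : FOTerm F V) → mark s (embed q) ≡ label plain q
    mark-embed (var x)    = refl
    mark-embed (fun g qs) = cong (fun (g , plain)) (mark*-embed qs)

    mark*-embed : (qs : Vec (FOTerm F V) n) → mark* s (rename₂* (λ ()) qs) ≡ label* plain qs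
    mark*-embed []       = refl
    mark*-embed (q ∷ qs) = cong₂ _∷_ (mark-embed q) (mark*-embed qs)

module _ {F Γ Δ : Symbols} {s : ∀ {k} → Δ k → Abs F k} {s′ : ∀ {k} → Γ k → Abs F k} {f : ∀ {k} → Γ k → Δ k}
         (e : ∀ {k} (X : Γ k) → s (f X) ≡ s′ X) where
  mutual
    mark-rename₂ : (t : Term F Γ V) → mark s (rename₂ f t) ≡ mark s′ t
    mark-rename₂ (var x)    = refl
    mark-rename₂ (fun g ts) = cong (fun (g , plain)) (mark*-rename₂* ts)
    mark-rename₂ (app X ts) =
      cong₂ (λ ds q → subst₁ (Vec.lookup ds) (markPattern q)) (mark*-rename₂* ts) (e X)

    mark*-rename₂* : (ts : Vec (Term F Γ V) n) → mark* s (rename₂* f ts) ≡ mark* s′ ts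
    mark*-rename₂* []       = refl
    mark*-rename₂* (t ∷ ts) = cong₂ _∷_ (mark-rename₂ t) (mark*-rename₂* ts)

lookup-extensional : {xs ys : Vec A n} → (∀ i → Vec.lookup xs i ≡ Vec.lookup ys i) → xs ≡ ys
lookup-extensional {xs = []}     {[]}     e = refl
lookup-extensional {xs = x ∷ xs} {y ∷ ys} e = cong₂ _∷_ (e Fin.zero) (lookup-extensional (e ∘ Fin.suc))

lookup-zip-mark* : {R : Mark → Mark → Set} {s : ∀ {k} → Γ k → Abs F k} {ts : Vec (Term F Γ V) n} {ds : Vec (MTerm F V) n} →
                   Pointwise (Zip R) (mark* s ts) ds → ∀ i → Zip R (mark s (Vec.lookup ts i)) (Vec.lookup ds i)
lookup-zip-mark* {R = R} {ts = ts} {ds} zs i =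
  subst (λ d → Zip R d (Vec.lookup ds i)) (lookup-mark* ts i) (Pointwise.lookup zs i)

-- Markings that arise from terms

mutual
  -- The invariant is that `cont` occurs only directly below `start` or `cont`. `Inside` is the
  -- state below a pattern symbol, where the pattern may go on; `Body` is the state elsewhere, where
  -- the root cannot be `cont`. Every marking of a term is a `Body`, and `parse` gives the converse.
  data Body {F : Symbols} {V : Set} : MTerm F V → Set where
    var   : (x : V) → Body (var x)
    plain : (g : F k) {ds : Vec (MTerm F V) k} → VecAll Body ds → Body (fun (g , plain) ds)
    start : (g : F k) {ds : Vec (MTerm F V) k} → VecAll Inside ds → Body (fun (g , start) ds)

  data Inside {F : Symbols} {V : Set} : MTerm F V → Set where
    inside : {d : MTerm F V} → Body d → Inside d
    cont : (g : F k) {ds : Vec (MTerm F V) k} → VecAll Inside ds → Inside (fun (g , cont) ds)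

module _ {F : Symbols} {τ : V → MTerm F W} (bodies : ∀ x → Body (τ x)) where
  mutual
    inside-subst₁-label : (q : FOTerm F V) → Inside (subst₁ τ (label cont q))
    inside-subst₁-label (var x)    = inside (bodies x)
    inside-subst₁-label (fun g qs) = cont g (inside-subst₁*-label* qs)

    inside-subst₁*-label* : (qs : Vec (FOTerm F V) n) → VecAll Inside (subst₁* τ (label* cont qs))
    inside-subst₁*-label* []       = []
    inside-subst₁*-label* (q ∷ qs) = inside-subst₁-label q ∷ inside-subst₁*-label* qs

  body-subst₁-pattern : (q : FOTerm F V) → Body (subst₁ τ (markPattern q))
  body-subst₁-pattern (var x)    = bodies x
  body-subst₁-pattern (fun g qs) = start g (inside-subst₁*-label* qs)

mutual
  body-mark : {s : ∀ {k} → Γ k → Abs F k} (t : Term F Γ V) → Body (mark s t)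
  body-mark (var x)    = var x
  body-mark (fun g ts) = plain g (body-mark* ts)
  body-mark {s = s} (app X ts) = body-subst₁-pattern (VecAllₚ.lookup⁺ (body-mark* ts)) (s X)

  body-mark* : {s : ∀ {k} → Γ k → Abs F k} (ts : Vec (Term F Γ V) n) → VecAll Body (mark* s ts)
  body-mark* []       = []
  body-mark* (t ∷ ts) = body-mark t ∷ body-mark* ts

-- Factoring a term through one with a larger marking

module _ {F : Symbols} {A B V : Set} {ρ : A → MTerm F V} {τ : B → MTerm F V}
         (bodies : ∀ b → Body (τ b)) where

  -- p embeds into q; its variable a is labelled with the part of q that continues p at a.
  Remainder : Set
  Remainder = Σ[ a ∈ A ] Σ[ q ∈ FOTerm F B ] ρ a ≤ᶻ subst₁ τ (label cont q)

  private
    remainder : Remainder → FOTerm F B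
    remainder = proj₁ ∘ proj₂

  mutual
    -- All symbols of `p` carry `cont`, and so do the symbols of the other term at these positions.
    -- They cannot leave `q`, because below a variable of `q` a body begins. Hence `p` is a prefix
    -- of `q`, and its leaves record what is left of `q`.
    strip : (p : FOTerm F A) (q : FOTerm F B) → subst₁ ρ (label cont p) ≤ᶻ subst₁ τ (label cont q) →
            Σ[ P ∈ FOTerm F Remainder ] rename₁ proj₁ P ≡ p × subst₁ remainder P ≡ q
    strip (var a)    q          z = var (a , q , z) , refl , refl
    -- Here `p` would reach beyond `q`: its root carries `cont`, but the body at `b` begins with a
    -- smaller mark.
    strip (fun g ps) (var b)    z with τ b | bodies b | z
    ... | _ | plain _ _ | fun _ () _
    ... | _ | start _ _ | fun _ () _
    strip (fun g ps) (fun .g qs) (fun .g _ zs) with strip* ps qs zs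
    ... | Ps , e , e′ = fun g Ps , cong (fun g) e , cong (fun g) e′

    strip* : (ps : Vec (FOTerm F A) n) (qs : Vec (FOTerm F B) n) →
             Pointwise _≤ᶻ_ (subst₁* ρ (label* cont ps)) (subst₁* τ (label* cont qs)) →
             Σ[ Ps ∈ Vec (FOTerm F Remainder) n ] rename₁* proj₁ Ps ≡ ps × subst₁* remainder Ps ≡ qs
    strip* []       []       []       = [] , refl , refl
    strip* (p ∷ ps) (q ∷ qs) (z ∷ zs) with strip p q z | strip* ps qs zs
    ... | P , e , e′ | Ps , es , es′ = P ∷ Ps , cong₂ _∷_ e es , cong₂ _∷_ e′ es′

  strip-pattern : {p : FOTerm F A} → NonVariable p → (g : F k) (qs : Vec (FOTerm F B) k) →
                  subst₁ ρ (markPattern p) ≤ᶻ subst₁ τ (label cont (fun g qs)) →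
                  Σ[ P ∈ FOTerm F Remainder ] rename₁ proj₁ P ≡ p × subst₁ remainder P ≡ fun g qs
  strip-pattern {p = var a}    nv g qs z = ⊥-elim (nv a refl)
  strip-pattern {p = fun g ps} nv .g qs (fun .g _ zs) with strip* ps qs zs
  ... | Ps , e , e′ = fun g Ps , cong (fun g) e , cong (fun g) e′

pattern-zip-var : {R : Mark → Mark → Set} {ρ : U → MTerm F V} {p : FOTerm F U} → NonVariable p →
                  {x : V} → ¬ Zip R (subst₁ ρ (markPattern p)) (var x)
pattern-zip-var {p = var a}    nv z = nv a refl
pattern-zip-var {p = fun g ps} nv ()

pattern-≤-plain : {ρ : U → MTerm F V} {p : FOTerm F U} → NonVariable p →
                  {g : F k} {ds : Vec (MTerm F V) k} → ¬ subst₁ ρ (markPattern p) ≤ᶻ fun (g , plain) ds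
pattern-≤-plain {p = var a}    nv z             = nv a refl
pattern-≤-plain {p = fun g ps} nv (fun .g () _)

IsPatternAssignment : (∀ {k} → Γ k → Abs F k) → Set
IsPatternAssignment {Γ} s = (∀ {k} (X : Γ k) → NonVariable (s X)) × (∀ {k} (X : Γ k) → Linear (s X))

module _ {F Γ : Symbols} {s : ∀ {k} → Γ k → Abs F k} (patterns : IsPatternAssignment s) where
  private
    nonVariable = proj₁ patterns
    linear      = proj₂ patterns

  module _ {V A : Set} {τ : A → MTerm F V} (bodies : ∀ a → Body (τ a)) where
    -- A variable a of q is labelled with the part of the cut term that is below q at a.
    Below : Set
    Below = Σ[ a ∈ A ] Σ[ M ∈ Term F Γ V ] mark s M ≤ᶻ τ a

    below : Below → Term F Γ V
    below = proj₁ ∘ proj₂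

    mutual
      -- No pattern of `M` straddles the border of `q`: its lower part would carry `cont` where a
      -- body begins. So `M` splits at that border into `P`, which expands to `q`, and one subterm
      -- per leaf of `P`. The recursion is on `M`; at a variable its pattern is first stripped off
      -- `q`.
      cut : (M : Term F Γ V) (q : FOTerm F A) → mark s M ≤ᶻ subst₁ τ (label cont q) →
            Σ[ P ∈ Term F Γ Below ] subst₁ below P ≡ M × subst₂ s (rename₁ proj₁ P) ≡ q
      cut M          (var a)     z             = var (a , M , z) , refl , refl
      cut (fun g Ms) (fun .g qs) (fun .g _ zs) with cut* Ms qs zs
      ... | Ps , e , e′ = fun g Ps , cong (fun g) e , cong (fun g) e′
      cut (app {k} X Ms) (fun g qs) z
        with strip-pattern bodies (nonVariable X) g qs z
      -- The leaves of `Q` pair each variable of `s X` with a remainder of `q`. By linearity this is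
      -- one remainder per argument in `Ms`, which is what the recursive call consumes.
      ... | Q , Q≡sX , Q≡q with choose {k = k} proj₁ Q (trans (cong vars Q≡sX) (linear X))
      ... | c , proj₁∘c , via-c with cut-lookup Ms (proj₁ ∘ proj₂ ∘ c) 
             (λ i → subst (λ j → Vec.lookup (mark* s Ms) j ≤ᶻ subst₁ τ (label cont (proj₁ (proj₂ (c i)))))
                      (proj₁∘c i) (proj₂ (proj₂ (c i))))
      ... | Ps , e , e′ = app X Ps , cong (app X) e , (begin
        subst₁ (Vec.lookup (subst₂* s (rename₁* proj₁ Ps))) (s X)
          ≡⟨ subst₁-cong (λ i → trans (lookup-subst₂* (rename₁* proj₁ Ps) i)
                           (trans (cong (subst₂ s) (lookup-subst₁* Ps i)) (e′ i))) (s X) ⟩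
        subst₁ (proj₁ ∘ proj₂ ∘ c) (s X)
          ≡⟨ cong (subst₁ _) Q≡sX ⟨
        subst₁ (proj₁ ∘ proj₂ ∘ c) (rename₁ proj₁ Q)
          ≡⟨ via-c (proj₁ ∘ proj₂) ⟨
        subst₁ (proj₁ ∘ proj₂) Q
          ≡⟨ Q≡q ⟩
        fun g qs ∎)
        where open ≡-Reasoning

      cut* : (Ms : Vec (Term F Γ V) n) (qs : Vec (FOTerm F A) n) →
             Pointwise _≤ᶻ_ (mark* s Ms) (subst₁* τ (label* cont qs)) →
             Σ[ Ps ∈ Vec (Term F Γ Below) n ] subst₁* below Ps ≡ Ms × subst₂* s (rename₁* proj₁ Ps) ≡ qs
      cut* []       []       []       = [] , refl , refl
      cut* (M ∷ Ms) (q ∷ qs) (z ∷ zs) with cut M q z | cut* Ms qs zs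
      ... | P , e , e′ | Ps , es , es′ = P ∷ Ps , cong₂ _∷_ e es , cong₂ _∷_ e′ es′

      cut-lookup : (Ms : Vec (Term F Γ V) n) (q : Fin n → FOTerm F A) →
                   (∀ i → Vec.lookup (mark* s Ms) i ≤ᶻ subst₁ τ (label cont (q i))) →
                   Σ[ Ps ∈ Vec (Term F Γ Below) n ] subst₁* below Ps ≡ Ms ×
                     (∀ i → subst₂ s (rename₁ proj₁ (Vec.lookup Ps i)) ≡ q i)
      cut-lookup []       q z = [] , refl , λ ()
      cut-lookup (M ∷ Ms) q z with cut M (q Fin.zero) (z Fin.zero) | cut-lookup Ms (q ∘ Fin.suc) (z ∘ Fin.suc)
      ... | P , e , e′ | Ps , es , es′ = P ∷ Ps , cong₂ _∷_ e es , λ { Fin.zero → e′ ; (Fin.suc i) → es′ i }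

  module _ {Δ : Symbols} {u : ∀ {k} → Δ k → Abs F k} (patternsᵘ : IsPatternAssignment u) where

    -- A variable together with its value under the refining substitution. The value belongs to an
    -- occurrence: as terms need not be linear, occurrences of the same `Y` may be cut differently.
    Factor : Symbols
    Factor k = Σ[ Y ∈ Δ k ] Σ[ P ∈ Term F Γ (Fin k) ] subst₂ s P ≡ u Y

    factorBody : Subst₂ F Factor Γ
    factorBody = proj₁ ∘ proj₂

    mutual
      -- The recursion is on `N`. At a variable `Y` the term `M` is cut at the border of `u Y`; the
      -- part within becomes the value of this occurrence, and the parts below are factored through
      -- the arguments of `Y`.
      factor : (M : Term F Γ V) (N : Term F Δ V) → mark s M ≤ᶻ mark u N →
               Σ[ L ∈ Term F Factor V ] rename₂ proj₁ L ≡ N × subst₂ factorBody L ≡ M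
      factor (var x)    (var .x)    (var .x)      = var x , refl , refl
      factor (app X Ms) (var x)     z             = ⊥-elim (pattern-zip-var (nonVariable X) z)
      factor (fun g Ms) (fun .g Ns) (fun .g _ zs) with factor* Ns (Vec.lookup Ms) (lookup-zip-mark* zs)
      ... | Ls , e , e′ = fun g Ls , cong (fun g) e ,
                          cong (fun g) (lookup-extensional (λ i → trans (lookup-subst₂* Ls i) (e′ i)))
      factor (app X Ms) (fun g Ns)  z             = ⊥-elim (pattern-≤-plain (nonVariable X) z)
      factor M          (app {k} Y Ns) z
        with cut (VecAllₚ.lookup⁺ (body-mark* Ns)) M (u Y)
               (zip-trans ≤ᵐ-trans z (zip-subst₁ (λ i → zip-refl ≤ᵐ-refl _) (zip-pattern-label start≤cont cont≤ (u Y))))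
      ... | P , P≡M , P≡uY
        -- Linearity is known for `u Y`, the expansion of `P` by linear patterns; such an expansion
        -- has the same 1st-order variables as `P`.
        with choose {k = k} proj₁ P (trans (sym (vars-subst₂ linear (rename₁ proj₁ P))) (trans (cong vars P≡uY) (proj₂ patternsᵘ Y)))
      ... | c , proj₁∘c , via-c
        with factor* Ns (proj₁ ∘ proj₂ ∘ c) 
               (λ i → subst (λ j → mark s (proj₁ (proj₂ (c i))) ≤ᶻ Vec.lookup (mark* u Ns) j)
                        (proj₁∘c i) (proj₂ (proj₂ (c i))))
      ... | Ls , e , e′ = app (Y , rename₁ proj₁ P , P≡uY) Ls , cong (app Y) e , (begin
        subst₁ (Vec.lookup (subst₂* factorBody Ls)) (rename₁ proj₁ P)
          ≡⟨ subst₁-cong (λ i → trans (lookup-subst₂* Ls i) (e′ i)) (rename₁ proj₁ P) ⟩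
        subst₁ (proj₁ ∘ proj₂ ∘ c) (rename₁ proj₁ P)
          ≡⟨ via-c (proj₁ ∘ proj₂) ⟨
        subst₁ (proj₁ ∘ proj₂) P
          ≡⟨ P≡M ⟩
        M ∎)
        where open ≡-Reasoning

      factor* : (Ns : Vec (Term F Δ V) n) (M : Fin n → Term F Γ V) → (∀ i → mark s (M i) ≤ᶻ Vec.lookup (mark* u Ns) i) →
                Σ[ Ls ∈ Vec (Term F Factor V) n ] rename₂* proj₁ Ls ≡ Ns × (∀ i → subst₂ factorBody (Vec.lookup Ls i) ≡ M i)
      factor* []       M z = [] , refl , λ ()
      factor* (N ∷ Ns) M z with factor (M Fin.zero) N (z Fin.zero) | factor* Ns (M ∘ Fin.suc) (z ∘ Fin.suc)
      ... | L , e , e′ | Ls , es , es′ = L ∷ Ls , cong₂ _∷_ e es , λ { Fin.zero → e′ ; (Fin.suc i) → es′ i }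

module _ {F Γ Δ : Symbols} {s : ∀ {k} → Γ k → Abs F k} {u : ∀ {k} → Δ k → Abs F k}
         {σ : Subst₂ F Δ Γ} (σ-pattern : ∀ {k} (Y : Δ k) → subst₂ s (σ Y) ≡ u Y) where
  mutual
    ≤-label-cont : {d : MTerm F V} (q : FOTerm F V) → d ≈ᶻ label cont q → d ≤ᶻ label cont q
    ≤-label-cont (var x)    (var .x)              = var x
    ≤-label-cont (fun g qs) (fun .g {m = m} _ zs) = fun g (≤ᵐ-cont m) (≤-label-cont* qs zs)

    ≤-label-cont* : {ds : Vec (MTerm F V) n} (qs : Vec (FOTerm F V) n) →
                    Pointwise _≈ᶻ_ ds (label* cont qs) → Pointwise _≤ᶻ_ ds (label* cont qs)
    ≤-label-cont* []       []       = []
    ≤-label-cont* (q ∷ qs) (z ∷ zs) = ≤-label-cont q z ∷ ≤-label-cont* qs zs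

  -- `markPattern q` is the largest body marking of `q`: below the root it is `cont` throughout, and
  -- at the root a body has at most `start`.
  ≤-pattern : {d : MTerm F V} → Body d → (q : FOTerm F V) → d ≈ᶻ markPattern q → d ≤ᶻ markPattern q
  ≤-pattern _         (var x)    (var .x)       = var x
  ≤-pattern (plain g _) (fun .g qs) (fun .g _ zs) = fun g plain≤ (≤-label-cont* qs zs)
  ≤-pattern (start g _) (fun .g qs) (fun .g _ zs) = fun g start≤ (≤-label-cont* qs zs)

  mutual
    -- The value of each variable `Y` is marked as a body with underlying term `u Y`, hence lies
    -- below the marking of the pattern `u Y`.
    mark-subst₂-≤ : (N : Term F Δ V) → mark s (subst₂ σ N) ≤ᶻ mark u N
    mark-subst₂-≤ (var x)    = var x
    mark-subst₂-≤ (fun g Ns) = fun g plain≤ (mark*-subst₂*-≤ Ns)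
    mark-subst₂-≤ (app Y Ns) = subst (_≤ᶻ mark u (app Y Ns)) (sym (mark-subst₁ (σ Y)))
      (zip-subst₁ (lookup-zip-mark* (mark*-subst₂*-≤ Ns))
        (≤-pattern (body-mark (σ Y)) (u Y)
          (erase-≈ᶻ _ _ (trans (erase-mark (σ Y)) (trans (σ-pattern Y) (sym (erase-markPattern (u Y))))))))

    mark*-subst₂*-≤ : (Ns : Vec (Term F Δ V) n) → Pointwise _≤ᶻ_ (mark* s (subst₂* σ Ns)) (mark* u Ns)
    mark*-subst₂*-≤ []       = []
    mark*-subst₂*-≤ (N ∷ Ns) = mark-subst₂-≤ N ∷ mark*-subst₂*-≤ Ns

-- Refinement as the order of markings, and meets

marks : Let F (Abs F) V → MTerm F V
marks ς = mark (bound ς) (body ς)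

erase-marks : (ς : Let F (Abs F) V) → erase (marks ς) ≡ ⟦ ς ⟧
erase-marks ς = erase-mark (body ς)

patternAssignment : {ς : Let F (Abs F) V} → Multipattern ς → IsPatternAssignment (bound ς)
patternAssignment ς-mp = Multipattern.nonVariable ς-mp , Multipattern.boundLinearCanonical ς-mp

⊑⇒≤ : {ς ζ : Let F (Abs F) V} → ς ⊑ ζ → marks ς ≤ᶻ marks ζ
⊑⇒≤ {ς = ς} {ζ} ς⊑ζ = subst (λ M → mark (bound ς) M ≤ᶻ marks ζ) body-σ
  (mark-subst₂-≤ (λ Y → trans (cong (subst₂ (bound ς)) (sym (subst₂-generic {σ = σ} Y))) (pattern-σ Y)) (body ζ))
  where open _⊑_ ς⊑ζ

module _ {F Γ : Symbols} {V : Set} {s : ∀ {k} → Γ k → Abs F k} (t : Term F Γ V) where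
  bound-canonise : (X : k ∈ arities t) → bound (canonise s t) X ≡ s (All.lookup (occurrences t) X)
  bound-canonise = Allₚ.lookup-map (occurrences t)

  marks-canonise : marks (canonise s t) ≡ mark s t
  marks-canonise = trans (sym (mark-rename₂ (λ X → sym (bound-canonise X)) (split t)))
                         (cong (mark s) (rename₂-lookup-split t))

  multipattern-canonise : IsPatternAssignment s → Multipattern (canonise s t)
  multipattern-canonise (nonVariable , linear) = record
    { linearCanonical      = canonise-linearCanonical {B = Abs F} s t
    ; nonVariable          = λ X x e → nonVariable _ x (trans (sym (bound-canonise X)) e)
    ; boundLinearCanonical = λ X → trans (cong vars (bound-canonise X)) (linear _) }

-- `factor` yields one value per occurrence. Canonising its result gives each occurrence a binding
-- of its own, so the values form a substitution on those bindings; by linear canonicity the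
-- let-expression obtained is `ζ` itself.
≤⇒⊑ : {ς ζ : Let F (Abs F) V} → Multipattern ς → Multipattern ζ → marks ς ≤ᶻ marks ζ → ς ⊑ ζ
≤⇒⊑ {F} {V} {ς} {ζ} ς-mp ζ-mp z with factor (patternAssignment ς-mp) (patternAssignment ζ-mp) (body ς) (body ζ) z
... | L , L≡ζ , L≡ς = subst (ς ⊑_) ζ′≡ζ record
  { σ         = τ
  ; body-σ    = trans (sym (subst₂-rename₂ (split L)))
                      (trans (cong (subst₂ _) (rename₂-lookup-split L)) L≡ς)
  ; pattern-σ = λ Y → trans (cong (subst₂ (bound ς)) (subst₂-generic {σ = τ} Y))
                        (trans (proj₂ (proj₂ (All.lookup (occurrences L) Y))) (sym (bound-canonise L Y))) }
  where
  τ : Subst₂ F (_∈ arities L) (_∈ context ς)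
  τ Y = factorBody (patternAssignment ς-mp) (patternAssignment ζ-mp) (All.lookup (occurrences L) Y)
  ζ′ : Let F (Abs F) V
  ζ′ = canonise (bound ζ ∘ proj₁) L
  ζ′≡ζ : ζ′ ≡ ζ
  ζ′≡ζ = toTerm-injective ζ′ ζ (canonise-linearCanonical {B = Abs F} (bound ζ ∘ proj₁) L) (Multipattern.linearCanonical ζ-mp)
    (trans (toTerm-canonise (bound ζ ∘ proj₁) L)
      (trans (sym (rename₂-rename₂ L)) (cong (rename₂ (bound ζ)) L≡ζ)))

infixr 7 _⊓ᵐ_

_⊓ᵐ_ : Mark → Mark → Mark
plain ⊓ᵐ _     = plain
start ⊓ᵐ plain = plain
start ⊓ᵐ start = start
start ⊓ᵐ cont  = start
cont  ⊓ᵐ m     = m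

⊓ᵐ-≤ˡ : ∀ m m′ → m ⊓ᵐ m′ ≤ᵐ m
⊓ᵐ-≤ˡ plain m′    = plain≤
⊓ᵐ-≤ˡ start plain = plain≤
⊓ᵐ-≤ˡ start start = start≤
⊓ᵐ-≤ˡ start cont  = start≤
⊓ᵐ-≤ˡ cont  m′    = ≤ᵐ-cont m′

⊓ᵐ-≤ʳ : ∀ m m′ → m ⊓ᵐ m′ ≤ᵐ m′
⊓ᵐ-≤ʳ plain m′    = plain≤
⊓ᵐ-≤ʳ start plain = plain≤
⊓ᵐ-≤ʳ start start = start≤
⊓ᵐ-≤ʳ start cont  = start≤cont
⊓ᵐ-≤ʳ cont  m′    = ≤ᵐ-refl m′

⊓ᵐ-greatest : ∀ {l m m′} → l ≤ᵐ m → l ≤ᵐ m′ → l ≤ᵐ m ⊓ᵐ m′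
⊓ᵐ-greatest plain≤     _          = plain≤
⊓ᵐ-greatest start≤     start≤     = start≤
⊓ᵐ-greatest start≤     start≤cont = start≤
⊓ᵐ-greatest start≤cont q          = q
⊓ᵐ-greatest cont≤      q          = q

module _ {F : Symbols} {V : Set} where
  mutual
    meet : {d d′ : MTerm F V} → d ≈ᶻ d′ → MTerm F V
    meet (var x)                  = var x
    meet (fun g {m} {m′} _ zs) = fun (g , m ⊓ᵐ m′) (meet* zs)

    meet* : {ds ds′ : Vec (MTerm F V) n} → Pointwise _≈ᶻ_ ds ds′ → Vec (MTerm F V) n
    meet* []       = []
    meet* (z ∷ zs) = meet z ∷ meet* zs

  mutual
    meet-≤ˡ : {d d′ : MTerm F V} (z : d ≈ᶻ d′) → meet z ≤ᶻ d
    meet-≤ˡ (var x)                  = var x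
    meet-≤ˡ (fun g {m} {m′} _ zs) = fun g (⊓ᵐ-≤ˡ m m′) (meet*-≤ˡ zs)

    meet*-≤ˡ : {ds ds′ : Vec (MTerm F V) n} (zs : Pointwise _≈ᶻ_ ds ds′) → Pointwise _≤ᶻ_ (meet* zs) ds
    meet*-≤ˡ []       = []
    meet*-≤ˡ (z ∷ zs) = meet-≤ˡ z ∷ meet*-≤ˡ zs

  mutual
    meet-≤ʳ : {d d′ : MTerm F V} (z : d ≈ᶻ d′) → meet z ≤ᶻ d′
    meet-≤ʳ (var x)                  = var x
    meet-≤ʳ (fun g {m} {m′} _ zs) = fun g (⊓ᵐ-≤ʳ m m′) (meet*-≤ʳ zs)

    meet*-≤ʳ : {ds ds′ : Vec (MTerm F V) n} (zs : Pointwise _≈ᶻ_ ds ds′) → Pointwise _≤ᶻ_ (meet* zs) ds′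
    meet*-≤ʳ []       = []
    meet*-≤ʳ (z ∷ zs) = meet-≤ʳ z ∷ meet*-≤ʳ zs

  mutual
    meet-greatest : {c d d′ : MTerm F V} (z : d ≈ᶻ d′) → c ≤ᶻ d → c ≤ᶻ d′ → c ≤ᶻ meet z
    meet-greatest (var x)       (var .x)      (var .x)       = var x
    meet-greatest (fun g _ zs) (fun .g p ps) (fun .g q qs) = fun g (⊓ᵐ-greatest p q) (meet*-greatest zs ps qs)

    meet*-greatest : {cs ds ds′ : Vec (MTerm F V) n} (zs : Pointwise _≈ᶻ_ ds ds′) →
                     Pointwise _≤ᶻ_ cs ds → Pointwise _≤ᶻ_ cs ds′ → Pointwise _≤ᶻ_ cs (meet* zs)
    meet*-greatest []       []       []       = []
    meet*-greatest (z ∷ zs) (p ∷ ps) (q ∷ qs) = meet-greatest z p q ∷ meet*-greatest zs ps qs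

  bodies⇒insides : {ds : Vec (MTerm F V) n} → VecAll Body ds → VecAll Inside ds
  bodies⇒insides []       = []
  bodies⇒insides (b ∷ bs) = inside b ∷ bodies⇒insides bs

  arguments-inside : {g : F k} {m : Mark} {ds : Vec (MTerm F V) k} → Inside (fun (g , m) ds) → VecAll Inside ds
  arguments-inside (inside (plain _ bs)) = bodies⇒insides bs
  arguments-inside (inside (start _ is)) = is
  arguments-inside (cont _ is)           = is

  mutual
    -- It suffices that one side is a body: the minimum at the root is then not `cont`. The
    -- condition persists, because a `plain` minimum comes from a `plain` symbol on one side, whose
    -- arguments are bodies; when both marks are non-plain, the arguments of the meet may be
    -- `Inside`.
    meet-bodyˡ : {d d′ : MTerm F V} (z : d ≈ᶻ d′) → Body d → Inside d′ → Body (meet z)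
    meet-bodyˡ (var x)      _            _                      = var x
    meet-bodyˡ (fun g _ zs) (plain _ bs) i                      = plain g (meet*-bodyˡ zs bs (arguments-inside i))
    meet-bodyˡ (fun g _ zs) (start _ is) (inside (plain _ bs))  = plain g (meet*-bodyʳ zs is bs)
    meet-bodyˡ (fun g _ zs) (start _ is) (inside (start _ is′)) = start g (meet*-inside zs is is′)
    meet-bodyˡ (fun g _ zs) (start _ is) (cont _ is′)           = start g (meet*-inside zs is is′)

    meet-bodyʳ : {d d′ : MTerm F V} (z : d ≈ᶻ d′) → Inside d → Body d′ → Body (meet z)
    meet-bodyʳ z            (inside b)   b′            = meet-bodyˡ z b (inside b′)
    meet-bodyʳ (fun g _ zs) (cont _ is)  (plain _ bs)  = plain g (meet*-bodyʳ zs is bs)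
    meet-bodyʳ (fun g _ zs) (cont _ is)  (start _ is′) = start g (meet*-inside zs is is′)

    meet-inside : {d d′ : MTerm F V} (z : d ≈ᶻ d′) → Inside d → Inside d′ → Inside (meet z)
    meet-inside z            (inside b)     i            = inside (meet-bodyˡ z b i)
    meet-inside z            i@(cont _ _)   (inside b)   = inside (meet-bodyʳ z i b)
    meet-inside (fun g _ zs) (cont _ is)    (cont _ is′) = cont g (meet*-inside zs is is′)

    meet*-bodyˡ : {ds ds′ : Vec (MTerm F V) n} (zs : Pointwise _≈ᶻ_ ds ds′) →
                  VecAll Body ds → VecAll Inside ds′ → VecAll Body (meet* zs)
    meet*-bodyˡ []       []       []       = []
    meet*-bodyˡ (z ∷ zs) (b ∷ bs) (i ∷ is) = meet-bodyˡ z b i ∷ meet*-bodyˡ zs bs is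

    meet*-bodyʳ : {ds ds′ : Vec (MTerm F V) n} (zs : Pointwise _≈ᶻ_ ds ds′) →
                  VecAll Inside ds → VecAll Body ds′ → VecAll Body (meet* zs)
    meet*-bodyʳ []       []       []       = []
    meet*-bodyʳ (z ∷ zs) (i ∷ is) (b ∷ bs) = meet-bodyʳ z i b ∷ meet*-bodyʳ zs is bs

    meet*-inside : {ds ds′ : Vec (MTerm F V) n} (zs : Pointwise _≈ᶻ_ ds ds′) →
                   VecAll Inside ds → VecAll Inside ds′ → VecAll Inside (meet* zs)
    meet*-inside []       []       []         = []
    meet*-inside (z ∷ zs) (i ∷ is) (i′ ∷ is′) = meet-inside z i i′ ∷ meet*-inside zs is is′

-- Reading a term off a marking

tabulate-+ : (m : ℕ) (f : Fin (m +ℕ n) → A) →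
             List.tabulate f ≡ List.tabulate (f ∘ (_↑ˡ n)) ++ List.tabulate (f ∘ (m ↑ʳ_))
tabulate-+ zero    f = refl
tabulate-+ (suc m) f = cong (f Fin.zero List.∷_) (tabulate-+ m (f ∘ Fin.suc))

mutual
  -- Numbering leaves from left to right, equal labels included, makes the pattern linear and
  -- canonical at once.
  linearise : (t : FOTerm F A) → ∃[ n ] Σ[ xs ∈ Vec A n ] Σ[ q ∈ Abs F n ]
              Linear q × rename₁ (Vec.lookup xs) q ≡ t
  linearise (var x)    = 1 , x ∷ [] , var Fin.zero , refl , refl
  linearise (fun g ts) = let n , xs , qs , l , e = linearise* ts in n , xs , fun g qs , l , cong (fun g) e

  linearise* : (ts : Vec (FOTerm F A) k) → ∃[ n ] Σ[ xs ∈ Vec A n ] Σ[ qs ∈ Vec (Abs F n) k ]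
               vars* qs ≡ allFin n × rename₁* (Vec.lookup xs) qs ≡ ts
  linearise* []       = 0 , [] , [] , refl , refl
  linearise* {F} (t ∷ ts) with linearise t | linearise* ts
  ... | m , xs , q , l , e | n , ys , qs , ls , es =
    m +ℕ n , xs Vec.++ ys ,
    rename₁ (_↑ˡ n) q ∷ rename₁* (m ↑ʳ_) qs ,
    (begin
      vars (rename₁ (_↑ˡ n) q) ++ vars* (rename₁* (m ↑ʳ_) qs)
        ≡⟨ cong₂ _++_ (vars-rename₁ (_↑ˡ n) q) (vars*-rename₁* (m ↑ʳ_) qs) ⟩
      List.map (_↑ˡ n) (vars q) ++ List.map (m ↑ʳ_) (vars* qs)
        ≡⟨ cong₂ (λ is js → List.map (_↑ˡ n) is ++ List.map (m ↑ʳ_) js) l ls ⟩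
      List.map (_↑ˡ n) (allFin m) ++ List.map (m ↑ʳ_) (allFin n)
        ≡⟨ cong₂ _++_ (Listₚ.map-tabulate id (_↑ˡ n)) (Listₚ.map-tabulate id (m ↑ʳ_)) ⟩
      List.tabulate (_↑ˡ n) ++ List.tabulate (m ↑ʳ_)
        ≡⟨ tabulate-+ m id ⟨
      allFin (m +ℕ n) ∎) ,
    cong₂ _∷_
      (trans (subst₁-subst₁ q) (trans (subst₁-cong (cong var ∘ Vecₚ.lookup-++ˡ xs ys) q) e))
      (trans (subst₁*-subst₁* qs) (trans (subst₁*-cong (cong var ∘ Vecₚ.lookup-++ʳ xs ys) qs) es))
    where open ≡-Reasoning

-- Patterns serve as their own 2nd-order variables, so parsing has no context to maintain.
Pattern : Symbols → Symbols
Pattern F k = Σ[ q ∈ Abs F k ] NonVariable q × Linear q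

module _ {F : Symbols} {f : V → W} where
  mutual
    label-rename₁ : (m : Mark) (q : FOTerm F V) → label m (rename₁ f q) ≡ rename₁ f (label m q)
    label-rename₁ m (var x)    = refl
    label-rename₁ m (fun g qs) = cong (fun (g , m)) (label*-rename₁* m qs)

    label*-rename₁* : (m : Mark) (qs : Vec (FOTerm F V) n) →
                      label* m (rename₁* f qs) ≡ rename₁* f (label* m qs)
    label*-rename₁* m []       = refl
    label*-rename₁* m (q ∷ qs) = cong₂ _∷_ (label-rename₁ m q) (label*-rename₁* m qs)

  markPattern-rename₁ : (q : FOTerm F V) → markPattern (rename₁ f q) ≡ rename₁ f (markPattern q)
  markPattern-rename₁ (var x)    = refl
  markPattern-rename₁ (fun g qs) = cong (fun (g , start)) (label*-rename₁* cont qs)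

module _ {F : Symbols} {V : Set} where
  mutual
    -- Surjectivity of the correspondence, from which meets get their existence: a pointwise minimum
    -- is a body, and a multipattern with that marking is recovered here. A pattern is collected as
    -- a 1st-order term whose leaves are the parsed terms below it, then linearised.
    parse : {d : MTerm F V} → Body d → Σ[ t ∈ Term F (Pattern F) V ] mark proj₁ t ≡ d
    parse (var x)      = var x , refl
    parse (plain g bs) with parse* bs
    ... | ts , e = fun g ts , cong (fun (g , plain)) e
    parse (start g is) with parseInside* is
    ... | ps , e with linearise (fun g ps)
    ... | k , ts , q , l , e′ = app (q , nonVariable {ts = ts} q e′ , l) ts , (begin
      subst₁ (Vec.lookup (mark* proj₁ ts)) (markPattern q)
        ≡⟨ subst₁-cong (lookup-mark* ts) (markPattern q) ⟩
      subst₁ (mark proj₁ ∘ Vec.lookup ts) (markPattern q)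
        ≡⟨ subst₁-subst₁ (markPattern q) ⟨
      subst₁ (mark proj₁) (rename₁ (Vec.lookup ts) (markPattern q))
        ≡⟨ cong (subst₁ (mark proj₁)) (trans (sym (markPattern-rename₁ q)) (cong markPattern e′)) ⟩
      fun (g , start) (subst₁* (mark proj₁) (label* cont ps))
        ≡⟨ cong (fun (g , start)) e ⟩
      fun (g , start) _ ∎)
      where
      open ≡-Reasoning
      nonVariable : ∀ {k} {ts : Vec _ k} (q : Abs F k) → rename₁ (Vec.lookup ts) q ≡ fun g ps → NonVariable q
      nonVariable (var _) () _ _
      nonVariable (fun _ _) _ _ ()

    parse* : {ds : Vec (MTerm F V) n} → VecAll Body ds → Σ[ ts ∈ Vec (Term F (Pattern F) V) n ] mark* proj₁ ts ≡ ds
    parse* []       = [] , refl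
    parse* (b ∷ bs) with parse b | parse* bs
    ... | t , e | ts , es = t ∷ ts , cong₂ _∷_ e es

    parseInside : {d : MTerm F V} → Inside d →
                  Σ[ p ∈ FOTerm F (Term F (Pattern F) V) ] subst₁ (mark proj₁) (label cont p) ≡ d
    parseInside (inside b)  with parse b
    ... | t , e = var t , e
    parseInside (cont g is) with parseInside* is
    ... | ps , e = fun g ps , cong (fun (g , cont)) e

    parseInside* : {ds : Vec (MTerm F V) n} → VecAll Inside ds →
                   Σ[ ps ∈ Vec (FOTerm F (Term F (Pattern F) V)) n ] subst₁* (mark proj₁) (label* cont ps) ≡ ds
    parseInside* []       = [] , refl
    parseInside* (i ∷ is) with parseInside i | parseInside* is
    ... | p , e | ps , es = p ∷ ps , cong₂ _∷_ e es

module _ {F : Symbols} {V : Set} {w : FOTerm F V} where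
  open MultipatternOf

  marks-≈ᶻ : {ς ζ : Let F (Abs F) V} → MultipatternOf w ς → MultipatternOf w ζ → marks ς ≈ᶻ marks ζ
  marks-≈ᶻ {ς} {ζ} p q = erase-≈ᶻ (marks ς) (marks ζ)
    (trans (erase-marks ς) (trans (denotes p) (trans (sym (denotes q)) (sym (erase-marks ζ)))))

  -- The marking of the meet is returned too, since whether it is the bottom element is judged by
  -- marks.
  isMeet-exists : {ς ζ : Let F (Abs F) V} (p : MultipatternOf w ς) (q : MultipatternOf w ζ) →
                  ∃[ μ ] IsMeet w ς ζ μ × marks μ ≡ meet (marks-≈ᶻ p q)
  isMeet-exists {ς} {ζ} p q with parse (meet-bodyˡ (marks-≈ᶻ p q) (body-mark (body ς)) (inside (body-mark (body ζ))))
  ... | t , e = μ , record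
    { member   = μ-member
    ; lowerˡ   = ≤⇒⊑ μ-multipattern (multipattern p) (subst (_≤ᶻ marks ς) (sym marks-μ) (meet-≤ˡ z))
    ; lowerʳ   = ≤⇒⊑ μ-multipattern (multipattern q) (subst (_≤ᶻ marks ζ) (sym marks-μ) (meet-≤ʳ z))
    ; greatest = λ ν r ν⊑ς ν⊑ζ → ≤⇒⊑ (multipattern r) μ-multipattern
                   (subst (marks ν ≤ᶻ_) (sym marks-μ) (meet-greatest z (⊑⇒≤ ν⊑ς) (⊑⇒≤ ν⊑ζ))) } , marks-μ
    where
    z = marks-≈ᶻ p q
    μ : Let F (Abs F) V
    μ = canonise proj₁ t
    marks-μ : marks μ ≡ meet z
    marks-μ = trans (marks-canonise t) e
    μ-multipattern : Multipattern μ
    μ-multipattern = multipattern-canonise t (proj₁ ∘ proj₂ , proj₂ ∘ proj₂)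
    μ-member : MultipatternOf w μ
    μ-member = record
      { multipattern = μ-multipattern
      ; denotes      = trans (sym (erase-marks μ)) (trans (cong erase marks-μ)
                         (trans (erase-zip (meet-≤ˡ z)) (trans (erase-marks ς) (denotes p)))) }

-- Joins

-- The maximum of two marks, restricted to disjoint ones. As a relation it carries the evidence of
-- disjointness along, which `join-∥` extracts.
data Joinᵐ : Mark → Mark → Mark → Set where
  left  : ∀ {m} → Joinᵐ m plain m
  right : ∀ {m} → Joinᵐ plain m m

mutual
  data Join {F : Symbols} {V : Set} : MTerm F V → MTerm F V → MTerm F V → Set where
    var : (x : V) → Join (var x) (var x) (var x)
    fun : (g : F k) {a b c : Mark} {as bs cs : Vec (MTerm F V) k} →
          Joinᵐ a b c → Join* as bs cs → Join (fun (g , a) as) (fun (g , b) bs) (fun (g , c) cs)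

  data Join* {F : Symbols} {V : Set} : (as bs cs : Vec (MTerm F V) n) → Set where
    []  : Join* [] [] []
    _∷_ : {a b c : MTerm F V} {as bs cs : Vec (MTerm F V) n} →
          Join a b c → Join* as bs cs → Join* (a ∷ as) (b ∷ bs) (c ∷ cs)

lookup-join* : {as bs cs : Vec (MTerm F V) n} → Join* as bs cs →
               ∀ i → Join (Vec.lookup as i) (Vec.lookup bs i) (Vec.lookup cs i)
lookup-join* (j ∷ js) Fin.zero    = j
lookup-join* (j ∷ js) (Fin.suc i) = lookup-join* js i

module _ {F : Symbols} {V W : Set} {α β γ : V → MTerm F W} (join-leaf : ∀ x → Join (α x) (β x) (γ x)) where
  mutual
    join-subst₁ : {a b c : MTerm F V} → Join a b c → Join (subst₁ α a) (subst₁ β b) (subst₁ γ c)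
    join-subst₁ (var x)      = join-leaf x
    join-subst₁ (fun g j js) = fun g j (join*-subst₁* js)

    join*-subst₁* : {as bs cs : Vec (MTerm F V) n} → Join* as bs cs →
                    Join* (subst₁* α as) (subst₁* β bs) (subst₁* γ cs)
    join*-subst₁* []       = []
    join*-subst₁* (j ∷ js) = join-subst₁ j ∷ join*-subst₁* js

module _ {F : Symbols} {V : Set} where
  mutual
    join-labelˡ : (m : Mark) (q : FOTerm F V) → Join (label m q) (label plain q) (label m q)
    join-labelˡ m (var x)    = var x
    join-labelˡ m (fun g qs) = fun g left (join*-labelˡ m qs)

    join*-labelˡ : (m : Mark) (qs : Vec (FOTerm F V) n) → Join* (label* m qs) (label* plain qs) (label* m qs)
    join*-labelˡ m []       = []
    join*-labelˡ m (q ∷ qs) = join-labelˡ m q ∷ join*-labelˡ m qs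

  mutual
    join-labelʳ : (m : Mark) (q : FOTerm F V) → Join (label plain q) (label m q) (label m q)
    join-labelʳ m (var x)    = var x
    join-labelʳ m (fun g qs) = fun g right (join*-labelʳ m qs)

    join*-labelʳ : (m : Mark) (qs : Vec (FOTerm F V) n) → Join* (label* plain qs) (label* m qs) (label* m qs)
    join*-labelʳ m []       = []
    join*-labelʳ m (q ∷ qs) = join-labelʳ m q ∷ join*-labelʳ m qs

  join-patternˡ : (q : FOTerm F V) → Join (markPattern q) (label plain q) (markPattern q)
  join-patternˡ (var x)    = var x
  join-patternˡ (fun g qs) = fun g left (join*-labelˡ cont qs)

  join-patternʳ : (q : FOTerm F V) → Join (label plain q) (markPattern q) (markPattern q)
  join-patternʳ (var x)    = var x
  join-patternʳ (fun g qs) = fun g right (join*-labelʳ cont qs)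

  module _ {R : Mark → Mark → Set} (r : ∀ {a b c} → Joinᵐ a b c → R a c) where
    mutual
      join-zipˡ : {a b c : MTerm F V} → Join a b c → Zip R a c
      join-zipˡ (var x)      = var x
      join-zipˡ (fun g j js) = fun g (r j) (join*-zipˡ js)

      join*-zipˡ : {as bs cs : Vec (MTerm F V) n} → Join* as bs cs → Pointwise (Zip R) as cs
      join*-zipˡ []       = []
      join*-zipˡ (j ∷ js) = join-zipˡ j ∷ join*-zipˡ js

  module _ {R : Mark → Mark → Set} (r : ∀ {a b c} → Joinᵐ a b c → R a b) where
    mutual
      join-zip : {a b c : MTerm F V} → Join a b c → Zip R a b
      join-zip (var x)      = var x
      join-zip (fun g j js) = fun g (r j) (join*-zip js)

      join*-zip : {as bs cs : Vec (MTerm F V) n} → Join* as bs cs → Pointwise (Zip R) as bs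
      join*-zip []       = []
      join*-zip (j ∷ js) = join-zip j ∷ join*-zip js

  mutual
    join-flip : {a b c : MTerm F V} → Join a b c → Join b a c
    join-flip (var x)          = var x
    join-flip (fun g left js)  = fun g right (join*-flip js)
    join-flip (fun g right js) = fun g left (join*-flip js)

    join*-flip : {as bs cs : Vec (MTerm F V) n} → Join* as bs cs → Join* bs as cs
    join*-flip []       = []
    join*-flip (j ∷ js) = join-flip j ∷ join*-flip js

  mutual
    join-least : {a b c d : MTerm F V} → Join a b c → a ≤ᶻ d → b ≤ᶻ d → c ≤ᶻ d
    join-least (var x)          (var .x)      _              = var x
    join-least (fun g left js)  (fun .g p ps) (fun .g _ qs) = fun g p (join*-least js ps qs)
    join-least (fun g right js) (fun .g _ ps) (fun .g q qs) = fun g q (join*-least js ps qs)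

    join*-least : {as bs cs ds : Vec (MTerm F V) n} → Join* as bs cs →
                  Pointwise _≤ᶻ_ as ds → Pointwise _≤ᶻ_ bs ds → Pointwise _≤ᶻ_ cs ds
    join*-least []       []       []       = []
    join*-least (j ∷ js) (p ∷ ps) (q ∷ qs) = join-least j p q ∷ join*-least js ps qs

  join-≤ˡ : {a b c : MTerm F V} → Join a b c → a ≤ᶻ c
  join-≤ˡ = join-zipˡ λ { left → ≤ᵐ-refl _ ; right → plain≤ }

  join-≤ʳ : {a b c : MTerm F V} → Join a b c → b ≤ᶻ c
  join-≤ʳ j = join-≤ˡ (join-flip j)

  join-∥ : {a b c : MTerm F V} → Join a b c → a ∥ b
  join-∥ = join-zip λ { left → plainʳ ; right → plainˡ }

  mutual
    -- At every symbol one of `a` and `b` is plain, so a common lower bound is plain everywhere and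
    -- lies below every marking of the term.
    disjoint-lower-bound : {a b c d : MTerm F V} → c ≤ᶻ a → c ≤ᶻ b → a ∥ b → c ≈ᶻ d → c ≤ᶻ d
    disjoint-lower-bound (var x) _ _ (var .x) = var x
    disjoint-lower-bound (fun g p ps) (fun .g q qs) (fun .g r rs) (fun .g _ zs) =
      fun g (≤ᵐ-any p q r) (disjoint-lower-bound* ps qs rs zs)
      where
      ≤ᵐ-any : ∀ {a b c d} → c ≤ᵐ a → c ≤ᵐ b → Disjoint a b → c ≤ᵐ d
      ≤ᵐ-any plain≤ _ plainˡ = plain≤
      ≤ᵐ-any _ plain≤ plainʳ = plain≤

    disjoint-lower-bound* : {as bs cs ds : Vec (MTerm F V) n} → Pointwise _≤ᶻ_ cs as → Pointwise _≤ᶻ_ cs bs →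
      Pointwise _∥_ as bs → Pointwise _≈ᶻ_ cs ds → Pointwise _≤ᶻ_ cs ds
    disjoint-lower-bound* []       []       []       []       = []
    disjoint-lower-bound* (p ∷ ps) (q ∷ qs) (r ∷ rs) (z ∷ zs) =
      disjoint-lower-bound p q r z ∷ disjoint-lower-bound* ps qs rs zs

-- Terms over two families of patterns, and their restrictions

mutual
  vars-embed : (t : FOTerm F V) → vars (embed {F} {Γ} t) ≡ vars t
  vars-embed (var x)    = refl
  vars-embed (fun g ts) = vars*-embed ts

  vars*-embed : (ts : Vec (FOTerm F V) n) → vars* (rename₂* {F} {Δ = Γ} (λ ()) ts) ≡ vars* ts
  vars*-embed []       = refl
  vars*-embed {Γ = Γ} (t ∷ ts) = cong₂ _++_ (vars-embed {Γ = Γ} t) (vars*-embed {Γ = Γ} ts)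

module _ {F Γ Δ : Symbols} where
  -- `keepˡ` and `keepʳ` are `instʳ` and `instˡ` of `JoinBody` for arbitrary families, named after
  -- the family that survives instead of the one that is expanded.
  keepˡ : (∀ {k} → Δ k → Abs F k) → Term F (Γ ∪ Δ) V → Term F Γ V
  keepˡ u = subst₂ [ generic , (λ Y → embed (u Y)) ]′

  keepˡ* : (∀ {k} → Δ k → Abs F k) → Vec (Term F (Γ ∪ Δ) V) n → Vec (Term F Γ V) n
  keepˡ* u = subst₂* [ generic , (λ Y → embed (u Y)) ]′

  keepʳ : (∀ {k} → Γ k → Abs F k) → Term F (Γ ∪ Δ) V → Term F Δ V
  keepʳ s = subst₂ [ (λ X → embed (s X)) , generic ]′

  keepʳ* : (∀ {k} → Γ k → Abs F k) → Vec (Term F (Γ ∪ Δ) V) n → Vec (Term F Δ V) n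
  keepʳ* s = subst₂* [ (λ X → embed (s X)) , generic ]′

  module _ {s : ∀ {k} → Γ k → Abs F k} {u : ∀ {k} → Δ k → Abs F k} where
    keepˡ-app : (X : Γ k) (Ls : Vec (Term F (Γ ∪ Δ) V) k) → keepˡ u (app (inj₁ X) Ls) ≡ app X (keepˡ* u Ls)
    keepˡ-app X Ls = cong (app X) (subst₁*-lookup (keepˡ* u Ls))

    keepʳ-app : (Y : Δ k) (Ls : Vec (Term F (Γ ∪ Δ) V) k) → keepʳ s (app (inj₂ Y) Ls) ≡ app Y (keepʳ* s Ls)
    keepʳ-app Y Ls = cong (app Y) (subst₁*-lookup (keepʳ* s Ls))

    -- Expanding the families one after the other is the same as expanding both at once. As `s` and
    -- `u` are independent, left-hand and right-hand sides can be mixed.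
    subst₂-keepˡ : (L : Term F (Γ ∪ Δ) V) → subst₂ s (keepˡ u L) ≡ subst₂ [ s , u ]′ L
    subst₂-keepˡ L = trans (subst₂-subst₂ L) (subst₂-cong {σ = σ} {σ′ = [ s , u ]′} pointwise L)
      where
      σ : Subst₂ F (Γ ∪ Δ) _
      σ X = subst₂ s ([ generic , (λ Y → embed (u Y)) ]′ X)
      pointwise : ∀ {k} (X : (Γ ∪ Δ) k) → σ X ≡ [ s , u ]′ X
      pointwise (inj₁ X) = subst₂-generic {σ = s} X
      pointwise (inj₂ Y) = trans (subst₂-embed {σ = s} (u Y)) (embed-id (u Y))

    subst₂-keepʳ : (L : Term F (Γ ∪ Δ) V) → subst₂ u (keepʳ s L) ≡ subst₂ [ s , u ]′ L
    subst₂-keepʳ L = trans (subst₂-subst₂ L) (subst₂-cong {σ = σ} {σ′ = [ s , u ]′} pointwise L)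
      where
      σ : Subst₂ F (Γ ∪ Δ) _
      σ X = subst₂ u ([ (λ X → embed (s X)) , generic ]′ X)
      pointwise : ∀ {k} (X : (Γ ∪ Δ) k) → σ X ≡ [ s , u ]′ X
      pointwise (inj₁ X) = trans (subst₂-embed {σ = u} (s X)) (embed-id (s X))
      pointwise (inj₂ Y) = subst₂-generic {σ = u} Y

mark-subst₁-embed : {s : ∀ {k} → Γ k → Abs F k} (ts : Vec (Term F Γ V) k) (q : Abs F k) →
  mark s (subst₁ (Vec.lookup ts) (embed q)) ≡ subst₁ (Vec.lookup (mark* s ts)) (label plain q)
mark-subst₁-embed {s = s} ts q = begin
  mark s (subst₁ (Vec.lookup ts) (embed q))
    ≡⟨ mark-subst₁ (embed q) ⟩
  subst₁ (mark s ∘ Vec.lookup ts) (mark s (embed q))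
    ≡⟨ cong (subst₁ (mark s ∘ Vec.lookup ts)) (mark-embed q) ⟩
  subst₁ (mark s ∘ Vec.lookup ts) (label plain q)
    ≡⟨ subst₁-cong (lookup-mark* ts) (label plain q) ⟨
  subst₁ (Vec.lookup (mark* s ts)) (label plain q) ∎
  where open ≡-Reasoning

module _ {F Γ Δ : Symbols} {s : ∀ {k} → Γ k → Abs F k} {u : ∀ {k} → Δ k → Abs F k} where
  mutual
    -- Every pattern of `L` is marked in the restriction that keeps it and appears as plain symbols
    -- in the one that expands it, so at most one of the two marks is non-plain at each symbol.
    join-mark : (L : Term F (Γ ∪ Δ) V) → Join (mark s (keepˡ u L)) (mark u (keepʳ s L)) (mark [ s , u ]′ L)
    join-mark (var x)    = var x
    join-mark (fun g Ls) = fun g left (join*-mark* Ls)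
    join-mark (app (inj₁ X) Ls) = transport₂ (λ a b → Join a b (mark [ s , u ]′ (app (inj₁ X) Ls)))
      (sym (cong (mark s) (keepˡ-app {s = s} X Ls))) (sym (mark-subst₁-embed (keepʳ* s Ls) (s X)))
      (join-subst₁ (lookup-join* (join*-mark* Ls)) (join-patternˡ (s X)))
    join-mark (app (inj₂ Y) Ls) = transport₂ (λ a b → Join a b (mark [ s , u ]′ (app (inj₂ Y) Ls)))
      (sym (mark-subst₁-embed (keepˡ* u Ls) (u Y))) (sym (cong (mark u) (keepʳ-app {u = u} Y Ls)))
      (join-subst₁ (lookup-join* (join*-mark* Ls)) (join-patternʳ (u Y)))

    join*-mark* : (Ls : Vec (Term F (Γ ∪ Δ) V) n) →
                  Join* (mark* s (keepˡ* u Ls)) (mark* u (keepʳ* s Ls)) (mark* [ s , u ]′ Ls)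
    join*-mark* []       = []
    join*-mark* (L ∷ Ls) = join-mark L ∷ join*-mark* Ls

-- Amalgamation along disjoint markings

pattern-∥-cont : {ρ : U → MTerm F V} {p : FOTerm F U} → NonVariable p →
                 {g : F k} {ds : Vec (MTerm F V) k} → ¬ subst₁ ρ (markPattern p) ∥ fun (g , cont) ds
pattern-∥-cont {p = var a}    nv z             = nv a refl
pattern-∥-cont {p = fun g ps} nv (fun .g () _)

disjoint-sym : ∀ {m m′} → Disjoint m m′ → Disjoint m′ m
disjoint-sym plainˡ = plainʳ
disjoint-sym plainʳ = plainˡ

module _ {F Δ : Symbols} {u : ∀ {k} → Δ k → Abs F k} (patterns : IsPatternAssignment u)
         {A V : Set} {ρ : A → MTerm F V} where
  Matched : Set
  Matched = Σ[ a ∈ A ] Σ[ N ∈ Term F Δ V ] mark u N ∥ ρ a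

  private
    matched : Matched → Term F Δ V
    matched = proj₁ ∘ proj₂

  mutual
    -- Only `plain` is disjoint from `cont`, so no pattern of `N` meets `q`: the symbols of `q` form
    -- a prefix of `N` made of plain symbols.
    match : (N : Term F Δ V) (q : FOTerm F A) → mark u N ∥ subst₁ ρ (label cont q) →
            Σ[ Q ∈ Term F Δ Matched ] rename₁ proj₁ Q ≡ embed q × subst₁ matched Q ≡ N
    match N          (var a)     z             = var (a , N , z) , refl , refl
    match (fun g Ns) (fun .g qs) (fun .g _ zs) with match* Ns qs zs
    ... | Qs , e , e′ = fun g Qs , cong (fun g) e , cong (fun g) e′
    match (app Y Ns) (fun g qs)  z             = ⊥-elim (pattern-∥-cont (proj₁ patterns Y) z)

    match* : (Ns : Vec (Term F Δ V) n) (qs : Vec (FOTerm F A) n) →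
             Pointwise _∥_ (mark* u Ns) (subst₁* ρ (label* cont qs)) →
             Σ[ Qs ∈ Vec (Term F Δ Matched) n ]
               rename₁* proj₁ Qs ≡ rename₂* (λ ()) qs × subst₁* matched Qs ≡ Ns
    match* []       []       []       = [] , refl , refl
    match* (N ∷ Ns) (q ∷ qs) (z ∷ zs) with match N q z | match* Ns qs zs
    ... | Q , e , e′ | Qs , es , es′ = Q ∷ Qs , cong₂ _∷_ e es , cong₂ _∷_ e′ es′

module _ {F Γ Δ : Symbols} {s : ∀ {k} → Γ k → Abs F k} {u : ∀ {k} → Δ k → Abs F k}
         (patternsˢ : IsPatternAssignment s) (patternsᵘ : IsPatternAssignment u) where

  private
    linear-embedˢ : (X : Γ k) → vars (embed {F} {Δ} (s X)) ≡ List.allFin k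
    linear-embedˢ X = trans (vars-embed {Γ = Δ} (s X)) (proj₂ patternsˢ X)

    linear-embedᵘ : (Y : Δ k) → vars (embed {F} {Γ} (u Y)) ≡ List.allFin k
    linear-embedᵘ Y = trans (vars-embed {Γ = Γ} (u Y)) (proj₂ patternsᵘ Y)

  Amalgam : Term F Γ V → Term F Δ V → Set
  Amalgam {V} M N = Σ[ L ∈ Term F (Γ ∪ Δ) V ] keepˡ u L ≡ M × keepʳ s L ≡ N

  -- Unlike `Matched`, this stores finished amalgams and not just disjointness evidence: the
  -- recursive calls have to be made while descending into the driving term.
  Amalgamated : Vec (Term F Δ V) k → Set
  Amalgamated {V} {k} Ns = Σ[ i ∈ Fin k ] Σ[ M ∈ Term F Γ V ] Amalgam M (Vec.lookup Ns i)

  amalgamated : (Ns : Vec (Term F Δ V) k) → Amalgamated Ns → Term F Γ V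
  amalgamated Ns = proj₁ ∘ proj₂

  mutual
    -- The recursion is on `M`, hence the asymmetry. At a variable of `M`, `N` is first matched
    -- against the pattern and the recursion moves to `Ms`. At a variable of `N`, its pattern covers
    -- plain symbols of `M`; `amalgamate-inside` walks down these and amalgamates with the arguments
    -- `Ns` at the leaves.
    amalgamate : (M : Term F Γ V) (N : Term F Δ V) → mark s M ∥ mark u N → Amalgam M N
    amalgamate (var x)    (var .x)    (var .x)      = var x , refl , refl
    amalgamate (fun g Ms) (fun .g Ns) (fun .g _ zs)
      with amalgamate-lookup Ms (Vec.lookup Ns) (λ i → zip-flip disjoint-sym (lookup-zip-mark* {s = u} {ts = Ns} (zip-flip* disjoint-sym zs) i))
    ... | Ls , e , e′ = fun g Ls , cong (fun g) e ,
                        cong (fun g) (lookup-extensional (λ i → trans (lookup-subst₂* Ls i) (e′ i)))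
    amalgamate (var x)    (app Y Ns)  z = ⊥-elim (pattern-zip-var (proj₁ patternsᵘ Y) (zip-flip disjoint-sym z))
    amalgamate (fun g Ms) (app {k} Y Ns) z
      with amalgamate-pattern g Ms Ns (u Y) (proj₁ patternsᵘ Y) z
    ... | Q , Q≡uY , Q≡M with choose {k = k} proj₁ Q (trans (cong vars Q≡uY) (linear-embedᵘ Y))
    ... | c , proj₁∘c , via-c = app (inj₂ Y) Ls , (begin
      subst₁ (Vec.lookup (keepˡ* u Ls)) (embed (u Y))
        ≡⟨ subst₁-cong (λ i → trans (lookup-subst₂* Ls i) (trans (cong (keepˡ u) (Vecₚ.lookup∘tabulate _ i))
                           (proj₁ (proj₂ (proj₂ (proj₂ (c i))))))) (embed (u Y)) ⟩
      subst₁ (amalgamated Ns ∘ c) (embed (u Y))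
        ≡⟨ cong (subst₁ (amalgamated Ns ∘ c)) Q≡uY ⟨
      subst₁ (amalgamated Ns ∘ c) (rename₁ proj₁ Q)
        ≡⟨ via-c (amalgamated Ns) ⟨
      subst₁ (amalgamated Ns) Q
        ≡⟨ Q≡M ⟩
      fun g Ms ∎) , trans (keepʳ-app {s = s} {u} Y Ls) (cong (app Y) (lookup-extensional λ i →
        trans (lookup-subst₂* Ls i) (trans (cong (keepʳ s) (Vecₚ.lookup∘tabulate _ i))
          (trans (proj₂ (proj₂ (proj₂ (proj₂ (c i))))) (cong (Vec.lookup Ns) (proj₁∘c i))))))
      where
      open ≡-Reasoning
      Ls : Vec (Term F (Γ ∪ Δ) _) k
      Ls = Vec.tabulate (proj₁ ∘ proj₂ ∘ proj₂ ∘ c)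
    amalgamate (app {k} X Ms) N z
      with match patternsᵘ N (s X)
             -- A mark disjoint from `start` is `plain`, hence disjoint from `cont` as well. Taking
             -- this transport of disjointness as the relation `S` replaces `start` by `cont` at the
             -- root of the pattern and leaves the other marks alone.
             (zip-trans {R = Disjoint} {S = λ m m′ → ∀ l → Disjoint l m → Disjoint l m′} (λ d f → f _ d)
               (zip-flip disjoint-sym z)
               (zip-subst₁ (λ i → zip-refl (λ m l d → d) (Vec.lookup (mark* s Ms) i))
                 (zip-pattern-label (λ { l plainˡ → plainˡ }) (λ l d → d) (s X))))
    ... | Q , Q≡sX , Q≡N with choose {k = k} proj₁ Q (trans (cong vars Q≡sX) (linear-embedˢ X))
    ... | c , proj₁∘c , via-c
      with amalgamate-lookup Ms (proj₁ ∘ proj₂ ∘ c) 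
             (λ i → subst (λ j → Vec.lookup (mark* s Ms) j ∥ mark u (proj₁ (proj₂ (c i)))) (proj₁∘c i)
                      (zip-flip disjoint-sym (proj₂ (proj₂ (c i)))))
    ... | Ls , e , e′ = app (inj₁ X) Ls , trans (keepˡ-app {s = s} {u} X Ls) (cong (app X) e) , (begin
      subst₁ (Vec.lookup (keepʳ* s Ls)) (embed (s X))
        ≡⟨ subst₁-cong (λ i → trans (lookup-subst₂* Ls i) (e′ i)) (embed (s X)) ⟩
      subst₁ (proj₁ ∘ proj₂ ∘ c) (embed (s X))
        ≡⟨ cong (subst₁ (proj₁ ∘ proj₂ ∘ c)) Q≡sX ⟨
      subst₁ (proj₁ ∘ proj₂ ∘ c) (rename₁ proj₁ Q)
        ≡⟨ via-c (proj₁ ∘ proj₂) ⟨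
      subst₁ (proj₁ ∘ proj₂) Q
        ≡⟨ Q≡N ⟩
      N ∎)
      where open ≡-Reasoning

    amalgamate-lookup : (Ms : Vec (Term F Γ V) n) (N : Fin n → Term F Δ V) →
      (∀ i → Vec.lookup (mark* s Ms) i ∥ mark u (N i)) →
      Σ[ Ls ∈ Vec (Term F (Γ ∪ Δ) V) n ] keepˡ* u Ls ≡ Ms × (∀ i → keepʳ s (Vec.lookup Ls i) ≡ N i)
    amalgamate-lookup []       N z = [] , refl , λ ()
    amalgamate-lookup (M ∷ Ms) N z
      with amalgamate M (N Fin.zero) (z Fin.zero) | amalgamate-lookup Ms (N ∘ Fin.suc) (z ∘ Fin.suc)
    ... | L , e , e′ | Ls , es , es′ = L ∷ Ls , cong₂ _∷_ e es , λ { Fin.zero → e′ ; (Fin.suc i) → es′ i }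

    amalgamate-pattern : ∀ {j} (g : F k) (Ms : Vec (Term F Γ V) k) (Ns : Vec (Term F Δ V) j) (q : Abs F j) →
      NonVariable q → fun (g , plain) (mark* s Ms) ∥ subst₁ (Vec.lookup (mark* u Ns)) (markPattern q) →
      Σ[ Q ∈ Term F Γ (Amalgamated Ns) ] rename₁ proj₁ Q ≡ embed q × subst₁ (amalgamated Ns) Q ≡ fun g Ms
    amalgamate-pattern g  Ms Ns (var i)    nv z             = ⊥-elim (nv i refl)
    amalgamate-pattern g  Ms Ns (fun .g qs) nv (fun .g _ zs) with amalgamate-inside* Ms Ns qs zs
    ... | Qs , e , e′ = fun g Qs , cong (fun g) e , cong (fun g) e′

    amalgamate-inside : (M : Term F Γ V) (Ns : Vec (Term F Δ V) k) (q : Abs F k) →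
      mark s M ∥ subst₁ (Vec.lookup (mark* u Ns)) (label cont q) →
      Σ[ Q ∈ Term F Γ (Amalgamated Ns) ] rename₁ proj₁ Q ≡ embed q × subst₁ (amalgamated Ns) Q ≡ M
    amalgamate-inside M          Ns (var i)     z =
      var (i , M , amalgamate M (Vec.lookup Ns i) (subst (mark s M ∥_) (lookup-mark* Ns i) z)) , refl , refl
    amalgamate-inside (fun g Ms) Ns (fun .g qs) (fun .g _ zs) with amalgamate-inside* Ms Ns qs zs
    ... | Qs , e , e′ = fun g Qs , cong (fun g) e , cong (fun g) e′
    amalgamate-inside (app X Ms) Ns (fun g qs)  z = ⊥-elim (pattern-∥-cont (proj₁ patternsˢ X) z)

    amalgamate-inside* : (Ms : Vec (Term F Γ V) n) (Ns : Vec (Term F Δ V) k) (qs : Vec (Abs F k) n) →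
      Pointwise _∥_ (mark* s Ms) (subst₁* (Vec.lookup (mark* u Ns)) (label* cont qs)) →
      Σ[ Qs ∈ Vec (Term F Γ (Amalgamated Ns)) n ]
        rename₁* proj₁ Qs ≡ rename₂* (λ ()) qs × subst₁* (amalgamated Ns) Qs ≡ Ms
    amalgamate-inside* []       Ns []       []       = [] , refl , refl
    amalgamate-inside* (M ∷ Ms) Ns (q ∷ qs) (z ∷ zs)
      with amalgamate-inside M Ns q z | amalgamate-inside* Ms Ns qs zs
    ... | Q , e , e′ | Qs , es , es′ = Q ∷ Qs , cong₂ _∷_ e es , cong₂ _∷_ e′ es′

app≢pattern : {X : Γ k} {us : Vec (Term F Γ V) k} {τ : U → Term F Γ V} {q : FOTerm F U} →
              NonVariable q → app X us ≢ subst₁ τ (embed q)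
app≢pattern {q = var x} nv e = nv x refl
app≢pattern {q = fun _ _} nv ()

subst₁-linear-injective : (q : Abs F k) → Linear q → {us vs : Vec (Term F Γ V) k} →
  subst₁ (Vec.lookup us) (embed q) ≡ subst₁ (Vec.lookup vs) (embed q) → us ≡ vs
subst₁-linear-injective {Γ = Γ} q linear e = lookup-extensional λ i →
  subst₁-injective-vars (embed q) e (subst (i ∈_) (sym (trans (vars-embed {Γ = Γ} q) linear)) (∈-allFin i))

module _ {F Γ Δ : Symbols} {s : ∀ {k} → Γ k → Abs F k} {u : ∀ {k} → Δ k → Abs F k}
         (patternsˢ : IsPatternAssignment s) (patternsᵘ : IsPatternAssignment u) where
  private
    nvˢ = proj₁ patternsˢ
    nvᵘ = proj₁ patternsᵘ

  mutual
    -- The root of `L` is visible in its restrictions: a function symbol shows in both, a 2nd-order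
    -- variable in the one that keeps it, while the other then begins with a function symbol because
    -- patterns are not variables. The arguments come back from the expanded pattern by linearity.
    amalgam-unique : (L L′ : Term F (Γ ∪ Δ) V) → keepˡ u L ≡ keepˡ u L′ → keepʳ s L ≡ keepʳ s L′ → L ≡ L′
    amalgam-unique (var x)           (var .x)          refl e′ = refl
    amalgam-unique (var x)           (fun g Ls)        ()   e′
    amalgam-unique (var x)           (app (inj₁ X) Ls) ()   e′
    amalgam-unique (var x)           (app (inj₂ Y) Ls) e    ()
    amalgam-unique (fun g Ls)        (var x)           ()   e′
    amalgam-unique (fun g Ls)        (fun h Ls′)       e    e′ with fun-symbol e
    ... | refl = cong (fun g) (amalgam-unique* Ls Ls′ (fun-injective e) (fun-injective e′))
    amalgam-unique (fun g Ls)        (app (inj₁ X) _)  ()   e′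
    amalgam-unique (fun g Ls)        (app (inj₂ Y) _)  e    ()
    amalgam-unique (app (inj₁ X) Ls) (var x)           ()   e′
    amalgam-unique (app (inj₂ Y) Ls) (var x)           e    ()
    amalgam-unique (app (inj₁ X) Ls) (fun g _)         ()   e′
    amalgam-unique (app (inj₂ Y) Ls) (fun g _)         e    ()
    amalgam-unique (app (inj₁ X) Ls) (app (inj₂ Y) _)  e    e′ = ⊥-elim (app≢pattern (nvᵘ Y) e)
    amalgam-unique (app (inj₂ Y) Ls) (app (inj₁ X) _)  e    e′ = ⊥-elim (app≢pattern (nvᵘ Y) (sym e))
    amalgam-unique (app (inj₁ X) Ls) (app (inj₁ X′) Ls′) e e′ with app-symbol e
    ... | refl = cong (app (inj₁ X)) (amalgam-unique* Ls Ls′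
                   (app-injective (trans (sym (keepˡ-app {s = s} X Ls)) (trans e (keepˡ-app {s = s} X Ls′))))
                   (subst₁-linear-injective (s X) (proj₂ patternsˢ X) e′))
    amalgam-unique (app (inj₂ Y) Ls) (app (inj₂ Y′) Ls′) e e′ with app-symbol e′
    ... | refl = cong (app (inj₂ Y)) (amalgam-unique* Ls Ls′
                   (subst₁-linear-injective (u Y) (proj₂ patternsᵘ Y) e)
                   (app-injective (trans (sym (keepʳ-app {u = u} Y Ls)) (trans e′ (keepʳ-app {u = u} Y Ls′)))))

    amalgam-unique* : (Ls Ls′ : Vec (Term F (Γ ∪ Δ) V) n) → keepˡ* u Ls ≡ keepˡ* u Ls′ → keepʳ* s Ls ≡ keepʳ* s Ls′ → Ls ≡ Ls′
    amalgam-unique* []       []         e e′ = refl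
    amalgam-unique* (L ∷ Ls) (L′ ∷ Ls′) e e′ = cong₂ _∷_
      (amalgam-unique L L′ (Vecₚ.∷-injectiveˡ e) (Vecₚ.∷-injectiveˡ e′))
      (amalgam-unique* Ls Ls′ (Vecₚ.∷-injectiveʳ e) (Vecₚ.∷-injectiveʳ e′))

-- Overlaps

disjoint? : ∀ m m′ → Dec (Disjoint m m′)
disjoint? plain _     = yes plainˡ
disjoint? start plain = yes plainʳ
disjoint? start start = no λ ()
disjoint? start cont  = no λ ()
disjoint? cont  plain = yes plainʳ
disjoint? cont  start = no λ ()
disjoint? cont  cont  = no λ ()

-- A path to the shared symbol, and not a mere negation of `_∥_`: `select` follows it to the
-- occurrence to be coloured.
data Overlap {F : Symbols} {V : Set} : MTerm F V → MTerm F V → Set where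
  here  : {g : F k} {m m′ : Mark} {ds ds′ : Vec (MTerm F V) k} →
          ¬ Disjoint m m′ → Overlap (fun (g , m) ds) (fun (g , m′) ds′)
  there : {g : F k} {m m′ : Mark} {ds ds′ : Vec (MTerm F V) k} (i : Fin k) →
          Overlap (Vec.lookup ds i) (Vec.lookup ds′ i) → Overlap (fun (g , m) ds) (fun (g , m′) ds′)

overlap-sym : {d d′ : MTerm F V} → Overlap d d′ → Overlap d′ d
overlap-sym (here ¬disjoint) = here (¬disjoint ∘ disjoint-sym)
overlap-sym (there i o)      = there i (overlap-sym o)

module _ {F : Symbols} {V : Set} where
  mutual
    -- The case distinction behind the theorem. Equality of symbols need not be decided, since both
    -- markings decorate the same term and only marks are compared.
    ∥-or-overlap : {d d′ : MTerm F V} → d ≈ᶻ d′ → d ∥ d′ ⊎ Overlap d d′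
    ∥-or-overlap (var x) = inj₁ (var x)
    ∥-or-overlap (fun g {m} {m′} _ zs) with disjoint? m m′ | ∥-or-overlap* zs
    ... | no ¬disjoint | _              = inj₂ (here ¬disjoint)
    ... | yes _        | inj₂ (i , o)   = inj₂ (there i o)
    ... | yes disjoint | inj₁ disjoints = inj₁ (fun g disjoint disjoints)

    ∥-or-overlap* : {ds ds′ : Vec (MTerm F V) n} → Pointwise _≈ᶻ_ ds ds′ →
                    Pointwise _∥_ ds ds′ ⊎ ∃[ i ] Overlap (Vec.lookup ds i) (Vec.lookup ds′ i)
    ∥-or-overlap* []       = inj₁ []
    ∥-or-overlap* (z ∷ zs) with ∥-or-overlap z | ∥-or-overlap* zs
    ... | inj₂ o | _            = inj₂ (Fin.zero , o)
    ... | inj₁ _ | inj₂ (i , o) = inj₂ (Fin.suc i , o)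
    ... | inj₁ p | inj₁ ps      = inj₁ (p ∷ ps)

  lookup-meet* : {ds ds′ : Vec (MTerm F V) n} (zs : Pointwise _≈ᶻ_ ds ds′) (i : Fin n) →
                 Vec.lookup (meet* zs) i ≡ meet (Pointwise.lookup zs i)
  lookup-meet* (z ∷ zs) Fin.zero    = refl
  lookup-meet* (z ∷ zs) (Fin.suc i) = lookup-meet* zs i

  lookup-label* : (m : Mark) (ts : Vec (FOTerm F V) n) (i : Fin n) →
                  Vec.lookup (label* m ts) i ≡ label m (Vec.lookup ts i)
  lookup-label* m (t ∷ ts) Fin.zero    = refl
  lookup-label* m (t ∷ ts) (Fin.suc i) = lookup-label* m ts i

  -- At the shared symbol the minimum of two non-plain marks is not plain, so the meet is not below
  -- the all-plain marking.
  overlap-meet : {d d′ : MTerm F V} → Overlap d d′ → (z : d ≈ᶻ d′) (t : FOTerm F V) → ¬ meet z ≤ᶻ label plain t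
  overlap-meet (here ¬disjoint) (fun _ {m} {m′} _ _) (fun _ _) (fun _ p _) = ¬disjoint (disjoint m m′ p)
    where
    disjoint : ∀ m m′ → m ⊓ᵐ m′ ≤ᵐ plain → Disjoint m m′
    disjoint plain m′    p = plainˡ
    disjoint start plain p = plainʳ
    disjoint cont  plain p = plainʳ
  overlap-meet (there i o) (fun _ _ zs) (fun _ ts) (fun _ _ ps) =
    overlap-meet o (Pointwise.lookup zs i) (Vec.lookup ts i)
      (transport₂ _≤ᶻ_ (lookup-meet* zs i) (lookup-label* plain ts i) (Pointwise.lookup ps i))

module _ {F : Symbols} {A V : Set} {τ : A → MTerm F V} where
  -- An overlap with a pattern is either with the pattern itself or with one of
  -- its arguments, and stays there when the other arguments change.
  Located : FOTerm F A → MTerm F V → (∀ {V} → FOTerm F V → MTerm F V) → Set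
  Located q e mk = (∀ τ′ → Overlap (subst₁ τ′ (mk q)) e) ⊎
    (Σ[ a ∈ A ] Σ[ e′ ∈ MTerm F V ] Overlap (τ a) e′ ×
      (∀ τ′ → Overlap (τ′ a) e′ → Overlap (subst₁ τ′ (label plain q)) e))

  mutual
    locate-label : {m : Mark} (q : FOTerm F A) {e : MTerm F V} → Overlap (subst₁ τ (label m q)) e →
                   Located q e (label m)
    locate-label (var a)    o                = inj₂ (a , _ , o , λ τ′ o′ → o′)
    locate-label (fun g qs) (here ¬disjoint) = inj₁ λ τ′ → here ¬disjoint
    locate-label (fun g qs) (there i o)      with locate-label* qs i o
    ... | inj₁ any               = inj₁ λ τ′ → there i (any τ′)
    ... | inj₂ (a , e′ , o′ , f) = inj₂ (a , e′ , o′ , λ τ′ o″ → there i (f τ′ o″))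

    locate-label* : {m : Mark} (qs : Vec (FOTerm F A) n) (i : Fin n) {e : MTerm F V} →
      Overlap (Vec.lookup (subst₁* τ (label* m qs)) i) e →
      (∀ τ′ → Overlap (Vec.lookup (subst₁* τ′ (label* m qs)) i) e) ⊎
      (Σ[ a ∈ A ] Σ[ e′ ∈ MTerm F V ] Overlap (τ a) e′ ×
        (∀ τ′ → Overlap (τ′ a) e′ → Overlap (Vec.lookup (subst₁* τ′ (label* plain qs)) i) e))
    locate-label* (q ∷ qs) Fin.zero    o = locate-label q o
    locate-label* (q ∷ qs) (Fin.suc i) o = locate-label* qs i o

  locate : (q : FOTerm F A) {e : MTerm F V} → Overlap (subst₁ τ (markPattern q)) e → Located q e markPattern
  locate (var a)    o                = inj₂ (a , _ , o , λ τ′ o′ → o′)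
  locate (fun g qs) (here ¬disjoint) = inj₁ λ τ′ → here ¬disjoint
  locate (fun g qs) (there i o)      with locate-label* qs i o
  ... | inj₁ any               = inj₁ λ τ′ → there i (any τ′)
  ... | inj₂ (a , e′ , o′ , f) = inj₂ (a , e′ , o′ , λ τ′ o″ → there i (f τ′ o″))

module _ {F Γ : Symbols} {s : ∀ {k} → Γ k → Abs F k} (linear : ∀ {k} (X : Γ k) → Linear (s X)) where
  private
    -- Forgets colours: `inj₁` colours the selected occurrence, `inj₂` all others.
    merge : ∀ {k} → (Γ ∪ Γ) k → Γ k
    merge = [ id , id ]′

  mutual
    arities-keepˡ-inj₂ : (t : Term F Γ V) → arities (keepˡ {Γ = Γ} s (rename₂ inj₂ t)) ≡ []
    arities-keepˡ-inj₂ (var x)    = refl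
    arities-keepˡ-inj₂ (fun g ts) = arities*-keepˡ*-inj₂ ts
    arities-keepˡ-inj₂ (app X ts) =
      trans (arities-subst₁-linear (s X) (linear X) (keepˡ* {Γ = Γ} s (rename₂* inj₂ ts))) (arities*-keepˡ*-inj₂ ts)

    arities*-keepˡ*-inj₂ : (ts : Vec (Term F Γ V) n) → arities* (keepˡ* {Γ = Γ} s (rename₂* inj₂ ts)) ≡ []
    arities*-keepˡ*-inj₂ []       = refl
    arities*-keepˡ*-inj₂ (t ∷ ts) = cong₂ _++_ (arities-keepˡ-inj₂ t) (arities*-keepˡ*-inj₂ ts)

  rename₂-merge-inj₂ : (t : Term F Γ V) → rename₂ merge (rename₂ inj₂ t) ≡ t
  rename₂-merge-inj₂ t = trans (rename₂-rename₂ t) (rename₂-id t)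

  rename₂*-merge-inj₂ : (ts : Vec (Term F Γ V) n) → rename₂* merge (rename₂* inj₂ ts) ≡ ts
  rename₂*-merge-inj₂ ts = trans (rename₂*-rename₂* ts) (rename₂*-id ts)

  mutual
    -- Exactly one occurrence goes to the left family, the one whose pattern contains the shared
    -- symbol. Restricting to that family expands every other occurrence, so one arity remains, and
    -- the overlap survives because its pattern is kept.
    select : (t : Term F Γ V) {e : MTerm F V} → Overlap (mark s t) e →
      Σ[ L ∈ Term F (Γ ∪ Γ) V ] rename₂ merge L ≡ t ×
        length (arities (keepˡ s L)) ≡ 1 × Overlap (mark s (keepˡ s L)) e
    select (fun g ts) (here ¬disjoint) = ⊥-elim (¬disjoint plainˡ)
    select (fun g ts) (there i o) with select* ts i o
    ... | Ls , merged , single , o′ = fun g Ls , cong (fun g) merged , single , there i o′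
    select {V} (app X ts) {e} o with locate (s X) o
    -- The shared symbol belongs to the pattern of this `X`, which is coloured; all occurrences in
    -- its arguments go to the complement.
    ... | inj₁ any =
      app (inj₁ X) Ls , cong (app X) (rename₂*-merge-inj₂ ts) ,
      trans (cong (length ∘ arities) keep) (cong (suc ∘ length) (arities*-keepˡ*-inj₂ ts)) ,
      subst (λ t → Overlap (mark s t) e) (sym keep) (any (Vec.lookup (mark* s (keepˡ* s Ls))))
      where
      Ls : Vec (Term F (Γ ∪ Γ) V) _
      Ls = rename₂* inj₂ ts
      keep : keepˡ s (app (inj₁ X) Ls) ≡ app X (keepˡ* s Ls)
      keep = keepˡ-app {s = s} X Ls
    -- The shared symbol lies below the pattern of `X`, in its `i`-th argument. So `X` joins the
    -- complement, and its pattern becomes plain symbols around the overlap.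
    ... | inj₂ (i , e′ , o′ , f) with select* ts i o′
    ... | Ls , merged , single , o″ =
      app (inj₂ X) Ls , cong (app X) merged ,
      trans (cong length (arities-subst₁-linear (s X) (linear X) (keepˡ* s Ls))) single ,
      subst (λ d → Overlap d e) (sym (mark-subst₁-embed (keepˡ* s Ls) (s X))) (f (Vec.lookup (mark* s (keepˡ* s Ls))) o″)

    select* : (ts : Vec (Term F Γ V) n) (i : Fin n) {e : MTerm F V} → Overlap (Vec.lookup (mark* s ts) i) e →
      Σ[ Ls ∈ Vec (Term F (Γ ∪ Γ) V) n ] rename₂* merge Ls ≡ ts ×
        length (arities* (keepˡ* s Ls)) ≡ 1 × Overlap (Vec.lookup (mark* s (keepˡ* s Ls)) i) e
    select* (t ∷ ts) Fin.zero o with select t o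
    ... | L , merged , single , o′ =
      L ∷ rename₂* inj₂ ts , cong₂ _∷_ merged (rename₂*-merge-inj₂ ts) ,
      trans (cong length (trans (cong (arities (keepˡ s L) ++_) (arities*-keepˡ*-inj₂ ts)) (Listₚ.++-identityʳ _))) single , o′
    select* (t ∷ ts) (Fin.suc i) o with select* ts i o
    ... | Ls , merged , single , o′ =
      rename₂ inj₂ t ∷ Ls , cong₂ _∷_ (rename₂-merge-inj₂ t) merged ,
      trans (cong (λ ks → length (ks ++ arities* (keepˡ* s Ls))) (arities-keepˡ-inj₂ t)) single , o′

-- Multisteps

lookup∈toList : {P : ℕ → Set} {xs : List ℕ} (ps : All P xs) {k : ℕ} (i : k ∈ xs) → (k , All.lookup ps i) ∈ All.toList ps
lookup∈toList (p ∷ ps) (here refl) = here refl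
lookup∈toList (p ∷ ps) (there i)   = there (lookup∈toList ps i)

toList-map-⊆ : {Γ B : Symbols} {xs : List ℕ} (f : ∀ {k} → Γ k → B k) (ps : All Γ xs) {bs : List (∃ B)} →
               (∀ {k} (X : Γ k) → (k , f X) ∈ bs) → All.toList (All.map f ps) ⊆ bs
toList-map-⊆ f (p ∷ ps) ∈bs (here refl) = ∈bs p
toList-map-⊆ f (p ∷ ps) ∈bs (there i)   = toList-map-⊆ f ps ∈bs i

module _ {F : Symbols} {V : Set} (w : FOTerm F V) where
  private
    none : ∀ {k} → ∅ k → Abs F k
    none ()

  -- The term `w` with no bindings has the least marking and is used to test candidates for the
  -- bottom element.
  patternless : Let F (Abs F) V
  patternless = canonise none w

  marks-patternless : marks patternless ≡ label plain w
  marks-patternless = begin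
    marks patternless       ≡⟨ marks-canonise {s = none} w ⟩
    mark none w             ≡⟨ cong (mark none) (embed-id w) ⟨
    mark none (embed w)     ≡⟨ mark-embed {s = none} w ⟩
    label plain w ∎
    where open ≡-Reasoning

  patternless-member : MultipatternOf w patternless
  patternless-member = record
    { multipattern = multipattern-canonise {s = none} w ((λ ()) , (λ ()))
    ; denotes      = begin
        ⟦ patternless ⟧         ≡⟨ erase-marks patternless ⟨
        erase (marks patternless) ≡⟨ cong erase marks-patternless ⟩
        erase (label plain w)   ≡⟨ erase-label plain w ⟩
        w ∎ }
    where open ≡-Reasoning

overlap⇒meet : {F : Symbols} {V : Set} {w : FOTerm F V} {ς ζ : Let F (Abs F) V}
               (p : MultipatternOf w ς) (q : MultipatternOf w ζ) → Overlap (marks ς) (marks ζ) →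
               ∃[ μ ] IsMeet w ς ζ μ × ¬ IsBottom w μ
-- A bottom element would refine `patternless`, so its marking would be plain throughout, against
-- `overlap-meet`.
overlap⇒meet {F} {V} {w} p q o = μ , proj₁ (proj₂ (isMeet-exists p q)) , λ bottom →
  overlap-meet o (marks-≈ᶻ p q) w (subst (_≤ᶻ label plain w) (proj₂ (proj₂ (isMeet-exists p q)))
    (subst (marks μ ≤ᶻ_) (marks-patternless w)
      (⊑⇒≤ (IsBottom.least bottom (patternless w) (patternless-member w)))))
  where
  μ : Let F (Abs F) V
  μ = proj₁ (isMeet-exists p q)

-- Residuals, and the decomposition of a coloured multistep

module LeftLinearMultisteps {F : Symbols} (R : TRS F) (leftLinear : LeftLinear R) (V : Set) where
  open TRS R
  open Multisteps R V

  -- Left-linearity enters here: deduplication fixes a duplicate-free list, so naming variables by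
  -- first occurrence becomes linearity and canonicity of the left-hand side.
  lhs-patterns : IsPatternAssignment lhs
  lhs-patterns = lhs-nonVariable , λ ϱ → trans (sym (unique⇒deduplicate (leftLinear ϱ))) (lhs-vars ϱ)

  module _ (Φ : RuleLet) where
    bound-src : ∀ {k} (X : k ∈ context Φ) → bound (src Φ) X ≡ lhs (bound Φ X)
    bound-src = Allₚ.lookup-map (binds Φ)

    bound-tgt : ∀ {k} (X : k ∈ context Φ) → bound (tgt Φ) X ≡ rhs (bound Φ X)
    bound-tgt = Allₚ.lookup-map (binds Φ)

    src-patterns : IsPatternAssignment (bound (src Φ))
    src-patterns = (λ X x e → lhs-nonVariable _ x (trans (sym (bound-src X)) e)) ,
                   (λ X → trans (cong vars (bound-src X)) (proj₂ lhs-patterns (bound Φ X)))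

    marks-src : marks (src Φ) ≡ mark lhs (toTerm Φ)
    marks-src = sym (mark-rename₂ {s = lhs} {f = bound Φ} (λ X → sym (bound-src X)) (body Φ))

    src-toTerm : ⟦ src Φ ⟧ ≡ subst₂ lhs (toTerm Φ)
    src-toTerm = trans (subst₂-cong {σ = bound (src Φ)} {σ′ = λ X → lhs (bound Φ X)} bound-src (body Φ))
                       (sym (subst₂-rename₂ {σ = lhs} {f = bound Φ} (body Φ)))

    tgt-toTerm : ⟦ tgt Φ ⟧ ≡ subst₂ rhs (toTerm Φ)
    tgt-toTerm = trans (subst₂-cong {σ = bound (tgt Φ)} {σ′ = λ X → rhs (bound Φ X)} bound-tgt (body Φ))
                       (sym (subst₂-rename₂ {σ = rhs} {f = bound Φ} (body Φ)))

    src-member : {w : FOTerm F V} → Multistep Φ → w ≡ ⟦ src Φ ⟧ → MultipatternOf w (src Φ)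
    src-member multistep source = record
      { multipattern = record
          { linearCanonical      = multistep
          ; nonVariable          = proj₁ src-patterns
          ; boundLinearCanonical = proj₂ src-patterns }
      ; denotes = sym source }

  module _ {w : FOTerm F V} {Φ Ψ : RuleLet} (p : MultipatternOf w (src Φ)) (q : MultipatternOf w (src Ψ)) where
    open MultipatternOf

    -- Any meet is a common lower bound of disjoint markings, hence the bottom element.
    ∥⇒nonOverlapping : marks (src Φ) ∥ marks (src Ψ) → NonOverlapping w Φ Ψ
    ∥⇒nonOverlapping disjoint (μ , meet , notBottom) = notBottom record
      { member = member
      ; least  = λ ν r → ≤⇒⊑ (multipattern member) (multipattern r)
                   (disjoint-lower-bound (⊑⇒≤ lowerˡ) (⊑⇒≤ lowerʳ) disjoint (marks-≈ᶻ member r)) }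
      where open IsMeet meet

    overlap⇒overlapping : Overlap (marks (src Φ)) (marks (src Ψ)) → Overlapping w Φ Ψ
    overlap⇒overlapping = overlap⇒meet p q

    ∥⇒joinBody : marks (src Φ) ∥ marks (src Ψ) → JoinBody w Φ Ψ
    ∥⇒joinBody disjoint with amalgamate (src-patterns Φ) (src-patterns Ψ) (body Φ) (body Ψ) disjoint
    ... | L , L≡Φ , L≡Ψ = record
      { L         = L
      ; instʳ-lhs = L≡Φ
      ; instˡ-lhs = L≡Ψ
      ; isJoin    = record
          { member = record
              { multipattern = join-multipattern
              ; denotes      = trans (sym (erase-marks μ)) (trans (sym (erase-zip (join-≤ˡ join)))
                                 (trans (erase-marks (src Φ)) (denotes p))) }
          ; upperˡ = ≤⇒⊑ (multipattern p) join-multipattern (join-≤ˡ join)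
          ; upperʳ = ≤⇒⊑ (multipattern q) join-multipattern (join-≤ʳ join)
          ; least  = λ ν r Φ⊑ν Ψ⊑ν → ≤⇒⊑ join-multipattern (multipattern r)
                       (join-least join (⊑⇒≤ Φ⊑ν) (⊑⇒≤ Ψ⊑ν)) } }
      where
      patterns : ∀ {k} → ((_∈ context Φ) ∪ (_∈ context Ψ)) k → Abs F k
      patterns = [ bound (src Φ) , bound (src Ψ) ]′
      μ : Let F (Abs F) V
      μ = canonise patterns L
      join-multipattern : Multipattern μ
      join-multipattern = multipattern-canonise {s = patterns} L
        ( (λ { (inj₁ X) → proj₁ (src-patterns Φ) X ; (inj₂ Y) → proj₁ (src-patterns Ψ) Y })
        , (λ { (inj₁ X) → proj₂ (src-patterns Φ) X ; (inj₂ Y) → proj₂ (src-patterns Ψ) Y }) )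
      ≡-Join : {a a′ b b′ c c′ : MTerm F V} → a ≡ a′ → b ≡ b′ → c ≡ c′ → Join a b c → Join a′ b′ c′
      ≡-Join refl refl refl j = j
      join : Join (marks (src Φ)) (marks (src Ψ)) (marks μ)
      join = ≡-Join (cong (mark _) L≡Φ) (cong (mark _) L≡Ψ) (sym (marks-canonise {s = patterns} L))
               (join-mark {s = bound (src Φ)} {u = bound (src Ψ)} L)

  module _ {w : FOTerm F V} {Φ Ψ : RuleLet} (J : JoinBody w Φ Ψ) where
    open JoinBody J

    private
      rules : ∀ {k} → ((_∈ context Φ) ∪ (_∈ context Ψ)) k → Rule k
      rules = [ bound Φ , bound Ψ ]′

    toTerm-join : toTerm join ≡ rename₂ rules L
    toTerm-join = toTerm-canonise {B = Rule} rules L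

    tgt-join : ⟦ tgt join ⟧ ≡ subst₂ [ bound (tgt Φ) , bound (tgt Ψ) ]′ L
    tgt-join = trans (tgt-toTerm join) (trans (cong (subst₂ rhs) toTerm-join)
      (trans (subst₂-rename₂ {σ = rhs} {f = rules} L) (subst₂-cong
        {σ = λ X → rhs (rules X)} {σ′ = [ bound (tgt Φ) , bound (tgt Ψ) ]′}
        (λ { (inj₁ X) → sym (bound-tgt Φ X) ; (inj₂ Y) → sym (bound-tgt Ψ Y) }) L)))

    -- All corners of the square are instances of `L`, with left-hand or right-hand sides chosen
    -- separately for `Φ` and `Ψ`. Right-hand sides for `Φ` and left-hand sides for `Ψ` give both
    -- the target of `Φ` and the source of the residual; right-hand sides for both give the target
    -- of the join.
    residualʳ-⊸ : residualʳ ∶ ⟦ tgt Φ ⟧ ⊸ ⟦ tgt join ⟧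
    residualʳ-⊸ = record
      { multistep = canonise-linearCanonical {B = Rule} (bound Ψ) t
      ; source    = begin
          ⟦ tgt Φ ⟧                                     ≡⟨ cong (subst₂ (bound (tgt Φ))) instʳ-lhs ⟨
          subst₂ (bound (tgt Φ)) (keepˡ (bound (src Ψ)) L) ≡⟨ subst₂-keepˡ L ⟩
          subst₂ [ bound (tgt Φ) , bound (src Ψ) ]′ L     ≡⟨ subst₂-keepʳ L ⟨
          subst₂ (bound (src Ψ)) t                        ≡⟨ subst₂-cong {σ = bound (src Ψ)} {σ′ = λ X → lhs (bound Ψ X)} (bound-src Ψ) t ⟩
          subst₂ (λ X → lhs (bound Ψ X)) t                ≡⟨ subst₂-rename₂ {σ = lhs} {f = bound Ψ} t ⟨
          subst₂ lhs (rename₂ (bound Ψ) t)                ≡⟨ cong (subst₂ lhs) (toTerm-canonise {B = Rule} (bound Ψ) t) ⟨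
          subst₂ lhs (toTerm residualʳ)                   ≡⟨ src-toTerm residualʳ ⟨
          ⟦ src residualʳ ⟧ ∎
      ; target    = begin
          ⟦ tgt join ⟧                                    ≡⟨ tgt-join ⟩
          subst₂ [ bound (tgt Φ) , bound (tgt Ψ) ]′ L     ≡⟨ subst₂-keepʳ L ⟨
          subst₂ (bound (tgt Ψ)) t                        ≡⟨ subst₂-cong {σ = bound (tgt Ψ)} {σ′ = λ X → rhs (bound Ψ X)} (bound-tgt Ψ) t ⟩
          subst₂ (λ X → rhs (bound Ψ X)) t                ≡⟨ subst₂-rename₂ {σ = rhs} {f = bound Ψ} t ⟨
          subst₂ rhs (rename₂ (bound Ψ) t)                ≡⟨ cong (subst₂ rhs) (toTerm-canonise {B = Rule} (bound Ψ) t) ⟨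
          subst₂ rhs (toTerm residualʳ)                   ≡⟨ tgt-toTerm residualʳ ⟨
          ⟦ tgt residualʳ ⟧ ∎ }
      where
      open ≡-Reasoning
      t : Term F (_∈ context Ψ) V
      t = instˡ (bound (tgt Φ))

    residualˡ-⊸ : residualˡ ∶ ⟦ tgt Ψ ⟧ ⊸ ⟦ tgt join ⟧
    residualˡ-⊸ = record
      { multistep = canonise-linearCanonical {B = Rule} (bound Φ) t
      ; source    = begin
          ⟦ tgt Ψ ⟧                                     ≡⟨ cong (subst₂ (bound (tgt Ψ))) instˡ-lhs ⟨
          subst₂ (bound (tgt Ψ)) (keepʳ (bound (src Φ)) L) ≡⟨ subst₂-keepʳ L ⟩
          subst₂ [ bound (src Φ) , bound (tgt Ψ) ]′ L     ≡⟨ subst₂-keepˡ L ⟨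
          subst₂ (bound (src Φ)) t                        ≡⟨ subst₂-cong {σ = bound (src Φ)} {σ′ = λ X → lhs (bound Φ X)} (bound-src Φ) t ⟩
          subst₂ (λ X → lhs (bound Φ X)) t                ≡⟨ subst₂-rename₂ {σ = lhs} {f = bound Φ} t ⟨
          subst₂ lhs (rename₂ (bound Φ) t)                ≡⟨ cong (subst₂ lhs) (toTerm-canonise {B = Rule} (bound Φ) t) ⟨
          subst₂ lhs (toTerm residualˡ)                   ≡⟨ src-toTerm residualˡ ⟨
          ⟦ src residualˡ ⟧ ∎
      ; target    = begin
          ⟦ tgt join ⟧                                    ≡⟨ tgt-join ⟩
          subst₂ [ bound (tgt Φ) , bound (tgt Ψ) ]′ L     ≡⟨ subst₂-keepˡ L ⟨
          subst₂ (bound (tgt Φ)) t                        ≡⟨ subst₂-cong {σ = bound (tgt Φ)} {σ′ = λ X → rhs (bound Φ X)} (bound-tgt Φ) t ⟩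
          subst₂ (λ X → rhs (bound Φ X)) t                ≡⟨ subst₂-rename₂ {σ = rhs} {f = bound Φ} t ⟨
          subst₂ rhs (rename₂ (bound Φ) t)                ≡⟨ cong (subst₂ rhs) (toTerm-canonise {B = Rule} (bound Φ) t) ⟨
          subst₂ rhs (toTerm residualˡ)                   ≡⟨ tgt-toTerm residualˡ ⟨
          ⟦ tgt residualˡ ⟧ ∎ }
      where
      open ≡-Reasoning
      t : Term F (_∈ context Φ) V
      t = instʳ (bound (tgt Ψ))

    ruleSymbols-residualʳ : ruleSymbols residualʳ ⊆ ruleSymbols Ψ
    ruleSymbols-residualʳ = toList-map-⊆ (bound Ψ) (occurrences (instˡ (bound (tgt Φ)))) (lookup∈toList (binds Ψ))

    ruleSymbols-residualˡ : ruleSymbols residualˡ ⊆ ruleSymbols Φ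
    ruleSymbols-residualˡ = toList-map-⊆ (bound Φ) (occurrences (instʳ (bound (tgt Ψ)))) (lookup∈toList (binds Φ))

    -- L with variable names replaced by rule symbols still restricts to the
    -- proof terms of both multisteps, hence is determined by them.
    private
      name : ∀ {k} → ((_∈ context Φ) ∪ (_∈ context Ψ)) k → (Rule ∪ Rule) k
      name = [ (λ X → inj₁ (bound Φ X)) , (λ Y → inj₂ (bound Ψ Y)) ]′

      L′ : Term F (Rule ∪ Rule) V
      L′ = rename₂ name L

    keepˡ-rules : keepˡ lhs L′ ≡ toTerm Φ
    keepˡ-rules = begin
      keepˡ lhs L′
        ≡⟨ subst₂-rename₂ {σ = [ generic , (λ Y → embed (lhs Y)) ]′} {f = name} L ⟩
      subst₂ σ L
        ≡⟨ subst₂-cong {σ = σ} {σ′ = σ′} pointwise L ⟩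
      subst₂ σ′ L
        ≡⟨ rename₂-subst₂ {f = bound Φ} L ⟨
      rename₂ (bound Φ) (keepˡ (bound (src Ψ)) L)
        ≡⟨ cong (rename₂ (bound Φ)) instʳ-lhs ⟩
      toTerm Φ ∎
      where
      open ≡-Reasoning
      σ σ′ : Subst₂ F ((_∈ context Φ) ∪ (_∈ context Ψ)) Rule
      σ X = [ generic , (λ Y → embed (lhs Y)) ]′ (name X)
      σ′ X = rename₂ (bound Φ) ([ generic , (λ Y → embed (bound (src Ψ) Y)) ]′ X)
      pointwise : ∀ {k} (X : ((_∈ context Φ) ∪ (_∈ context Ψ)) k) → σ X ≡ σ′ X
      pointwise (inj₁ X) = sym (rename₂-generic {f = bound Φ} X)
      pointwise (inj₂ Y) = trans (cong embed (sym (bound-src Ψ Y))) (sym (rename₂-embed {f = bound Φ} (bound (src Ψ) Y)))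

    keepʳ-rules : keepʳ lhs L′ ≡ toTerm Ψ
    keepʳ-rules = begin
      keepʳ lhs L′
        ≡⟨ subst₂-rename₂ {σ = [ (λ X → embed (lhs X)) , generic ]′} {f = name} L ⟩
      subst₂ σ L
        ≡⟨ subst₂-cong {σ = σ} {σ′ = σ′} pointwise L ⟩
      subst₂ σ′ L
        ≡⟨ rename₂-subst₂ {f = bound Ψ} L ⟨
      rename₂ (bound Ψ) (keepʳ (bound (src Φ)) L)
        ≡⟨ cong (rename₂ (bound Ψ)) instˡ-lhs ⟩
      toTerm Ψ ∎
      where
      open ≡-Reasoning
      σ σ′ : Subst₂ F ((_∈ context Φ) ∪ (_∈ context Ψ)) Rule
      σ X = [ (λ X → embed (lhs X)) , generic ]′ (name X)
      σ′ X = rename₂ (bound Ψ) ([ (λ X → embed (bound (src Φ) X)) , generic ]′ X)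
      pointwise : ∀ {k} (X : ((_∈ context Φ) ∪ (_∈ context Ψ)) k) → σ X ≡ σ′ X
      pointwise (inj₁ X) = trans (cong embed (sym (bound-src Φ X))) (sym (rename₂-embed {f = bound Ψ} (bound (src Φ) X)))
      pointwise (inj₂ Y) = sym (rename₂-generic {f = bound Ψ} Y)

    -- A colouring `K` and the body `L` of a join arise independently and over different names. Once
    -- `L` is renamed to rule symbols, both have the same two restrictions, so they coincide.
    merge-determined : (K : Term F (Rule ∪ Rule) V) → keepˡ lhs K ≡ toTerm Φ → keepʳ lhs K ≡ toTerm Ψ →
                       rename₂ [ id , id ]′ K ≡ toTerm join
    merge-determined K e e′ = begin
      rename₂ [ id , id ]′ K
        ≡⟨ cong (rename₂ [ id , id ]′) (amalgam-unique lhs-patterns lhs-patterns K L′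
             (trans e (sym keepˡ-rules)) (trans e′ (sym keepʳ-rules))) ⟩
      rename₂ [ id , id ]′ L′
        ≡⟨ rename₂-rename₂ {f = [ id , id ]′} {g = name} L ⟩
      rename₂ (λ X → [ id , id ]′ (name X)) L
        ≡⟨ rename₂-cong (λ { (inj₁ X) → refl ; (inj₂ Y) → refl }) L ⟩
      rename₂ rules L
        ≡⟨ toTerm-join ⟨
      toTerm join ∎
      where open ≡-Reasoning

  fromTerm : Term F Rule V → RuleLet
  fromTerm = canonise id

  toTerm-fromTerm : (t : Term F Rule V) → toTerm (fromTerm t) ≡ t
  toTerm-fromTerm t = trans (toTerm-canonise {B = Rule} id t) (rename₂-id t)

  marks-fromTerm : (t : Term F Rule V) → marks (src (fromTerm t)) ≡ mark lhs t
  marks-fromTerm t = trans (marks-src (fromTerm t)) (cong (mark lhs) (toTerm-fromTerm t))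

  fromTerm-multistep : (t : Term F Rule V) → Multistep (fromTerm t)
  fromTerm-multistep = canonise-linearCanonical {B = Rule} id

  module _ {w : FOTerm F V} {Φ : RuleLet} (multistep : Multistep Φ) (source : w ≡ ⟦ src Φ ⟧)
           (K : Term F (Rule ∪ Rule) V) (merged : rename₂ [ id , id ]′ K ≡ toTerm Φ) where
    private
      φ ρ : RuleLet
      φ = fromTerm (keepˡ lhs K)
      ρ = fromTerm (keepʳ lhs K)

      w≡K : w ≡ subst₂ [ lhs , lhs ]′ K
      w≡K = trans source (trans (src-toTerm Φ) (trans (cong (subst₂ lhs) (sym merged))
        (trans (subst₂-rename₂ {σ = lhs} {f = [ id , id ]′} K)
          (subst₂-cong {σ = λ X → lhs ([ id , id ]′ X)} {σ′ = [ lhs , lhs ]′} (λ { (inj₁ X) → refl ; (inj₂ Y) → refl }) K))))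

    -- Restricting to one colour expands the other by left-hand sides, which leaves the source term
    -- unchanged.
    part-source : w ≡ ⟦ src φ ⟧
    part-source = trans w≡K (trans (sym (subst₂-keepˡ {s = lhs} {u = lhs} K))
      (trans (cong (subst₂ lhs) (sym (toTerm-fromTerm (keepˡ lhs K)))) (sym (src-toTerm φ))))

    rest-source : w ≡ ⟦ src ρ ⟧
    rest-source = trans w≡K (trans (sym (subst₂-keepʳ {s = lhs} {u = lhs} K))
      (trans (cong (subst₂ lhs) (sym (toTerm-fromTerm (keepʳ lhs K)))) (sym (src-toTerm ρ))))

    private
      φ-member : MultipatternOf w (src φ)
      φ-member = src-member φ (fromTerm-multistep (keepˡ lhs K)) part-source
      ρ-member : MultipatternOf w (src ρ)
      ρ-member = src-member ρ (fromTerm-multistep (keepʳ lhs K)) rest-source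
      disjoint : marks (src φ) ∥ marks (src ρ)
      disjoint = transport₂ _∥_ (sym (marks-fromTerm (keepˡ lhs K))) (sym (marks-fromTerm (keepʳ lhs K)))
                   (join-∥ (join-mark {s = lhs} {u = lhs} K))
      J : JoinBody w φ ρ
      J = ∥⇒joinBody {Φ = φ} {Ψ = ρ} φ-member ρ-member disjoint
      -- Membership asks for an equation between let-expressions. Both sides are linear canonical,
      -- so it reduces to one between terms, where `K` links `Φ` to the join.
      Φ≡join : Φ ≡ JoinBody.join J
      Φ≡join = toTerm-injective Φ (JoinBody.join J) multistep
        (canonise-linearCanonical {B = Rule} [ bound φ , bound ρ ]′ (JoinBody.L J))
        (trans (sym merged) (merge-determined J K (sym (toTerm-fromTerm (keepˡ lhs K))) (sym (toTerm-fromTerm (keepʳ lhs K)))))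

    part∈ : φ ∈[ w ] Φ
    part∈ = record
      { rest           = ρ
      ; rest-multistep = fromTerm-multistep (keepʳ lhs K)
      ; rest-source    = rest-source
      ; nonOverlapping = ∥⇒nonOverlapping {Φ = φ} {Ψ = ρ} φ-member ρ-member disjoint
      ; joinBody       = J
      ; decomposition  = Φ≡join }

    -- The residual leads from the target of `φ` to the target of the join, and the join is `Φ`.
    part-⊸ : {t : FOTerm F V} → t ≡ ⟦ tgt Φ ⟧ → _∈[_]_.residual part∈ ∶ ⟦ tgt φ ⟧ ⊸ t
    part-⊸ target = subst (_∈[_]_.residual part∈ ∶ ⟦ tgt φ ⟧ ⊸_)
                          (trans (cong (λ Ξ → ⟦ tgt Ξ ⟧) (sym Φ≡join)) (sym target)) (residualʳ-⊸ J)

    part-⟶ : length (arities (keepˡ lhs K)) ≡ 1 → φ ∶ w ⟶ ⟦ tgt φ ⟧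
    -- The context produced by `canonise` is the list of arities of the term, so one arity means one
    -- binding.
    part-⟶ single = single , record { multistep = fromTerm-multistep (keepˡ lhs K) ; source = part-source ; target = refl }

lemma5 : (F : Symbols) (V : Set) (R : TRS F) → LeftLinear R →
    let open Multisteps R V in
    (Φ Ψ : RuleLet) (w t s : FOTerm F V) → Φ ∶ w ⊸ t → Ψ ∶ w ⊸ s →
    (NonOverlapping w Φ Ψ ×
    (Σ[ J ∈ JoinBody w Φ Ψ ]
    let Φ/Ψ = JoinBody.residualˡ J in
    let Ψ/Φ = JoinBody.residualʳ J in
    ∃[ v ] (Ψ/Φ ∶ t ⊸ v × Φ/Ψ ∶ s ⊸ v ×
    ruleSymbols Ψ/Φ ⊆ ruleSymbols Ψ × ruleSymbols Φ/Ψ ⊆ ruleSymbols Φ)))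
    ⊎
    (∃[ φ ] ∃[ ψ ] ∃[ t′ ] ∃[ s′ ]
    Σ[ φ∈Φ ∈ φ ∈[ w ] Φ ] Σ[ ψ∈Ψ ∈ ψ ∈[ w ] Ψ ]
    let Φ/φ = _∈[_]_.residual φ∈Φ in
    let Ψ/ψ = _∈[_]_.residual ψ∈Ψ in
    (Overlapping w φ ψ ×
    φ ∶ w ⟶ t′ × Φ/φ ∶ t′ ⊸ t ×
    ψ ∶ w ⟶ s′ × Ψ/ψ ∶ s′ ⊸ s))
lemma5 F V R leftLinear Φ Ψ w t s
  record { multistep = msΦ ; source = srcΦ ; target = refl }
  record { multistep = msΨ ; source = srcΨ ; target = refl } = result (∥-or-overlap (marks-≈ᶻ Φ-member Ψ-member))
  where
  open TRS R using (Rule; lhs)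
  open Multisteps R V
  open LeftLinearMultisteps R leftLinear V

  Φ-member : MultipatternOf w (src Φ)
  Φ-member = src-member Φ msΦ srcΦ
  Ψ-member : MultipatternOf w (src Ψ)
  Ψ-member = src-member Ψ msΨ srcΨ

  horizontal : (K : Term F (Rule ∪ Rule) V) → rename₂ [ id , id ]′ K ≡ toTerm Φ → length (arities (keepˡ lhs K)) ≡ 1 →
    (K′ : Term F (Rule ∪ Rule) V) → rename₂ [ id , id ]′ K′ ≡ toTerm Ψ → length (arities (keepˡ lhs K′)) ≡ 1 →
    Overlap (mark lhs (keepˡ lhs K′)) (mark lhs (keepˡ lhs K)) →
    ∃[ φ ] ∃[ ψ ] ∃[ t′ ] ∃[ s′ ] Σ[ φ∈Φ ∈ φ ∈[ w ] Φ ] Σ[ ψ∈Ψ ∈ ψ ∈[ w ] Ψ ]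
      (Overlapping w φ ψ ×
       φ ∶ w ⟶ t′ × _∈[_]_.residual φ∈Φ ∶ t′ ⊸ ⟦ tgt Φ ⟧ ×
       ψ ∶ w ⟶ s′ × _∈[_]_.residual ψ∈Ψ ∶ s′ ⊸ ⟦ tgt Ψ ⟧)
  horizontal K K-merged K-single K′ K′-merged K′-single o =
      φ , ψ , ⟦ tgt φ ⟧ , ⟦ tgt ψ ⟧
    , part∈ {Φ = Φ} msΦ srcΦ K K-merged , part∈ {Φ = Ψ} msΨ srcΨ K′ K′-merged
    , overlap⇒overlapping {Φ = φ} {ψ}
        (src-member φ (fromTerm-multistep (keepˡ lhs K)) (part-source {Φ = Φ} msΦ srcΦ K K-merged))
        (src-member ψ (fromTerm-multistep (keepˡ lhs K′)) (part-source {Φ = Ψ} msΨ srcΨ K′ K′-merged))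
        (transport₂ Overlap (sym (marks-fromTerm (keepˡ lhs K))) (sym (marks-fromTerm (keepˡ lhs K′))) (overlap-sym o))
    , part-⟶ {Φ = Φ} msΦ srcΦ K K-merged K-single , part-⊸ {Φ = Φ} msΦ srcΦ K K-merged refl
    , part-⟶ {Φ = Ψ} msΨ srcΨ K′ K′-merged K′-single , part-⊸ {Φ = Ψ} msΨ srcΨ K′ K′-merged refl
    where
    φ ψ : RuleLet
    φ = fromTerm (keepˡ lhs K)
    ψ = fromTerm (keepˡ lhs K′)

  result : marks (src Φ) ∥ marks (src Ψ) ⊎ Overlap (marks (src Φ)) (marks (src Ψ)) → _
  result (inj₁ disjoint) = inj₁
    ( ∥⇒nonOverlapping {Φ = Φ} {Ψ} Φ-member Ψ-member disjoint
    -- The common reduct found by unification is the target of the join, in which both residuals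
    -- end.
    , J , _ , residualʳ-⊸ J , residualˡ-⊸ J
    , (λ {_} → ruleSymbols-residualʳ J) , (λ {_} → ruleSymbols-residualˡ J) )
    where
    J : JoinBody w Φ Ψ
    J = ∥⇒joinBody {Φ = Φ} {Ψ} Φ-member Ψ-member disjoint
  result (inj₂ o) =
    let K  , K-merged  , K-single  , o′ = select (proj₂ lhs-patterns) (toTerm Φ) (subst (λ d → Overlap d (marks (src Ψ))) (marks-src Φ) o)
        -- The second selection is made against the step already chosen from `Φ` instead of against
        -- `Φ`, so that the two steps overlap each other.
        K′ , K′-merged , K′-single , o″ = select (proj₂ lhs-patterns) (toTerm Ψ)
          (subst (λ d → Overlap d (mark lhs (keepˡ lhs K))) (marks-src Ψ) (overlap-sym o′))
    in inj₂ (horizontal K K-merged K-single K′ K′-merged K′-single o″)
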